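{- Let $n\geq 1$. List the set of partitions of $n$ in weakly increasing order of crank, and separately in weakly increasing order of rank; ties may be broken arbitrarily in each list. Define $\tau_n$ as the bijection on the set of partitions of $n$ that sends the $i$-th partition in the crank-ordered list to the $i$-th partition in the rank-ordered list. Then for every partition $\lambda$ of $n$, \[ \operatorname{crank}(\lambda)-\operatorname{rank}(\tau_n(\lambda))=\begin{cases}0 & \text{if } \operatorname{crank}(\lambda)=0,\\ 0\text{ or }1 & \text{if } \operatorname{crank}(\lambda)>0,\\ 0\text{ or }-1 & \text{if } \operatorname{crank}(\lambda)<0.\end{cases} \]
   Context: For a partition $\lambda$, $\operatorname{rank}(\lambda)$ is its largest part minus its number of parts. $\operatorname{crank}(\lambda)$ is the largest part of $\lambda$ if $\lambda$ contains no part equal to $1$; otherwise it is the number of parts larger than the number of ones minus the number of ones. -}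

module Defs where

open import Data.Fin as Fin using (Fin)
open import Data.Fin.Permutation using (cast-id; ↔⇒≡)
open import Data.Integer as ℤ using (ℤ; +_)
open import Data.List using (List; filter; length)
open import Data.List.Extrema.Nat using (max)
open import Data.List.Relation.Unary.All using (All)
open import Data.List.Relation.Unary.Linked using (Linked)
open import Data.Nat using (ℕ; zero; suc; _≥_; _>_; _≟_; _>?_)
open import Data.Nat.ListAction using (sum)
open import Function using (_↔_; Inverse)
open import Function.Construct.Composition using (_↔-∘_)
open import Function.Construct.Symmetry using (↔-sym)
open import Relation.Binary.PropositionalEquality using (_≡_)

-- The three proof fields are propositions, so two partitions are
-- propositionally equal exactly when their lists of parts are.
record Partition (n : ℕ) : Set where
  constructor mkPartition
  field
    parts      : List ℕ
    decreasing : Linked _≥_ parts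
    positive   : All (_> 0) parts
    sum≡n      : sum parts ≡ n

open Partition public

-- The default value 0 is only attained by the empty partition.
largestPart : ∀ {n} → Partition n → ℕ
largestPart p = max 0 (parts p)

numParts : ∀ {n} → Partition n → ℕ
numParts p = length (parts p)

numOnes : ∀ {n} → Partition n → ℕ
numOnes p = length (filter (_≟ 1) (parts p))

numPartsLargerThan : ∀ {n} → ℕ → Partition n → ℕ
numPartsLargerThan k p = length (filter (_>? k) (parts p))

rank : ∀ {n} → Partition n → ℤ
rank p = + largestPart p ℤ.- + numParts p

crank : ∀ {n} → Partition n → ℤ
crank p with numOnes p
... | zero      = + largestPart p
... | ω@(suc _) = + numPartsLargerThan ω p ℤ.- + ω

-- A list containing every partition of n exactly once, in weakly increasing
-- order of the given statistic; the order among ties is unconstrained.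
record OrderedListing (n : ℕ) (stat : Partition n → ℤ) : Set where
  field
    size       : ℕ
    enumerate  : Fin size ↔ Partition n
    increasing : ∀ {i j} → i Fin.≤ j →
                 stat (Inverse.to enumerate i) ℤ.≤ stat (Inverse.to enumerate j)

open OrderedListing public

sizes-agree : ∀ {n s t} (C : OrderedListing n s) (R : OrderedListing n t) →
              size C ≡ size R
sizes-agree C R = ↔⇒≡ (↔-sym (enumerate R) ↔-∘ enumerate C)

-- The i-th partition listed by C is sent to the i-th partition listed by R;
-- cast-id is the value-preserving bijection Fin (size C) ↔ Fin (size R).
τ : ∀ {n s t} → OrderedListing n s → OrderedListing n t →
    Partition n ↔ Partition n
τ C R = enumerate R ↔-∘ (cast-id (sizes-agree C R) ↔-∘ ↔-sym (enumerate C))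

{-# OPTIONS --safe #-}
module Submission where

-- Write C_m for the generating function of the partitions of crank ≥ m, and R_m for rank ≥ m. Both are sums over
-- J ≥ 1 of q^(J(J+m-1)) times a count of multisets of parts carrying charges +1 and -1: for the rank by dissection along
-- the largest rectangle J × (J+m-1), for the crank by sorting the partitions according to their ones and telescoping in m.
-- A hockey-stick identity for such counts yields an exact relation C_m + X = R_m + q^m + Y with explicit X, Y ≥ 0.
-- It gives C_m ≤ R_(m-1) at once, and R_m ≤ C_m after X ≤ q^m + Y, which is proved summand by summand with a reflection
-- principle (charge j - i is at least as frequent as charge j + i) and insertions of parts.
-- Since both statistics are symmetric about 0 (the crank for n ≥ 2), the inequalities R_m ≤ C_m ≤ R_(m-1) confine
-- the rank at the i-th place of one sorted listing to the values allowed by the crank at the i-th place of the other.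

open import Defs
open import Data.Bool using (if_then_else_)
open import Data.Fin as Fin using (Fin; toℕ)
open import Data.Fin.Properties using (toℕ-cast)
open import Data.Integer as ℤ using (ℤ; -[1+_]; 0ℤ; 1ℤ; -1ℤ; _-_)
import Data.Integer.Properties as ℤₚ
open import Data.List using (List; []; _∷_; _++_; map; length; filter; tabulate)
open import Data.List.Extrema.Nat using (max; max≈v⁺)
open import Data.List.Membership.Propositional using (_∈_)
open import Data.List.Membership.Propositional.Properties using (∈-∃++; ∈-++⁺ˡ; ∈-++⁺ʳ; ∈-++⁻; ∈-map⁺; ∈-map⁻; ∈-tabulate⁺; ∈-tabulate⁻)
open import Data.List.Membership.Propositional.Properties.WithK using (unique∧set⇒bag)
open import Data.List.Properties using (map-++; map-∘; ++-identityʳ; ∷-injectiveʳ; filter-accept; filter-reject; length-filter; map-tabulate; tabulate-cong)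
open import Data.List.Relation.Binary.BagAndSetEquality using (∼bag⇒↭)
open import Data.List.Relation.Binary.Permutation.Propositional using (_↭_; refl; prep; swap; trans; ↭-sym; ↭-reflexive)
open import Data.List.Relation.Binary.Permutation.Propositional.Properties as ↭ using (shift; ++-comm; ++⁺ʳ; ++⁺ˡ; ∈-resp-↭)
open import Data.List.Relation.Unary.All as All using (All; []; _∷_)
open import Data.List.Relation.Unary.AllPairs using ([]; _∷_)
open import Data.List.Relation.Unary.Any using (here; there)
open import Data.List.Relation.Unary.Linked as Linked using (Linked; [-]; _∷_)
open import Data.List.Relation.Unary.Linked.Properties using (Linked⇒All)
open import Data.List.Relation.Unary.Unique.Propositional using (Unique)
import Data.List.Relation.Unary.Unique.Propositional.Properties as Unq
open import Data.Nat using (ℕ; zero; suc; _+_; _*_; _∸_; _≤_; _<_; _≥_; _>_; _≟_; _>?_; z≤n; s≤s)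
open import Data.Nat.Induction using (<-rec)
open import Data.Nat.ListAction using (sum)
open import Data.Nat.ListAction.Properties using (sum-++; sum-↭)
open import Data.Nat.Properties
open import Data.Nat.Solver using (module +-*-Solver)
open import Data.Product using (Σ; _×_; _,_; ∃-syntax)
open import Data.Sum using (_⊎_; inj₁; inj₂)
open import Data.Unit using (⊤; tt)
open import Function using (Inverse; _↔_; mk⇔; _∘_; id)
open import Relation.Binary.PropositionalEquality as ≡ using (_≡_; _≢_; _≗_; refl; sym; cong; cong₂; subst; subst₂)
open import Relation.Nullary using (¬_; yes; no; does; contradiction)
open import Relation.Nullary.Decidable using (dec-true; dec-false)

-- The charge encodes the rank: a column right of the rectangle J × (J + c) adds 1 to the largest
-- part, a row below it adds 1 to the number of parts, so the rank is c plus the charge. Throughout,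
-- M stands for m - 1 and j for J - 1. Extracting a part turns a count into a recursion that refers
-- to itself only in lower degrees, and two counts are compared by matching such recursions
-- (`fix-≼`, `fix-≗`). There is no subtraction, so correction terms sit on whichever side keeps them
-- nonnegative. The delicate point is X ≤ q^m + Y. For M ≥ 1, trading a negative part of size A + M
-- + 1 for a positive one of size A + 1 frees M cells, which pay for lowering the charge by one. For
-- M = 0 nothing is freed; the summands are then paired differently, and the scarcity of small sizes
-- forces separate arguments for j = 0, 1, 2 and j ≥ 3. The symmetry of the crank fails at n = 1,
-- where `cell 0 1` would demand a partition of 1 with crank 1; that case is settled directly.

-- Formal power series in q with natural coefficients; sh k is multiplication by q^k.

Ser : Set
Ser = ℕ → ℕ

infix 4 _≼_
_≼_ : Ser → Ser → Set
f ≼ g = ∀ n → f n ≤ g n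

infixl 6 _⊕_
_⊕_ : Ser → Ser → Ser
(f ⊕ g) n = f n + g n

sh : ℕ → Ser → Ser
sh zero    f n       = f n
sh (suc k) f zero    = 0
sh (suc k) f (suc n) = sh k f n

sh-⊕ : ∀ k f g → sh k (f ⊕ g) ≗ sh k f ⊕ sh k g
sh-⊕ zero    f g n       = refl
sh-⊕ (suc k) f g zero    = refl
sh-⊕ (suc k) f g (suc n) = sh-⊕ k f g n

sh-cong : ∀ k {f g} → f ≗ g → sh k f ≗ sh k g
sh-cong zero    e n       = e n
sh-cong (suc k) e zero    = refl
sh-cong (suc k) e (suc n) = sh-cong k e n

sh-mono : ∀ k {f g} → f ≼ g → sh k f ≼ sh k g
sh-mono zero    e n       = e n
sh-mono (suc k) e zero    = z≤n
sh-mono (suc k) e (suc n) = sh-mono k e n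

sh-sh : ∀ a b f → sh a (sh b f) ≗ sh (a + b) f
sh-sh zero    b f n       = refl
sh-sh (suc a) b f zero    = refl
sh-sh (suc a) b f (suc n) = sh-sh a b f n

sh-exp : ∀ {a b} → a ≡ b → ∀ f → sh a f ≗ sh b f
sh-exp refl f n = refl

sh-comm : ∀ a b f → sh a (sh b f) ≗ sh b (sh a f)
sh-comm a b f n = ≡.trans (sh-sh a b f n) (≡.trans (sh-exp (+-comm a b) f n) (sym (sh-sh b a f n)))

sh-vanish : ∀ k f {n} → n < k → sh k f n ≡ 0
sh-vanish (suc k) f {zero}  _       = refl
sh-vanish (suc k) f {suc n} (s≤s l) = sh-vanish k f l

sh-0 : ∀ k → sh k (λ _ → 0) ≗ λ _ → 0
sh-0 zero    n       = refl
sh-0 (suc k) zero    = refl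
sh-0 (suc k) (suc n) = sh-0 k n

-- Multiplication by a positive power of q sees only lower degrees. This is what feeds the induction
-- hypotheses of all recursions on the degree.
sh-local : ∀ (R : ℕ → ℕ → Set) → R 0 0 → ∀ k {f g n} → (∀ m → m < n → R (f m) (g m)) →
           R (sh (suc k) f n) (sh (suc k) g n)
sh-local R r k       {n = zero}  h = r
sh-local R r zero    {n = suc n} h = h n ≤-refl
sh-local R r (suc k) {n = suc n} h = sh-local R r k (λ m l → h m (m<n⇒m<1+n l))

-- By induction on the degree, the solution of f i = a i + q^(k+1) f (s i) is monotone in a.

fix-≼ : ∀ {I : Set} k {X A Y B : I → Ser} (s : I → I) →
        (∀ i → X i ≼ A i ⊕ sh (suc k) (X (s i))) →
        (∀ i → B i ⊕ sh (suc k) (Y (s i)) ≼ Y i) →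
        (∀ i → A i ≼ B i) → ∀ i → X i ≼ Y i
fix-≼ {I} k {X} {A} {Y} {B} s hx hy hab i n = <-rec (λ n → ∀ i → X i n ≤ Y i n) step n i
  where
  step : ∀ n → (∀ {m} → m < n → ∀ i → X i m ≤ Y i m) → ∀ i → X i n ≤ Y i n
  step n rec i = ≤-trans (hx i n) (≤-trans
    (+-mono-≤ (hab i n) (sh-local _≤_ z≤n k (λ m l → rec l (s i)))) (hy i n))

fix-≗ : ∀ {I : Set} k {X A Y B : I → Ser} (s : I → I) →
        (∀ i → X i ≗ A i ⊕ sh (suc k) (X (s i))) →
        (∀ i → Y i ≗ B i ⊕ sh (suc k) (Y (s i))) →
        (∀ i → A i ≗ B i) → ∀ i → X i ≗ Y i
fix-≗ k s hx hy hab i n = ≤-antisym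
  (fix-≼ k s (λ i n → ≤-reflexive (hx i n)) (λ i n → ≤-reflexive (sym (hy i n))) (λ i n → ≤-reflexive (hab i n)) i n)
  (fix-≼ k s (λ i n → ≤-reflexive (hy i n)) (λ i n → ≤-reflexive (sym (hx i n))) (λ i n → ≤-reflexive (sym (hab i n))) i n)

-- The number argument is fuel. Each repetition costs at least one degree, so in degree n the fuel n
-- chosen by `geo∞` is enough.
geo : {X : Set} → ℕ → (X → X) → (X → Ser) → ℕ → X → Ser
geo a st g zero    x n = g x n
geo a st g (suc k) x n = g x n + sh (suc a) (geo a st g k (st x)) n

geo-fuel : ∀ {X : Set} a st (g : X → Ser) k k′ x {n} → n ≤ k → n ≤ k′ → geo a st g k x n ≡ geo a st g k′ x n
geo-fuel a st g zero    zero     x z≤n _ = refl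
geo-fuel a st g zero    (suc k′) x z≤n _ = sym (+-identityʳ _)
geo-fuel a st g (suc k) zero     x _ z≤n = +-identityʳ _
geo-fuel a st g (suc k) (suc k′) x p q = cong (g x _ +_)
  (sh-local _≡_ refl a (λ m l → geo-fuel a st g k k′ (st x) (≤-pred (≤-trans l p)) (≤-pred (≤-trans l q))))

geo∞ : {X : Set} → ℕ → (X → X) → (X → Ser) → X → Ser
geo∞ a st g x n = geo a st g n x n

geo∞-unfold : ∀ {X : Set} a st (g : X → Ser) x → geo∞ a st g x ≗ g x ⊕ sh (suc a) (geo∞ a st g (st x))
geo∞-unfold a st g x zero    = sym (+-identityʳ _)
geo∞-unfold a st g x (suc n) = cong (g x _ +_)
  (sh-local _≡_ refl a {n = suc n} (λ m l → geo-fuel a st g n m (st x) (≤-pred l) ≤-refl))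

-- Multisets of charged parts

-- A part (i , s) has size i + 1 and carries the charge +1, 0 or -1.

data Sg : Set where
  pl ze mi : Sg

Part : Set
Part = ℕ × Sg

act dn : Sg → ℤ → ℤ
act pl = ℤ.suc
act ze = id
act mi = ℤ.pred
dn pl = ℤ.pred
dn ze = id
dn mi = ℤ.suc

-- F L χ n is the sum of χ (total charge) over the multisets of parts from L of total size n.

F : List Part → (ℤ → ℕ) → Ser
F []            χ zero    = χ 0ℤ
F []            χ (suc n) = 0
F ((i , s) ∷ L)           = geo∞ i (_∘ act s) (F L)

F-unfold : ∀ i s L χ → F ((i , s) ∷ L) χ ≗ F L χ ⊕ sh (suc i) (F ((i , s) ∷ L) (χ ∘ act s))
F-unfold i s L = geo∞-unfold i (_∘ act s) (F L)

F-cong : ∀ L {χ χ′} → χ ≗ χ′ → F L χ ≗ F L χ′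
F-cong []            e zero    = e 0ℤ
F-cong []            e (suc n) = refl
F-cong ((i , s) ∷ L) {χ} {χ′} e = fix-≗ {I = Σ ((ℤ → ℕ) × (ℤ → ℕ)) λ (χ , χ′) → χ ≗ χ′} i
  (λ ((χ , χ′) , e) → (χ ∘ act s , χ′ ∘ act s) , e ∘ act s)
  (λ ((χ , χ′) , e) → F-unfold i s L χ) (λ ((χ , χ′) , e) → F-unfold i s L χ′)
  (λ (_ , e) → F-cong L e) ((χ , χ′) , e)

F-⊕ : ∀ L χ χ′ → F L (λ c → χ c + χ′ c) ≗ F L χ ⊕ F L χ′
F-⊕ []            χ χ′ zero    = refl
F-⊕ []            χ χ′ (suc n) = refl
F-⊕ ((i , s) ∷ L) χ χ′ = fix-≗ {I = (ℤ → ℕ) × (ℤ → ℕ)} i (λ (χ , χ′) → χ ∘ act s , χ′ ∘ act s)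
  (λ (χ , χ′) → F-unfold i s L _)
  (λ (χ , χ′) n → ≡.trans (cong₂ _+_ (F-unfold i s L χ n) (F-unfold i s L χ′ n))
     (≡.trans (solve 4 (λ a b c d → (a :+ b) :+ (c :+ d) := (a :+ c) :+ (b :+ d)) refl
        (F L χ n) (sh (suc i) (F ((i , s) ∷ L) (χ ∘ act s)) n) (F L χ′ n) (sh (suc i) (F ((i , s) ∷ L) (χ′ ∘ act s)) n))
       (cong (F L χ n + F L χ′ n +_) (sym (sh-⊕ (suc i) _ _ n)))))
  (λ (χ , χ′) → F-⊕ L χ χ′) (χ , χ′)
  where open +-*-Solver

act-comm : ∀ s t c → act s (act t c) ≡ act t (act s c)
act-comm pl pl c = refl
act-comm pl ze c = refl
act-comm pl mi c = ≡.trans (ℤₚ.suc-pred c) (sym (ℤₚ.pred-suc c))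
act-comm ze t  c = refl
act-comm mi pl c = ≡.trans (ℤₚ.pred-suc c) (sym (ℤₚ.suc-pred c))
act-comm mi ze c = refl
act-comm mi mi c = refl

F-prep : ∀ p L L′ → (∀ χ → F L χ ≗ F L′ χ) → ∀ χ → F (p ∷ L) χ ≗ F (p ∷ L′) χ
F-prep (i , s) L L′ e = fix-≗ i (_∘ act s) (F-unfold i s L) (F-unfold i s L′) e

-- Sorting by whether `p` and whether `r` occurs gives the same four terms in either order. The
-- recursive references lie in lower degrees, and the term with both parts also needs `act-comm`.
F-swap : ∀ p r L χ → F (p ∷ r ∷ L) χ ≗ F (r ∷ p ∷ L) χ
F-swap p@(i , s) r@(j , t) L χ n = <-rec (λ n → ∀ χ → F (p ∷ r ∷ L) χ n ≡ F (r ∷ p ∷ L) χ n) step n χ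
  where
  open ≡.≡-Reasoning
  open +-*-Solver
  step : ∀ n → (∀ {m} → m < n → ∀ χ → F (p ∷ r ∷ L) χ m ≡ F (r ∷ p ∷ L) χ m) →
         ∀ χ → F (p ∷ r ∷ L) χ n ≡ F (r ∷ p ∷ L) χ n
  step n rec χ = begin
    F (p ∷ r ∷ L) χ n
      ≡⟨ F-unfold i s (r ∷ L) χ n ⟩
    F (r ∷ L) χ n + sh (suc i) (F (p ∷ r ∷ L) (χ ∘ act s)) n
      ≡⟨ cong₂ _+_ (F-unfold j t L χ n) (sh-local _≡_ refl i (λ m l → ≡.trans (rec l (χ ∘ act s)) (F-unfold j t (p ∷ L) (χ ∘ act s) m))) ⟩
    F L χ n + sh (suc j) R n + sh (suc i) (P ⊕ sh (suc j) (F (r ∷ p ∷ L) (χ ∘ act s ∘ act t))) n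
      ≡⟨ cong (F L χ n + sh (suc j) R n +_) (sh-⊕ (suc i) P _ n) ⟩
    F L χ n + sh (suc j) R n + (sh (suc i) P n + sh (suc i) (sh (suc j) (F (r ∷ p ∷ L) (χ ∘ act s ∘ act t))) n)
      ≡⟨ cong (λ z → F L χ n + sh (suc j) R n + (sh (suc i) P n + z)) mid ⟩
    F L χ n + sh (suc j) R n + (sh (suc i) P n + sh (suc j) (sh (suc i) (F (p ∷ r ∷ L) (χ ∘ act t ∘ act s))) n)
      ≡⟨ solve 4 (λ a b c d → (a :+ b) :+ (c :+ d) := (a :+ c) :+ (b :+ d)) refl (F L χ n) (sh (suc j) R n) (sh (suc i) P n) _ ⟩
    F L χ n + sh (suc i) P n + (sh (suc j) R n + sh (suc j) (sh (suc i) (F (p ∷ r ∷ L) (χ ∘ act t ∘ act s))) n)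
      ≡⟨ cong₂ _+_ (sym (F-unfold i s L χ n)) (sym (sh-⊕ (suc j) R _ n)) ⟩
    F (p ∷ L) χ n + sh (suc j) (R ⊕ sh (suc i) (F (p ∷ r ∷ L) (χ ∘ act t ∘ act s))) n
      ≡⟨ cong (F (p ∷ L) χ n +_) (sh-local _≡_ refl j (λ m l → sym (≡.trans (sym (rec l (χ ∘ act t))) (F-unfold i s (r ∷ L) (χ ∘ act t) m)))) ⟩
    F (p ∷ L) χ n + sh (suc j) (F (r ∷ p ∷ L) (χ ∘ act t)) n
      ≡⟨ F-unfold j t (p ∷ L) χ n ⟨
    F (r ∷ p ∷ L) χ n ∎
    where
    R = F (r ∷ L) (χ ∘ act t)
    P = F (p ∷ L) (χ ∘ act s)
    mid : sh (suc i) (sh (suc j) (F (r ∷ p ∷ L) (χ ∘ act s ∘ act t))) n ≡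
          sh (suc j) (sh (suc i) (F (p ∷ r ∷ L) (χ ∘ act t ∘ act s))) n
    mid = begin
      sh (suc i) (sh (suc j) (F (r ∷ p ∷ L) (χ ∘ act s ∘ act t))) n
        ≡⟨ sh-sh (suc i) (suc j) _ n ⟩
      sh (suc (i + suc j)) (F (r ∷ p ∷ L) (χ ∘ act s ∘ act t)) n
        ≡⟨ sh-local _≡_ refl (i + suc j) (λ m l → ≡.trans (F-cong (r ∷ p ∷ L) (λ c → cong χ (act-comm s t c)) m) (sym (rec l _))) ⟩
      sh (suc i + suc j) (F (p ∷ r ∷ L) (χ ∘ act t ∘ act s)) n
        ≡⟨ sh-sh (suc i) (suc j) _ n ⟨
      sh (suc i) (sh (suc j) (F (p ∷ r ∷ L) (χ ∘ act t ∘ act s))) n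
        ≡⟨ sh-comm (suc i) (suc j) _ n ⟩
      sh (suc j) (sh (suc i) (F (p ∷ r ∷ L) (χ ∘ act t ∘ act s))) n ∎

F-↭ : ∀ {L L′} → L ↭ L′ → ∀ χ → F L χ ≗ F L′ χ
F-↭ refl                  χ n = refl
F-↭ (prep {L} {L′} p e)   χ = F-prep p L L′ (F-↭ e) χ
F-↭ (swap {L} {L′} p r e) χ n = ≡.trans (F-swap p r L χ n)
  (F-prep r (p ∷ L) (p ∷ L′) (F-prep p L L′ (F-↭ e)) χ n)
F-↭ (trans e e′)          χ n = ≡.trans (F-↭ e χ n) (F-↭ e′ χ n)

δ : ℤ → ℤ → ℕ
δ d c = if does (c ℤ.≟ d) then 1 else 0

δ-≡ : ∀ d → δ d d ≡ 1
δ-≡ d = cong (if_then 1 else 0) (dec-true (d ℤ.≟ d) refl)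

δ-≢ : ∀ {d c} → c ≢ d → δ d c ≡ 0
δ-≢ {d} {c} ne = cong (if_then 1 else 0) (dec-false (c ℤ.≟ d) ne)

act-dn : ∀ s d → act s (dn s d) ≡ d
act-dn pl = ℤₚ.suc-pred
act-dn ze d = refl
act-dn mi = ℤₚ.pred-suc

dn-act : ∀ s d → dn s (act s d) ≡ d
dn-act pl = ℤₚ.pred-suc
dn-act ze d = refl
dn-act mi = ℤₚ.suc-pred

δ-act : ∀ s d c → δ d (act s c) ≡ δ (dn s d) c
δ-act s d c with c ℤ.≟ dn s d
... | yes refl = ≡.trans (cong (δ d) (act-dn s d)) (δ-≡ d)
... | no ne    = δ-≢ (λ e → ne (≡.trans (sym (dn-act s c)) (cong (dn s) e)))

B : List Part → ℤ → Ser
B L d = F L (δ d)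

B-unfold : ∀ i s L d → B ((i , s) ∷ L) d ≗ B L d ⊕ sh (suc i) (B ((i , s) ∷ L) (dn s d))
B-unfold i s L d n = ≡.trans (F-unfold i s L (δ d) n)
  (cong (B L d n +_) (sh-cong (suc i) (F-cong ((i , s) ∷ L) (δ-act s d)) n))

F-out : ∀ {i s L L′} → L ↭ (i , s) ∷ L′ → ∀ χ → F L χ ≗ F L′ χ ⊕ sh (suc i) (F L (χ ∘ act s))
F-out {i} {s} {L} {L′} e χ n = ≡.trans (F-↭ e χ n) (≡.trans (F-unfold i s L′ χ n)
  (cong (F L′ χ n +_) (sh-cong (suc i) (λ m → sym (F-↭ e (χ ∘ act s) m)) n)))

B-out : ∀ {i s L L′} → L ↭ (i , s) ∷ L′ → ∀ d → B L d ≗ B L′ d ⊕ sh (suc i) (B L (dn s d))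
B-out {i} {s} {L} {L′} e d n = ≡.trans (F-out e (δ d) n)
  (cong (B L′ d n +_) (sh-cong (suc i) (F-cong L (δ-act s d)) n))

pull : ∀ {p : Part} {L} → p ∈ L → ∃[ L′ ] (L ↭ p ∷ L′)
pull {p} p∈L with xs , ys , refl ← ∈-∃++ p∈L = xs ++ ys , shift p xs ys

insert : ∀ {i s L} → (i , s) ∈ L → ∀ d → sh (suc i) (B L (dn s d)) ≼ B L d
insert {i} {s} {L} m d n with L′ , e ← pull m =
  ≤-trans (m≤n+m _ (B L′ d n)) (≤-reflexive (sym (B-out e d n)))

insert₂ : ∀ {i j L} → (i , pl) ∈ L → (j , mi) ∈ L → ∀ d → sh (suc i + suc j) (B L d) ≼ B L d
insert₂ {i} {j} {L} p m d n = begin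
  sh (suc i + suc j) (B L d) n                       ≡⟨ sh-sh (suc i) (suc j) _ n ⟨
  sh (suc i) (sh (suc j) (B L d)) n                  ≡⟨ sh-cong (suc i) (sh-cong (suc j) (λ k → cong (λ z → B L z k) (sym (ℤₚ.suc-pred d)))) n ⟩
  sh (suc i) (sh (suc j) (B L (ℤ.suc (ℤ.pred d)))) n ≤⟨ sh-mono (suc i) (insert m (ℤ.pred d)) n ⟩
  sh (suc i) (B L (ℤ.pred d)) n                      ≤⟨ insert p d n ⟩
  B L d n                                            ∎
  where open ≤-Reasoning

-- Intervals of sizes, negation and support of the charge

rng : Sg → ℕ → ℕ → List Part
rng s a zero    = []
rng s a (suc k) = (a + k , s) ∷ rng s a k

rng-bottom : ∀ s a k → rng s a (suc k) ↭ (a , s) ∷ rng s (suc a) k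
rng-bottom s a zero    = ↭-reflexive (cong (λ z → (z , s) ∷ []) (+-identityʳ a))
rng-bottom s a (suc k) = trans (prep _ (rng-bottom s a k))
  (trans (swap _ _ refl) (↭-reflexive (cong (λ z → (a , s) ∷ (z , s) ∷ rng s (suc a) k) (+-suc a k))))

-- Charge +1 on the sizes 1, …, A and charge -1 on the sizes 1, …, B.
⟨_,_⟩ : ℕ → ℕ → List Part
⟨ A , B ⟩ = rng pl 0 A ++ rng mi 0 B

br : ℕ → ℕ → ℤ → Ser
br A B′ = B ⟨ A , B′ ⟩

top-mi : ∀ A B → ⟨ A , suc B ⟩ ↭ (B , mi) ∷ ⟨ A , B ⟩
top-mi A B = shift (B , mi) (rng pl 0 A) (rng mi 0 B)

br-pl : ∀ A B d → br (suc A) B d ≗ br A B d ⊕ sh (suc A) (br (suc A) B (ℤ.pred d))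
br-pl A B d = B-unfold A pl ⟨ A , B ⟩ d

br-mi : ∀ A B d → br A (suc B) d ≗ br A B d ⊕ sh (suc B) (br A (suc B) (ℤ.suc d))
br-mi A B d = B-out (top-mi A B) d

fl : Sg → Sg
fl pl = mi
fl ze = ze
fl mi = pl

flip : Part → Part
flip (i , s) = i , fl s

neg-act : ∀ s c → ℤ.- act s c ≡ act (fl s) (ℤ.- c)
neg-act pl c = ℤₚ.neg-distrib-+ 1ℤ c
neg-act ze c = refl
neg-act mi c = ℤₚ.neg-distrib-+ -1ℤ c

F-flip : ∀ L χ → F (map flip L) χ ≗ F L (χ ∘ ℤ.-_)
F-flip []            χ zero    = refl
F-flip []            χ (suc n) = refl
F-flip ((i , s) ∷ L) = fix-≗ i (_∘ act (fl s))
  (F-unfold i (fl s) (map flip L))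
  (λ χ n → ≡.trans (F-unfold i s L (χ ∘ ℤ.-_) n) (cong (F L (χ ∘ ℤ.-_) n +_)
     (sh-cong (suc i) (F-cong ((i , s) ∷ L) (λ c → cong χ (neg-act s c))) n)))
  (F-flip L)

map-flip-rng : ∀ s a k → map flip (rng s a k) ≡ rng (fl s) a k
map-flip-rng s a zero    = refl
map-flip-rng s a (suc k) = cong ((a + k , fl s) ∷_) (map-flip-rng s a k)

flip-↭ : ∀ A B → map flip ⟨ A , B ⟩ ↭ ⟨ B , A ⟩
flip-↭ A B = trans (↭-reflexive (≡.trans (map-++ flip (rng pl 0 A) (rng mi 0 B))
  (cong₂ _++_ (map-flip-rng pl 0 A) (map-flip-rng mi 0 B)))) (++-comm (rng mi 0 A) (rng pl 0 B))

⟨⟩-flip : ∀ A B χ → F ⟨ A , B ⟩ (χ ∘ ℤ.-_) ≗ F ⟨ B , A ⟩ χ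
⟨⟩-flip A B χ n = ≡.trans (sym (F-flip ⟨ A , B ⟩ χ n)) (F-↭ (flip-↭ A B) χ n)

δ-neg : ∀ d c → δ d (ℤ.- c) ≡ δ (ℤ.- d) c
δ-neg d c with c ℤ.≟ ℤ.- d
... | yes refl = ≡.trans (cong (δ d) (ℤₚ.neg-involutive d)) (δ-≡ d)
... | no ne    = δ-≢ (λ e → ne (≡.trans (sym (ℤₚ.neg-involutive c)) (cong ℤ.-_ e)))

br-flip : ∀ A B d → br A B (ℤ.- d) ≗ br B A d
br-flip A B d n = ≡.trans (sym (F-cong ⟨ A , B ⟩ (δ-neg d) n)) (⟨⟩-flip A B (δ d) n)

-- Every part has size at least 1 and charge at most 1, so the charge never exceeds the total size.
F-support : ∀ L {χ} n → (∀ c → c ℤ.≤ ℤ.+ n → χ c ≡ 0) → F L χ n ≡ 0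
F-support []            zero    h = h 0ℤ ℤₚ.≤-refl
F-support []            (suc n) h = refl
F-support ((i , s) ∷ L) {χ} n h = <-rec
  (λ n → ∀ χ → (∀ c → c ℤ.≤ ℤ.+ n → χ c ≡ 0) → F ((i , s) ∷ L) χ n ≡ 0) step n χ h
  where
  act-≤ : ∀ s c → act s c ℤ.≤ ℤ.suc c
  act-≤ pl c = ℤₚ.≤-refl
  act-≤ ze c = ℤₚ.i≤suc[i] c
  act-≤ mi c = ℤₚ.≤-trans (ℤₚ.i≤j⇒pred[i]≤j ℤₚ.≤-refl) (ℤₚ.i≤suc[i] c)
  step : ∀ n → (∀ {m} → m < n → ∀ χ → (∀ c → c ℤ.≤ ℤ.+ m → χ c ≡ 0) → F ((i , s) ∷ L) χ m ≡ 0) →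
         ∀ χ → (∀ c → c ℤ.≤ ℤ.+ n → χ c ≡ 0) → F ((i , s) ∷ L) χ n ≡ 0
  step n rec χ h = ≡.trans (F-unfold i s L χ n) (cong₂ _+_ (F-support L n h)
    (sh-local (λ x y → x ≡ 0) refl i {g = λ _ → 0} (λ m l → rec l _
      (λ c c≤m → h (act s c) (ℤₚ.≤-trans (act-≤ s c) (ℤₚ.≤-trans (ℤₚ.suc-mono c≤m) (ℤ.+≤+ l)))))))

sucpred : ∀ a d → ℤ.+ suc a ℤ.+ ℤ.pred d ≡ ℤ.+ a ℤ.+ d
sucpred a d = ≡.trans (ℤₚ.suc-+ a (ℤ.pred d)) (≡.trans (cong ℤ.suc (ℤₚ.+-pred (ℤ.+ a) d)) (ℤₚ.suc-pred (ℤ.+ a ℤ.+ d)))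

+-sucℤ : ∀ a d → a ℤ.+ ℤ.suc d ≡ ℤ.suc (a ℤ.+ d)
+-sucℤ a d = ≡.trans (sym (ℤₚ.+-assoc a 1ℤ d)) (≡.trans (cong (ℤ._+ d) (ℤₚ.+-comm a 1ℤ)) (ℤₚ.+-assoc 1ℤ a d))

-- Shifting sizes by charges, and the hockey-stick identity

-- Adding its charge to the size of every part multiplies the count of charge d by q^d.

data Sh : List Part → List Part → Set where
  []  : Sh [] []
  shp : ∀ {i L L′} → Sh L L′ → Sh ((i , pl) ∷ L) ((suc i , pl) ∷ L′)
  shz : ∀ {i L L′} → Sh L L′ → Sh ((i , ze) ∷ L) ((i , ze) ∷ L′)
  shm : ∀ {i L L′} → Sh L L′ → Sh ((suc i , mi) ∷ L) ((i , mi) ∷ L′)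

-- The factor q^d is represented by two exponents k = l + d, one on each side, because d may be
-- negative and the recursion changes its value.
ShIdx : Set
ShIdx = Σ (ℕ × ℕ × ℤ) λ (k , l , d) → ℤ.+ k ≡ ℤ.+ l ℤ.+ d

shX : List Part → ShIdx → Ser
shX L ((k , l , d) , _) = sh k (B L d)

shY : List Part → ShIdx → Ser
shY L ((k , l , d) , _) = sh l (B L d)

private
  pull-sh : ∀ k i s L d → sh k (B ((i , s) ∷ L) d) ≗ sh k (B L d) ⊕ sh (suc i) (sh k (B ((i , s) ∷ L) (dn s d)))
  pull-sh k i s L d n = ≡.trans (sh-cong k (B-unfold i s L d) n)
    (≡.trans (sh-⊕ k _ _ n) (cong (sh k (B L d) n +_) (sh-comm k (suc i) _ n)))

  pull-sh′ : ∀ k i s L d → sh k (B ((suc i , s) ∷ L) d) ≗ sh k (B L d) ⊕ sh (suc i) (sh (suc k) (B ((suc i , s) ∷ L) (dn s d)))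
  pull-sh′ k i s L d n = ≡.trans (pull-sh k (suc i) s L d n) (cong (sh k (B L d) n +_)
    (≡.trans (sh-sh (suc (suc i)) k _ n) (≡.trans (sh-exp (cong suc (sym (+-suc i k))) _ n) (sym (sh-sh (suc i) (suc k) _ n)))))

B-shift : ∀ {L L′} → Sh L L′ → ∀ i → shX L i ≗ shY L′ i
B-shift [] ((k , l , d) , e) n with 0ℤ ℤ.≟ d
... | yes refl = sh-exp (ℤₚ.+-injective (≡.trans e (ℤₚ.+-identityʳ (ℤ.+ l)))) _ n
... | no ne    = ≡.trans (zero-sh k n) (sym (zero-sh l n))
  where
  zero-sh : ∀ k → sh k (B [] d) ≗ λ _ → 0
  zero-sh zero    zero    = δ-≢ ne
  zero-sh zero    (suc n) = refl
  zero-sh (suc k) zero    = refl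
  zero-sh (suc k) (suc n) = zero-sh k n
B-shift (shp {i} {L} {L′} r) = fix-≗ i
  (λ ((k , l , d) , e) → (k , suc l , ℤ.pred d) , ≡.trans e (sym (sucpred l d)))
  (λ ((k , l , d) , e) → pull-sh k i pl L d) (λ ((k , l , d) , e) → pull-sh′ l i pl L′ d) (B-shift r)
B-shift (shz {i} {L} {L′} r) = fix-≗ i id
  (λ ((k , l , d) , e) → pull-sh k i ze L d) (λ ((k , l , d) , e) → pull-sh l i ze L′ d) (B-shift r)
B-shift (shm {i} {L} {L′} r) = fix-≗ i
  (λ ((k , l , d) , e) → (suc k , l , ℤ.suc d) , ≡.trans (cong ℤ.suc e) (sym (+-sucℤ (ℤ.+ l) d)))
  (λ ((k , l , d) , e) → pull-sh′ k i mi L d) (λ ((k , l , d) , e) → pull-sh l i mi L′ d) (B-shift r)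

B-shift⁺ : ∀ {L L′} → Sh L L′ → ∀ e → sh e (B L (ℤ.+ e)) ≗ B L′ (ℤ.+ e)
B-shift⁺ r e = B-shift r ((e , 0 , ℤ.+ e) , refl)

Sh-++ : ∀ {K K′ L L′} → Sh K K′ → Sh L L′ → Sh (K ++ L) (K′ ++ L′)
Sh-++ []      s = s
Sh-++ (shp r) s = shp (Sh-++ r s)
Sh-++ (shz r) s = shz (Sh-++ r s)
Sh-++ (shm r) s = shm (Sh-++ r s)

Sh-pl : ∀ a k → Sh (rng pl a k) (rng pl (suc a) k)
Sh-pl a zero    = []
Sh-pl a (suc k) = shp (Sh-pl a k)

Sh-mi : ∀ a k → Sh (rng mi (suc a) k) (rng mi a k)
Sh-mi a zero    = []
Sh-mi a (suc k) = shm (Sh-mi a k)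

-- ge e is the indicator of [e , ∞).

ge0 : ℤ → ℕ
ge0 (ℤ.+ _)    = 1
ge0 -[1+ _ ] = 0

ge : ℕ → ℤ → ℕ
ge zero    c = ge0 c
ge (suc e) c = ge e (ℤ.pred c)

le0 : ℤ → ℕ
le0 c = ge0 (ℤ.- c)

ge-split : ∀ e c → ge e c ≡ δ (ℤ.+ e) c + ge (suc e) c
ge-split zero    (ℤ.+ zero)    = refl
ge-split zero    (ℤ.+ (suc n)) = refl
ge-split zero    -[1+ n ]    = refl
ge-split (suc e) c = ≡.trans (ge-split e (ℤ.pred c)) (cong (_+ ge (suc (suc e)) c) (δ-act mi (ℤ.+ e) c))

ge-small : ∀ e {n} → n < e → ∀ c → c ℤ.≤ ℤ.+ n → ge e c ≡ 0
ge-small (suc zero)    {zero}  l c h = low c h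
  where
  low : ∀ c → c ℤ.≤ 0ℤ → ge0 (ℤ.pred c) ≡ 0
  low (ℤ.+ zero)    _ = refl
  low (ℤ.+ (suc n)) (ℤ.+≤+ ())
  low -[1+ n ]    _ = refl
ge-small (suc (suc e)) {zero}  l c h = ge-small (suc e) {0} (s≤s z≤n) (ℤ.pred c) (ℤₚ.≤-trans (ℤₚ.i≤j⇒pred[i]≤j ℤₚ.≤-refl) h)
ge-small (suc e)       {suc n} (s≤s l) c h = ge-small e l (ℤ.pred c) (ℤₚ.pred-mono h)

ge0-suc : ∀ c → ge0 (ℤ.suc c) ≡ ge0 c + δ -1ℤ c
ge0-suc (ℤ.+ n)          = refl
ge0-suc -[1+ zero ]    = refl
ge0-suc -[1+ (suc n) ] = refl

-- By B-shift⁺, a part (0 , mi) of multiplicity e can be traded for the charge e.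
F-halfline : ∀ {L L′} → Sh L L′ → B ((0 , mi) ∷ L) 0ℤ ≗ F L′ ge0
F-halfline {L} {L′} r n = go (suc n) 0 ≤-refl
  where
  Z : ℕ → Ser
  Z e = sh e (B ((0 , mi) ∷ L) (ℤ.+ e))
  Z-step : ∀ e → Z e ≗ B L′ (ℤ.+ e) ⊕ Z (suc e)
  Z-step e m = ≡.trans (sh-cong e (B-unfold 0 mi L (ℤ.+ e)) m) (≡.trans (sh-⊕ e _ _ m)
    (cong₂ _+_ (B-shift⁺ r e m) (≡.trans (sh-sh e 1 _ m) (sh-exp (+-comm e 1) _ m))))
  X-step : ∀ e → F L′ (ge e) ≗ B L′ (ℤ.+ e) ⊕ F L′ (ge (suc e))
  X-step e m = ≡.trans (F-cong L′ (ge-split e) m) (F-⊕ L′ _ _ m)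
  -- Both sides obey the same recursion in `e` and vanish in degree n as soon as e > n; `k` measures
  -- the distance to that point.
  go : ∀ k e → n < e + k → Z e n ≡ F L′ (ge e) n
  go zero    e l = ≡.trans (sh-vanish e _ l′) (sym (F-support L′ n (ge-small e l′)))
    where l′ = subst (n <_) (+-identityʳ e) l
  go (suc k) e l = ≡.trans (Z-step e n) (≡.trans (cong (B L′ (ℤ.+ e) n +_)
    (go k (suc e) (subst (n <_) (+-suc e k) l))) (sym (X-step e n)))

-- Split by the part of size 1 and charge +1. Without it, `F-halfline` read backwards turns the
-- half-line into a part of size 1 and charge -1 and gives `br A (suc B) 0ℤ`. With it, the half-line
-- grows by the charge -1.
hockey⁺ : ∀ A B → F ⟨ suc A , B ⟩ ge0 ≗ br A (suc B) 0ℤ ⊕ sh 1 (F ⟨ suc A , B ⟩ ge0) ⊕ sh 1 (br (suc A) B -1ℤ)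
hockey⁺ A B n = begin
  F ⟨ suc A , B ⟩ ge0 n
    ≡⟨ F-out (++⁺ʳ (rng mi 0 B) (rng-bottom pl 0 A)) ge0 n ⟩
  F L′ ge0 n + sh 1 (F ⟨ suc A , B ⟩ (ge0 ∘ ℤ.suc)) n
    ≡⟨ cong₂ _+_ (≡.trans (sym (F-halfline (Sh-++ (Sh-pl 0 A) (Sh-mi 0 B)) n)) (F-↭ (↭-sym V) _ n))
         (sh-cong 1 (λ m → ≡.trans (F-cong ⟨ suc A , B ⟩ ge0-suc m) (F-⊕ ⟨ suc A , B ⟩ _ _ m)) n) ⟩
  br A (suc B) 0ℤ n + sh 1 (F ⟨ suc A , B ⟩ ge0 ⊕ br (suc A) B -1ℤ) n
    ≡⟨ cong (br A (suc B) 0ℤ n +_) (sh-⊕ 1 (F ⟨ suc A , B ⟩ ge0) _ n) ⟩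
  br A (suc B) 0ℤ n + (sh 1 (F ⟨ suc A , B ⟩ ge0) n + sh 1 (br (suc A) B -1ℤ) n)
    ≡⟨ +-assoc (br A (suc B) 0ℤ n) _ _ ⟨
  br A (suc B) 0ℤ n + sh 1 (F ⟨ suc A , B ⟩ ge0) n + sh 1 (br (suc A) B -1ℤ) n ∎
  where
  open ≡.≡-Reasoning
  L′ = rng pl 1 A ++ rng mi 0 B
  V : ⟨ A , suc B ⟩ ↭ (0 , mi) ∷ rng pl 0 A ++ rng mi 1 B
  V = trans (++⁺ˡ (rng pl 0 A) (rng-bottom mi 0 B)) (shift _ (rng pl 0 A) _)

hockey⁻ : ∀ A B → F ⟨ A , suc B ⟩ le0 ≗ br (suc A) B 0ℤ ⊕ sh 1 (F ⟨ A , suc B ⟩ le0) ⊕ sh 1 (br A (suc B) 1ℤ)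
hockey⁻ A B n = ≡.trans (⟨⟩-flip A (suc B) ge0 n) (≡.trans (hockey⁺ B A n)
  (cong₂ _+_ (cong₂ _+_ (br-flip B (suc A) 0ℤ n) (sh-cong 1 (λ m → sym (⟨⟩-flip A (suc B) ge0 m)) n))
    (sh-cong 1 (br-flip (suc B) A 1ℤ) n)))

-- Sums of families of series, and the exponents of the rectangles

sumTo : ℕ → (ℕ → ℕ) → ℕ
sumTo zero    f = f 0
sumTo (suc k) f = f 0 + sumTo k (f ∘ suc)

sumTo-last : ∀ k f → sumTo (suc k) f ≡ sumTo k f + f (suc k)
sumTo-last zero    f = refl
sumTo-last (suc k) f = ≡.trans (cong (f 0 +_) (sumTo-last k (f ∘ suc))) (sym (+-assoc (f 0) _ _))

sumTo-cong : ∀ k {f g} → f ≗ g → sumTo k f ≡ sumTo k g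
sumTo-cong zero    e = e 0
sumTo-cong (suc k) e = cong₂ _+_ (e 0) (sumTo-cong k (e ∘ suc))

sumTo-mono : ∀ k {f g} → (∀ j → f j ≤ g j) → sumTo k f ≤ sumTo k g
sumTo-mono zero    e = e 0
sumTo-mono (suc k) e = +-mono-≤ (e 0) (sumTo-mono k (e ∘ suc))

+-interchange : ∀ a b c d → (a + b) + (c + d) ≡ (a + c) + (b + d)
+-interchange = solve 4 (λ a b c d → (a :+ b) :+ (c :+ d) := (a :+ c) :+ (b :+ d)) refl
  where open +-*-Solver

sumTo-+ : ∀ k f g → sumTo k (λ j → f j + g j) ≡ sumTo k f + sumTo k g
sumTo-+ zero    f g = refl
sumTo-+ (suc k) f g = ≡.trans (cong (f 0 + g 0 +_) (sumTo-+ k (f ∘ suc) (g ∘ suc))) (+-interchange (f 0) _ _ _)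

sumTo-zero : ∀ k {f} → (∀ j → f j ≡ 0) → sumTo k f ≡ 0
sumTo-zero zero    h = h 0
sumTo-zero (suc k) h = cong₂ _+_ (h 0) (sumTo-zero k (h ∘ suc))

sumTo-swap : ∀ k l (f : ℕ → ℕ → ℕ) → sumTo k (λ i → sumTo l (f i)) ≡ sumTo l (λ j → sumTo k (λ i → f i j))
sumTo-swap zero    l f = refl
sumTo-swap (suc k) l f = ≡.trans (cong (sumTo l (f 0) +_) (sumTo-swap k l (f ∘ suc))) (sym (sumTo-+ l (f 0) _))

-- The sum of a family of series whose (n+1)-st member has no coefficient at n.

∑ : (ℕ → Ser) → Ser
∑ g n = sumTo n (λ j → g j n)

Van : (ℕ → Ser) → Set
Van g = ∀ n → g (suc n) n ≡ 0

∑-cong : ∀ {g h} → (∀ j → g j ≗ h j) → ∑ g ≗ ∑ h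
∑-cong e n = sumTo-cong n (λ j → e j n)

∑-mono : ∀ {g h} → (∀ j → g j ≼ h j) → ∑ g ≼ ∑ h
∑-mono e n = sumTo-mono n (λ j → e j n)

∑-⊕ : ∀ g h → ∑ (λ j → g j ⊕ h j) ≗ ∑ g ⊕ ∑ h
∑-⊕ g h n = sumTo-+ n (λ j → g j n) (λ j → h j n)

∑-head : ∀ g → Van g → ∑ g ≗ g 0 ⊕ ∑ (g ∘ suc)
∑-head g v n = sym (≡.trans (sumTo-last n (λ j → g j n)) (≡.trans (cong (∑ g n +_) (v n)) (+-identityʳ _)))

∑-sh : ∀ g → Van g → sh 1 (∑ g) ≗ ∑ (λ j → sh 1 (g j))
∑-sh g v zero    = refl
∑-sh g v (suc n) = sym (≡.trans (sumTo-last n (λ j → g j n)) (≡.trans (cong (∑ g n +_) (v n)) (+-identityʳ _)))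

-- In f + c = k + q f each coefficient of f is determined by the preceding one. The series c stays
-- on the left because it cannot be subtracted from k.
fix1 : ∀ {f g c k : Ser} → f ⊕ c ≗ k ⊕ sh 1 f → g ⊕ c ≗ k ⊕ sh 1 g → f ≗ g
fix1 {f} {g} {c} {k} p r zero    = +-cancelʳ-≡ (c 0) (f 0) (g 0) (≡.trans (p 0) (sym (r 0)))
fix1 {f} {g} {c} {k} p r (suc n) = +-cancelʳ-≡ (c (suc n)) (f (suc n)) (g (suc n))
  (≡.trans (p (suc n)) (≡.trans (cong (k (suc n) +_) (fix1 {f} {g} {c} {k} p r n)) (sym (r (suc n)))))

unit : Ser
unit zero    = 1
unit (suc n) = 0

mi-support : ∀ a k χ → (∀ c → c ℤ.≤ 0ℤ → χ c ≡ 0) → F (rng mi a k) χ ≗ λ _ → 0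
mi-support a zero    χ h zero    = h 0ℤ ℤₚ.≤-refl
mi-support a zero    χ h (suc n) = refl
mi-support a (suc k) χ h = fix-≗ {I = Σ (ℤ → ℕ) λ χ → ∀ c → c ℤ.≤ 0ℤ → χ c ≡ 0} (a + k)
  {A = λ (χ , _) → F (rng mi a k) χ} {B = λ _ _ → 0}
  (λ (χ , h) → χ ∘ ℤ.pred , λ c c≤0 → h (ℤ.pred c) (ℤₚ.i≤j⇒pred[i]≤j c≤0))
  (λ (χ , h) → F-unfold (a + k) mi (rng mi a k) χ)
  (λ _ n → sym (sh-0 (suc (a + k)) n)) (λ (χ , h) → mi-support a k χ h) (χ , h)

mi-pos : ∀ a k c → B (rng mi a k) (ℤ.+ suc c) ≗ λ _ → 0
mi-pos a k c = mi-support a k (δ (ℤ.+ suc c)) (λ d d≤0 → δ-≢ (λ e → contradiction (subst (ℤ._≤ 0ℤ) e d≤0) λ { (ℤ.+≤+ ()) }))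

mi-zero : ∀ a k → B (rng mi a k) 0ℤ ≗ unit
mi-zero a zero    zero    = refl
mi-zero a zero    (suc n) = refl
mi-zero a (suc k) n = ≡.trans (B-unfold (a + k) mi (rng mi a k) 0ℤ n)
  (≡.trans (cong₂ _+_ (mi-zero a k n) (≡.trans (sh-cong (suc (a + k)) (mi-pos a (suc k) 0) n) (sh-0 (suc (a + k)) n))) (+-identityʳ _))

-- The exponent J (J + M) at J = j + 1.

ex : ℕ → ℕ → ℕ
ex M j = suc j * (suc j + M)

-- From J × (J + M) to the next rectangle: a column of J cells, then a row of J + 1 + M cells. These
-- are sizes of largest charged parts, so extracting such parts moves between neighbouring summands.
ex-suc : ∀ M j → ex M (suc j) ≡ ex M j + suc j + suc (suc j + M)
ex-suc = solve 2 (λ M j → (con 2 :+ j) :* ((con 2 :+ j) :+ M) :=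
  ((con 1 :+ j) :* ((con 1 :+ j) :+ M) :+ (con 1 :+ j)) :+ (con 2 :+ (j :+ M))) refl
  where open +-*-Solver

ex-up : ∀ M j → ex (suc M) j ≡ ex M j + suc j
ex-up = solve 2 (λ M j → (con 1 :+ j) :* ((con 1 :+ j) :+ (con 1 :+ M)) := (con 1 :+ j) :* ((con 1 :+ j) :+ M) :+ (con 1 :+ j)) refl
  where open +-*-Solver

ex-diagonal : ∀ M j → ex (suc M) j + suc (suc j + M) ≡ ex M (suc j)
ex-diagonal M j = ≡.trans (cong (_+ suc (suc j + M)) (ex-up M j)) (sym (ex-suc M j))

ex-big : ∀ M j → j < ex M j
ex-big M j = ≤-trans (m≤m+n (suc j) M) (m≤m+n (suc j + M) _)

ex-van : ∀ M (a : ℕ → ℕ) (f : ℕ → Ser) → (∀ j → ex M j ≤ a j) → Van (λ j → sh (a j) (f j))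
ex-van M a f h n = sh-vanish (a (suc n)) (f (suc n)) (≤-trans (≤-trans (n≤1+n _) (ex-big M (suc n))) (h (suc n)))

ex-mono : ∀ M j → ex M j ≤ ex M (suc j)
ex-mono M j = ≤-trans (≤-trans (m≤m+n _ (suc j)) (m≤m+n _ _)) (≤-reflexive (sym (ex-suc M j)))

sh-split : ∀ a b {f g h : Ser} → f ≗ g ⊕ sh b h → sh a f ≗ sh a g ⊕ sh (a + b) h
sh-split a b {f} {g} {h} e n = ≡.trans (sh-cong a e n) (≡.trans (sh-⊕ a g (sh b h) n) (cong (sh a g n +_) (sh-sh a b h n)))

-- The exact relation between the crank and the rank series

module Frame (M : ℕ) where

  -- The partitions with crank ≥ M + 1 (crank-ge), rank ≥ M + 1 and rank ≥ M (rank-ge).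
  Cser Rser R₀ser Qm : Ser
  Cser  = ∑ λ j → sh (ex M j) (F ⟨ j , suc j + M ⟩ (λ _ → 1))
  Rser  = ∑ λ j → sh (ex M j) (F ⟨ suc j , suc j + M ⟩ (ge 1))
  R₀ser = ∑ λ j → sh (ex M j) (F ⟨ suc j , suc j + M ⟩ ge0)
  Qm    = sh (suc M) unit

  cF rF gF lF x⁰ w¹ V⁰ v⁻ : ℕ → Ser
  cF j = F ⟨ j , suc j + M ⟩ (λ _ → 1)
  rF j = F ⟨ suc j , suc j + M ⟩ (ge 1)
  gF j = F ⟨ suc j , suc j + M ⟩ ge0
  lF j = F ⟨ j , suc j + M ⟩ le0
  x⁰ j = br (suc j) (j + M) 0ℤ
  w¹ j = br j (suc j + M) 1ℤ
  V⁰ j = br j (suc (suc j + M)) 0ℤ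
  v⁻ j = br (suc j) (suc j + M) -1ℤ

  -- `A′` and `Bq` are the discrepancies between the crank and the rank summands. The hockey-stick
  -- identities produce `x0`, `w1` from `A′` and `V0`, `vm` from `Bq`; extracting a largest part
  -- from these produces `X2`, `Y2`, `a0`, `W0`. The series `v0` accounts for rank exactly M.
  A′ Bq x0 w1 V0 vm X2 Y2 a0 W0 v0 : ℕ → Ser
  A′ j = sh (ex M j) (F ⟨ j , suc j + M ⟩ le0)
  Bq j = sh (ex M j + suc j) (F ⟨ suc j , suc j + M ⟩ ge0)
  x0 j = sh (ex M j) (br (suc j) (j + M) 0ℤ)
  w1 j = sh (ex M j) (br j (suc j + M) 1ℤ)
  V0 j = sh (ex M j + suc j) (br j (suc (suc j + M)) 0ℤ)
  vm j = sh (ex M j + suc j) (br (suc j) (suc j + M) -1ℤ)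
  X2 j = sh (ex M (suc j)) (br j (suc (suc j + M)) 1ℤ)
  Y2 j = sh (ex M j + suc j) (br (suc j) (j + M) -1ℤ)
  a0 j = sh (ex M (suc j)) (br (suc j) (suc j + M) 0ℤ)
  W0 j = sh (ex M j + suc j) (br j (suc j + M) 0ℤ)
  v0 j = sh (ex M j) (br (suc j) (suc j + M) 0ℤ)

  open ≡.≡-Reasoning
  open +-*-Solver using (solve; _:+_; _:=_)

  van : ∀ f → Van (λ j → sh (ex M j) (f j))
  van f = ex-van M (ex M) f (λ _ → ≤-refl)

  van⁺ : ∀ f → Van (λ j → sh (ex M j + suc j) (f j))
  van⁺ f = ex-van M (λ j → ex M j + suc j) f (λ j → m≤m+n (ex M j) (suc j))

  one-split : ∀ c → 1 ≡ le0 c + ge 1 c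
  one-split (ℤ.+ zero)    = refl
  one-split (ℤ.+ (suc n)) = refl
  one-split -[1+ n ]      = refl

  -- Both sides contain `ge 1` on ⟨ j , suc j + M ⟩: the constant 1 exceeds it by `le0`, which is
  -- `A′`, and `rF` exceeds it by the multisets with a positive part of size j + 1, which is `Bq`.
  CB : Cser ⊕ ∑ Bq ≗ Rser ⊕ ∑ A′
  CB n = ≡.trans (sym (∑-⊕ (λ j → sh (ex M j) (cF j)) Bq n))
    (≡.trans (∑-cong term n) (∑-⊕ (λ j → sh (ex M j) (rF j)) A′ n))
    where
    term : ∀ j → sh (ex M j) (F ⟨ j , suc j + M ⟩ (λ _ → 1)) ⊕ Bq j ≗
                 sh (ex M j) (F ⟨ suc j , suc j + M ⟩ (ge 1)) ⊕ A′ j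
    term j n = begin
      sh (ex M j) (F w (λ _ → 1)) n + Bq j n
        ≡⟨ cong (_+ Bq j n) (≡.trans (sh-cong (ex M j) (λ m → ≡.trans (F-cong w one-split m) (F-⊕ w le0 (ge 1) m)) n) (sh-⊕ (ex M j) (F w le0) _ n)) ⟩
      A′ j n + sh (ex M j) (F w (ge 1)) n + Bq j n
        ≡⟨ solve 3 (λ a b c → (a :+ b) :+ c := (b :+ c) :+ a) refl (A′ j n) (sh (ex M j) (F w (ge 1)) n) (Bq j n) ⟩
      sh (ex M j) (F w (ge 1)) n + Bq j n + A′ j n
        ≡⟨ cong (_+ A′ j n) (sh-split (ex M j) (suc j) (λ m → ≡.trans (F-unfold j pl w (ge 1) m)
             (cong (F w (ge 1) m +_) (sh-cong (suc j) (F-cong ((j , pl) ∷ w) (λ c → cong ge0 (ℤₚ.pred-suc c))) m))) n) ⟨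
      sh (ex M j) (F ⟨ suc j , suc j + M ⟩ (ge 1)) n + A′ j n ∎
      where w = ⟨ j , suc j + M ⟩

  hA : ∑ A′ ≗ ∑ x0 ⊕ sh 1 (∑ A′) ⊕ sh 1 (∑ w1)
  hA n = begin
    ∑ A′ n
      ≡⟨ ∑-cong (λ j m → ≡.trans (sh-cong (ex M j) (hockey⁻ j (j + M)) m) (≡.trans (sh-⊕ (ex M j) (x⁰ j ⊕ sh 1 (lF j)) (sh 1 (w¹ j)) m)
           (cong₂ _+_ (≡.trans (sh-⊕ (ex M j) (x⁰ j) (sh 1 (lF j)) m) (cong (x0 j m +_) (sh-comm (ex M j) 1 (lF j) m))) (sh-comm (ex M j) 1 (w¹ j) m)))) n ⟩
    ∑ (λ j → x0 j ⊕ sh 1 (A′ j) ⊕ sh 1 (w1 j)) n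
      ≡⟨ ≡.trans (∑-⊕ (λ j → x0 j ⊕ sh 1 (A′ j)) (λ j → sh 1 (w1 j)) n) (cong (_+ ∑ (λ j → sh 1 (w1 j)) n) (∑-⊕ x0 (λ j → sh 1 (A′ j)) n)) ⟩
    ∑ x0 n + ∑ (λ j → sh 1 (A′ j)) n + ∑ (λ j → sh 1 (w1 j)) n
      ≡⟨ cong₂ (λ a b → ∑ x0 n + a + b) (∑-sh A′ (van lF) n) (∑-sh w1 (van w¹) n) ⟨
    ∑ x0 n + sh 1 (∑ A′) n + sh 1 (∑ w1) n ∎

  hB : ∑ Bq ≗ ∑ V0 ⊕ sh 1 (∑ Bq) ⊕ sh 1 (∑ vm)
  hB n = begin
    ∑ Bq n
      ≡⟨ ∑-cong (λ j m → ≡.trans (sh-cong (ex M j + suc j) (hockey⁺ j (suc j + M)) m) (≡.trans (sh-⊕ (ex M j + suc j) (V⁰ j ⊕ sh 1 (gF j)) (sh 1 (v⁻ j)) m)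
           (cong₂ _+_ (≡.trans (sh-⊕ (ex M j + suc j) (V⁰ j) (sh 1 (gF j)) m) (cong (V0 j m +_) (sh-comm (ex M j + suc j) 1 (gF j) m))) (sh-comm (ex M j + suc j) 1 (v⁻ j) m)))) n ⟩
    ∑ (λ j → V0 j ⊕ sh 1 (Bq j) ⊕ sh 1 (vm j)) n
      ≡⟨ ≡.trans (∑-⊕ (λ j → V0 j ⊕ sh 1 (Bq j)) (λ j → sh 1 (vm j)) n) (cong (_+ ∑ (λ j → sh 1 (vm j)) n) (∑-⊕ V0 (λ j → sh 1 (Bq j)) n)) ⟩
    ∑ V0 n + ∑ (λ j → sh 1 (Bq j)) n + ∑ (λ j → sh 1 (vm j)) n
      ≡⟨ cong₂ (λ a b → ∑ V0 n + a + b) (∑-sh Bq (van⁺ gF) n) (∑-sh vm (van⁺ v⁻) n) ⟨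
    ∑ V0 n + sh 1 (∑ Bq) n + sh 1 (∑ vm) n ∎

  -- Extracting the largest positive part leaves `y0`, whose tail is `a0`. Its head is `Qm`, as the
  -- empty multiset is the only one of charge 0 among negative parts.
  f1 : ∑ x0 ≗ Qm ⊕ ∑ a0 ⊕ ∑ Y2
  f1 n = begin
    ∑ x0 n
      ≡⟨ ∑-cong (λ j → sh-split (ex M j) (suc j) (br-pl j (j + M) 0ℤ)) n ⟩
    ∑ (λ j → y0 j ⊕ Y2 j) n
      ≡⟨ ∑-⊕ y0 Y2 n ⟩
    ∑ y0 n + ∑ Y2 n
      ≡⟨ cong (_+ ∑ Y2 n) (∑-head y0 (van (λ j → br j (j + M) 0ℤ)) n) ⟩
    y0 0 n + ∑ a0 n + ∑ Y2 n
      ≡⟨ cong (λ z → z + ∑ a0 n + ∑ Y2 n) (≡.trans (sh-exp (+-identityʳ (suc M)) _ n) (sh-cong (suc M) (mi-zero 0 M) n)) ⟩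
    Qm n + ∑ a0 n + ∑ Y2 n ∎
    where
    y0 : ℕ → Ser
    y0 j = sh (ex M j) (br j (j + M) 0ℤ)

  -- `w1 0` vanishes for lack of positive parts, while `W0 0` is q^(M+2) and has no partner in `Z`;
  -- this mismatch is the summand `sh 1 Qm`, which later becomes the constant c of `fix1`.
  f2 : sh 1 (∑ w1) ⊕ sh 1 Qm ≗ sh 1 (∑ X2) ⊕ ∑ W0
  f2 n = begin
    sh 1 (∑ w1) n + sh 1 Qm n
      ≡⟨ cong (_+ sh 1 Qm n) (sh-cong 1 sumw1 n) ⟩
    sh 1 (∑ X2 ⊕ ∑ Z) n + sh 1 Qm n
      ≡⟨ cong (_+ sh 1 Qm n) (sh-⊕ 1 (∑ X2) (∑ Z) n) ⟩
    sh 1 (∑ X2) n + sh 1 (∑ Z) n + sh 1 Qm n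
      ≡⟨ solve 3 (λ a b c → (a :+ b) :+ c := a :+ (c :+ b)) refl (sh 1 (∑ X2) n) (sh 1 (∑ Z) n) (sh 1 Qm n) ⟩
    sh 1 (∑ X2) n + (sh 1 Qm n + sh 1 (∑ Z) n)
      ≡⟨ cong (sh 1 (∑ X2) n +_) (sym sumW0) ⟩
    sh 1 (∑ X2) n + ∑ W0 n ∎
    where
    Z : ℕ → Ser
    Z j = sh (ex M (suc j) + suc j) (br (suc j) (suc (suc j + M)) 0ℤ)
    sumw1 : ∑ w1 ≗ ∑ X2 ⊕ ∑ Z
    sumw1 m = begin
      ∑ w1 m
        ≡⟨ ∑-head w1 (van w¹) m ⟩
      w1 0 m + ∑ (w1 ∘ suc) m
        ≡⟨ cong₂ _+_ (≡.trans (sh-cong (ex M 0) (mi-pos 0 (suc M) 0) m) (sh-0 (ex M 0) m))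
             (∑-cong (λ j → sh-split (ex M (suc j)) (suc j) (br-pl j (suc (suc j + M)) 1ℤ)) m) ⟩
      ∑ (λ j → X2 j ⊕ Z j) m
        ≡⟨ ∑-⊕ X2 Z m ⟩
      ∑ X2 m + ∑ Z m ∎
    sumW0 : ∑ W0 n ≡ sh 1 Qm n + sh 1 (∑ Z) n
    sumW0 = begin
      ∑ W0 n
        ≡⟨ ∑-head W0 (van⁺ (λ j → br j (suc j + M) 0ℤ)) n ⟩
      W0 0 n + ∑ (W0 ∘ suc) n
        ≡⟨ cong₂ _+_ (≡.trans (sh-exp (≡.trans (+-comm (suc M + 0) 1) (cong (λ z → suc (suc z)) (+-identityʳ M))) _ n)
              (≡.trans (sh-cong (suc (suc M)) (mi-zero 0 (suc M)) n) (sym (sh-sh 1 (suc M) unit n))))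
             (∑-cong (λ j m → ≡.trans (sh-exp (+-suc (ex M (suc j)) (suc j)) _ m) (sym (sh-sh 1 (ex M (suc j) + suc j) _ m))) n) ⟩
      sh 1 Qm n + ∑ (λ j → sh 1 (Z j)) n
        ≡⟨ cong (sh 1 Qm n +_) (∑-sh Z (ex-van M (λ j → ex M (suc j) + suc j) (λ j → br (suc j) (suc (suc j + M)) 0ℤ) (λ j → ≤-trans (ex-mono M j) (m≤m+n (ex M (suc j)) (suc j)))) n) ⟨
      sh 1 Qm n + sh 1 (∑ Z) n ∎

  f3 : ∑ V0 ≗ ∑ W0 ⊕ ∑ X2
  f3 n = ≡.trans (∑-cong (λ j m → ≡.trans (sh-split (ex M j + suc j) (suc (suc j + M)) (br-mi j (suc j + M) 0ℤ) m)
    (cong (W0 j m +_) (sh-exp (sym (ex-suc M j)) _ m))) n) (∑-⊕ W0 X2 n)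

  f4 : sh 1 (∑ vm) ≗ sh 1 (∑ Y2) ⊕ ∑ a0
  f4 n = begin
    sh 1 (∑ vm) n
      ≡⟨ ∑-sh vm (van⁺ v⁻) n ⟩
    ∑ (λ j → sh 1 (vm j)) n
      ≡⟨ ∑-cong (λ j m → ≡.trans (sh-cong 1 (sh-split (ex M j + suc j) (suc j + M) (br-mi (suc j) (j + M) -1ℤ)) m)
           (≡.trans (sh-⊕ 1 (Y2 j) _ m) (cong (sh 1 (Y2 j) m +_) (≡.trans (sh-sh 1 (ex M j + suc j + (suc j + M)) _ m)
             (sh-exp (≡.trans (sym (+-suc (ex M j + suc j) (suc j + M))) (sym (ex-suc M j))) _ m))))) n ⟩
    ∑ (λ j → sh 1 (Y2 j) ⊕ a0 j) n
      ≡⟨ ∑-⊕ (λ j → sh 1 (Y2 j)) a0 n ⟩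
    ∑ (λ j → sh 1 (Y2 j)) n + ∑ a0 n
      ≡⟨ cong (_+ ∑ a0 n) (∑-sh Y2 (van⁺ (λ j → br (suc j) (j + M) -1ℤ)) n) ⟨
    sh 1 (∑ Y2) n + ∑ a0 n ∎

  -- Both sides f satisfy f + q^(M+2) = k + q f with the same k.
  AB : ∑ A′ ⊕ ∑ X2 ≗ ∑ Bq ⊕ Qm ⊕ ∑ Y2
  AB = fix1 {c = sh 1 Qm} {k = Qm ⊕ ∑ a0 ⊕ ∑ Y2 ⊕ ∑ W0 ⊕ ∑ X2} left right
    where
    left : ∑ A′ ⊕ ∑ X2 ⊕ sh 1 Qm ≗ Qm ⊕ ∑ a0 ⊕ ∑ Y2 ⊕ ∑ W0 ⊕ ∑ X2 ⊕ sh 1 (∑ A′ ⊕ ∑ X2)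
    left n = begin
      ∑ A′ n + ∑ X2 n + sh 1 Qm n
        ≡⟨ cong (λ z → z + ∑ X2 n + sh 1 Qm n) (≡.trans (hA n) (cong (λ z → z + sh 1 (∑ A′) n + sh 1 (∑ w1) n) (f1 n))) ⟩
      Qm n + ∑ a0 n + ∑ Y2 n + sh 1 (∑ A′) n + sh 1 (∑ w1) n + ∑ X2 n + sh 1 Qm n
        ≡⟨ solve 5 (λ k a w x z → (((k :+ a) :+ w) :+ x) :+ z := ((k :+ x) :+ a) :+ (w :+ z)) refl (Qm n + ∑ a0 n + ∑ Y2 n) (sh 1 (∑ A′) n) (sh 1 (∑ w1) n) (∑ X2 n) (sh 1 Qm n) ⟩
      Qm n + ∑ a0 n + ∑ Y2 n + ∑ X2 n + sh 1 (∑ A′) n + (sh 1 (∑ w1) n + sh 1 Qm n)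
        ≡⟨ cong (Qm n + ∑ a0 n + ∑ Y2 n + ∑ X2 n + sh 1 (∑ A′) n +_) (f2 n) ⟩
      Qm n + ∑ a0 n + ∑ Y2 n + ∑ X2 n + sh 1 (∑ A′) n + (sh 1 (∑ X2) n + ∑ W0 n)
        ≡⟨ solve 5 (λ k a w x z → ((k :+ x) :+ a) :+ (w :+ z) := ((k :+ z) :+ x) :+ (a :+ w)) refl (Qm n + ∑ a0 n + ∑ Y2 n) (sh 1 (∑ A′) n) (sh 1 (∑ X2) n) (∑ X2 n) (∑ W0 n) ⟩
      Qm n + ∑ a0 n + ∑ Y2 n + ∑ W0 n + ∑ X2 n + (sh 1 (∑ A′) n + sh 1 (∑ X2) n)
        ≡⟨ cong (Qm n + ∑ a0 n + ∑ Y2 n + ∑ W0 n + ∑ X2 n +_) (sh-⊕ 1 (∑ A′) (∑ X2) n) ⟨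
      Qm n + ∑ a0 n + ∑ Y2 n + ∑ W0 n + ∑ X2 n + sh 1 (∑ A′ ⊕ ∑ X2) n ∎
    right : ∑ Bq ⊕ Qm ⊕ ∑ Y2 ⊕ sh 1 Qm ≗ Qm ⊕ ∑ a0 ⊕ ∑ Y2 ⊕ ∑ W0 ⊕ ∑ X2 ⊕ sh 1 (∑ Bq ⊕ Qm ⊕ ∑ Y2)
    right n = begin
      ∑ Bq n + Qm n + ∑ Y2 n + sh 1 Qm n
        ≡⟨ cong (λ z → z + Qm n + ∑ Y2 n + sh 1 Qm n) (≡.trans (hB n) (cong₂ (λ y z → y + sh 1 (∑ Bq) n + z) (f3 n) (f4 n))) ⟩
      ∑ W0 n + ∑ X2 n + sh 1 (∑ Bq) n + (sh 1 (∑ Y2) n + ∑ a0 n) + Qm n + ∑ Y2 n + sh 1 Qm n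
        ≡⟨ solve 8 (λ w x b y a q z p → (((((w :+ x) :+ b) :+ (y :+ a)) :+ q) :+ z) :+ p := ((((q :+ a) :+ z) :+ w) :+ x) :+ ((b :+ p) :+ y)) refl
             (∑ W0 n) (∑ X2 n) (sh 1 (∑ Bq) n) (sh 1 (∑ Y2) n) (∑ a0 n) (Qm n) (∑ Y2 n) (sh 1 Qm n) ⟩
      Qm n + ∑ a0 n + ∑ Y2 n + ∑ W0 n + ∑ X2 n + (sh 1 (∑ Bq) n + sh 1 Qm n + sh 1 (∑ Y2) n)
        ≡⟨ cong (Qm n + ∑ a0 n + ∑ Y2 n + ∑ W0 n + ∑ X2 n +_) (≡.trans (sh-⊕ 1 (∑ Bq ⊕ Qm) (∑ Y2) n) (cong (_+ sh 1 (∑ Y2) n) (sh-⊕ 1 (∑ Bq) Qm n))) ⟨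
      Qm n + ∑ a0 n + ∑ Y2 n + ∑ W0 n + ∑ X2 n + sh 1 (∑ Bq ⊕ Qm ⊕ ∑ Y2) n ∎

  crank-rank : Cser ⊕ ∑ X2 ≗ Rser ⊕ (Qm ⊕ ∑ Y2)
  crank-rank n = +-cancelʳ-≡ (∑ Bq n) _ _ (begin
    Cser n + ∑ X2 n + ∑ Bq n                 ≡⟨ solve 3 (λ a b c → (a :+ b) :+ c := (a :+ c) :+ b) refl (Cser n) (∑ X2 n) (∑ Bq n) ⟩
    Cser n + ∑ Bq n + ∑ X2 n                 ≡⟨ cong (_+ ∑ X2 n) (CB n) ⟩
    Rser n + ∑ A′ n + ∑ X2 n                 ≡⟨ +-assoc (Rser n) _ _ ⟩
    Rser n + (∑ A′ n + ∑ X2 n)               ≡⟨ cong (Rser n +_) (AB n) ⟩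
    Rser n + (∑ Bq n + Qm n + ∑ Y2 n)        ≡⟨ solve 4 (λ r b q y → r :+ ((b :+ q) :+ y) := (r :+ (q :+ y)) :+ b) refl (Rser n) (∑ Bq n) (Qm n) (∑ Y2 n) ⟩
    Rser n + (Qm n + ∑ Y2 n) + ∑ Bq n        ∎)

  R₀-split : R₀ser ≗ ∑ v0 ⊕ Rser
  R₀-split n = ≡.trans (∑-cong (λ j m → ≡.trans (sh-cong (ex M j) (λ k →
    ≡.trans (F-cong ⟨ suc j , suc j + M ⟩ (ge-split 0) k) (F-⊕ ⟨ suc j , suc j + M ⟩ (δ 0ℤ) (ge 1) k)) m) (sh-⊕ (ex M j) (br (suc j) (suc j + M) 0ℤ) (rF j) m)) n)
    (∑-⊕ v0 (λ j → sh (ex M j) (rF j)) n)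

C≼R₀ : ∀ M → Frame.Cser M ≼ Frame.R₀ser M
C≼R₀ M n = begin
  Cser n                                  ≤⟨ m≤m+n _ (∑ X2 n) ⟩
  -- `∑ a0` will be added to complete the right-hand side of `f1`, which trades q^m and `∑ Y2` for
  -- `∑ x0`, a lower bound of `∑ v0`.
  Cser n + ∑ X2 n                         ≡⟨ crank-rank n ⟩
  Rser n + (Qm n + ∑ Y2 n)                ≤⟨ +-monoʳ-≤ (Rser n) (+-monoˡ-≤ (∑ Y2 n) (m≤m+n (Qm n) (∑ a0 n))) ⟩
  Rser n + (Qm n + ∑ a0 n + ∑ Y2 n)       ≡⟨ cong (Rser n +_) (f1 n) ⟨
  Rser n + ∑ x0 n                         ≤⟨ +-monoʳ-≤ (Rser n) (∑-mono (λ j → sh-mono (ex M j) (λ m →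
                                               ≤-trans (m≤m+n _ _) (≤-reflexive (sym (br-mi (suc j) (j + M) 0ℤ m))))) n) ⟩
  Rser n + ∑ v0 n                         ≡⟨ +-comm (Rser n) _ ⟩
  ∑ v0 n + Rser n                         ≡⟨ R₀-split n ⟨
  R₀ser n                                 ∎
  where
  open Frame M
  open ≤-Reasoning

-- Reflection and insertion inequalities

∈-rng : ∀ s a {i k} → i < k → (a + i , s) ∈ rng s a k
∈-rng s a {i} {suc k} (s≤s l) with m≤n⇒m<n∨m≡n l
... | inj₁ i<k  = there (∈-rng s a i<k)
... | inj₂ refl = here refl

∈-pl : ∀ {i A} B → i < A → (i , pl) ∈ ⟨ A , B ⟩
∈-pl B l = ∈-++⁺ˡ (∈-rng pl 0 l)

∈-mi : ∀ A {i B} → i < B → (i , mi) ∈ ⟨ A , B ⟩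
∈-mi A l = ∈-++⁺ʳ (rng pl 0 A) (∈-rng mi 0 l)

-- Unimodality in steps of two: the reflection principle, in the form of a double recursion.

Uni : ℕ → ℕ → Set
Uni A B = ∀ i j → br A B (ℤ.+ (i + j)) ≼ br A B (j ℤ.⊖ i)

suc-⊖ : ∀ j i → ℤ.suc (j ℤ.⊖ i) ≡ suc j ℤ.⊖ i
suc-⊖ j i = ℤₚ.distribʳ-⊖-+-pos 1 j i

0⊖ : ∀ i → 0 ℤ.⊖ i ≡ ℤ.- (ℤ.+ i)
0⊖ zero    = refl
0⊖ (suc i) = refl

-- Extracting a negative part raises both charges by 1, that is, j by 1 with i fixed.
uni-mi : ∀ A B → Uni A B → Uni A (suc B)
uni-mi A B′ u i j = fix-≼ {I = ℕ × ℕ} B′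
  {X = λ (i , j) → br A (suc B′) (ℤ.+ (i + j))} {A = λ (i , j) → br A B′ (ℤ.+ (i + j))}
  {Y = λ (i , j) → br A (suc B′) (j ℤ.⊖ i)} {B = λ (i , j) → br A B′ (j ℤ.⊖ i)}
  (λ (i , j) → i , suc j)
  (λ (i , j) n → ≤-reflexive (≡.trans (br-mi A B′ (ℤ.+ (i + j)) n) (cong (br A B′ (ℤ.+ (i + j)) n +_)
     (cong (λ z → sh (suc B′) (br A (suc B′) (ℤ.+ z)) n) (sym (+-suc i j))))))
  (λ (i , j) n → ≤-reflexive (sym (≡.trans (br-mi A B′ (j ℤ.⊖ i) n) (cong (br A B′ (j ℤ.⊖ i) n +_)
     (cong (λ z → sh (suc B′) (br A (suc B′) z) n) (suc-⊖ j i))))))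
  (λ (i , j) → u i j) (i , j)

-- Extracting a positive part lowers j, so the recursion reaches j = 0. There the charges i and -i
-- are equally frequent because positive and negative sizes agree; this is why the induction runs
-- along the diagonal.
uni-pl : ∀ A → Uni A (suc A) → Uni (suc A) (suc A)
uni-pl A u i j n = <-rec (λ n → ∀ i j → br S S (ℤ.+ (i + j)) n ≤ br S S (j ℤ.⊖ i) n) step n i j
  where
  S = suc A
  step : ∀ n → (∀ {m} → m < n → ∀ i j → br S S (ℤ.+ (i + j)) m ≤ br S S (j ℤ.⊖ i) m) →
         ∀ i j → br S S (ℤ.+ (i + j)) n ≤ br S S (j ℤ.⊖ i) n
  step n rec i zero    = ≤-reflexive (≡.trans (cong (λ z → br S S (ℤ.+ z) n) (+-identityʳ i))
    (≡.trans (sym (br-flip S S (ℤ.+ i) n)) (cong (λ z → br S S z n) (sym (0⊖ i)))))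
  step n rec i (suc j) = begin
    br S S (ℤ.+ (i + suc j)) n
      ≡⟨ br-pl A S (ℤ.+ (i + suc j)) n ⟩
    br A S (ℤ.+ (i + suc j)) n + sh S (br S S (ℤ.pred (ℤ.+ (i + suc j)))) n
      ≤⟨ +-mono-≤ (u i (suc j) n) (sh-local _≤_ z≤n A (λ m l → ≤-trans
           (≤-reflexive (cong (λ z → br S S z m) (≡.trans (cong (ℤ.pred ∘ ℤ.+_) (+-suc i j)) refl))) (rec l i j))) ⟩
    br A S (suc j ℤ.⊖ i) n + sh S (br S S (j ℤ.⊖ i)) n
      ≡⟨ cong (λ z → br A S (suc j ℤ.⊖ i) n + sh S (br S S z) n)
           (≡.trans (sym (ℤₚ.pred-suc (j ℤ.⊖ i))) (cong ℤ.pred (suc-⊖ j i))) ⟩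
    br A S (suc j ℤ.⊖ i) n + sh S (br S S (ℤ.pred (suc j ℤ.⊖ i))) n
      ≡⟨ br-pl A S (suc j ℤ.⊖ i) n ⟨
    br S S (suc j ℤ.⊖ i) n ∎
    where open ≤-Reasoning

uni-diag : ∀ A → Uni A A
uni-diag zero    zero    zero    zero    = ≤-refl
uni-diag zero    (suc i) j       zero    = z≤n
uni-diag zero    zero    (suc j) zero    = z≤n
uni-diag zero    i       j       (suc n) = z≤n
uni-diag (suc A) = uni-pl A (uni-mi A A (uni-diag A))

uni : ∀ A k → Uni A (A + k)
uni A zero    = subst (Uni A) (sym (+-identityʳ A)) (uni-diag A)
uni A (suc k) = subst (Uni A) (sym (+-suc A k)) (uni-mi A (A + k) (uni A k))

≼-trans : ∀ {f g h : Ser} → f ≼ g → g ≼ h → f ≼ h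
≼-trans p q n = ≤-trans (p n) (q n)

sh-twice : ∀ a b {f : Ser} → sh a f ≼ f → sh b f ≼ f → sh (a + b) f ≼ f
sh-twice a b {f} p q n = ≤-trans (≤-reflexive (sym (sh-sh a b f n))) (≤-trans (sh-mono a q n) (p n))

-- The positive 1 forms neutral blocks of sizes 2 and 3 with the negative 1 and 2, and every size
-- from 2 on is a sum of such blocks.
neutral₂ : ∀ {L} → (0 , pl) ∈ L → (0 , mi) ∈ L → (1 , mi) ∈ L → ∀ d e → sh (2 + e) (B L d) ≼ B L d
neutral₂ p m m′ d zero          = insert₂ p m d
neutral₂ p m m′ d (suc zero)    = insert₂ p m′ d
neutral₂ p m m′ d (suc (suc e)) = sh-twice 2 (2 + e) (insert₂ p m d) (neutral₂ p m m′ d e)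

-- Costs 1 and 2 are met by a single negative part, a higher cost by a negative 1 and a neutral
-- filling of the rest.
lower : ∀ {L} → (0 , pl) ∈ L → (0 , mi) ∈ L → (1 , mi) ∈ L → ∀ d k → sh (suc k) (B L (ℤ.suc d)) ≼ B L d
lower p m m′ d zero          = insert m d
lower p m m′ d (suc zero)    = insert m′ d
lower {L} p m m′ d (suc (suc k)) n = ≤-trans (≤-reflexive (≡.trans (sh-exp (+-comm 1 (2 + k)) (B L (ℤ.suc d)) n) (sym (sh-sh (2 + k) 1 (B L (ℤ.suc d)) n))))
  (≤-trans (sh-mono (2 + k) (insert m d) n) (neutral₂ p m m′ d k n))

-- The comparison of X and Y for M ≥ 1

module Positive (μ : ℕ) where
  private M = suc μ
  open Frame M
  open +-*-Solver using (solve; _:+_; _:=_; _:*_; con)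

  -- The negative part of size A + M + 1 is traded for the positive part of size A + 1. Each trade
  -- frees M cells, whence the exponent M (k + 1). Once no such part is left, `lower` spends these
  -- cells, at least one as M ≥ 1, on reaching charge k + 1, and `uni` reflects this to -(k + 1).
  reach : ∀ j k → let A = suc j in sh (M * suc k) (br A (suc A + M) (ℤ.+ (2 + k))) ≼ br (suc A) (A + M) -[1+ k ]
  reach j = fix-≼ {I = ℕ} A
    {X = λ k → sh (M * suc k) (br A (suc A + M) (ℤ.+ (2 + k)))} {A = λ k → sh (M * suc k) (br A (A + M) (ℤ.+ (2 + k)))}
    {Y = λ k → br (suc A) (A + M) -[1+ k ]} {B = λ k → br A (A + M) -[1+ k ]} suc
    (λ k n → ≤-reflexive (≡.trans (sh-split (M * suc k) (suc A + M) (br-mi A (A + M) (ℤ.+ (2 + k))) n)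
      (cong (sh (M * suc k) (br A (A + M) (ℤ.+ (2 + k))) n +_) (≡.trans (sh-exp (expo k) _ n) (sym (sh-sh (suc A) (M * suc (suc k)) _ n))))))
    (λ k n → ≤-reflexive (sym (br-pl A (A + M) -[1+ k ] n)))
    (λ k → ≼-trans (lower (∈-pl (A + M) (s≤s z≤n)) (∈-mi A (s≤s z≤n)) (∈-mi A two) (ℤ.+ suc k) (k + μ * suc k))
      (λ n → ≤-trans (≤-reflexive (cong (λ z → br A (A + M) (ℤ.+ z) n) (sym (+-identityʳ (suc k))))) (uni A M (suc k) 0 n)))
    where
    A = suc j
    two : 1 < A + M
    two = subst (1 <_) (cong suc (sym (+-suc j μ))) (s≤s (s≤s z≤n))
    expo : ∀ k → M * suc k + (suc A + M) ≡ suc A + M * suc (suc k)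
    expo = solve 3 (λ M A k → M :* (con 1 :+ k) :+ (A :+ M) := A :+ M :* (con 2 :+ k)) refl M (suc A)

  -- A neutral pair of size 2 absorbs the surplus of the first term. The two terms are then
  -- `br A (suc A + M) (+ 2)` with and without its largest positive part, and `reach` applies.
  bound : ∀ j → let A = suc j in
    sh (suc (suc A + M)) (br A (suc A + M) 1ℤ) ⊕ sh M (br j (suc A + M) (ℤ.+ 2)) ≼ br (suc A) (A + M) -1ℤ
  bound j n = begin
    sh (suc (suc A + M)) (br A (suc A + M) 1ℤ) n + sh M (br j (suc A + M) (ℤ.+ 2)) n
      ≡⟨ cong (_+ sh M (br j (suc A + M) (ℤ.+ 2)) n) (≡.trans (sh-exp (expo M A) _ n) (sym (sh-sh (M + A) 2 _ n))) ⟩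
    sh (M + A) (sh 2 (br A (suc A + M) 1ℤ)) n + sh M (br j (suc A + M) (ℤ.+ 2)) n
      ≤⟨ +-monoˡ-≤ _ (sh-mono (M + A) (insert₂ (∈-pl (suc A + M) (s≤s z≤n)) (∈-mi A (s≤s z≤n)) 1ℤ) n) ⟩
    sh (M + A) (br A (suc A + M) 1ℤ) n + sh M (br j (suc A + M) (ℤ.+ 2)) n
      ≡⟨ +-comm (sh (M + A) (br A (suc A + M) 1ℤ) n) _ ⟩
    sh M (br j (suc A + M) (ℤ.+ 2)) n + sh (M + A) (br A (suc A + M) 1ℤ) n
      ≡⟨ sh-split M A (br-pl j (suc A + M) (ℤ.+ 2)) n ⟨
    sh M (br A (suc A + M) (ℤ.+ 2)) n
      ≡⟨ sh-exp (*-identityʳ M) _ n ⟨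
    sh (M * 1) (br A (suc A + M) (ℤ.+ 2)) n
      ≤⟨ reach j 0 n ⟩
    br (suc A) (A + M) -1ℤ n ∎
    where
    open ≤-Reasoning
    A = suc j
    expo : ∀ M A → suc (suc A + M) ≡ M + A + 2
    expo = solve 2 (λ M A → con 2 :+ (A :+ M) := (M :+ A) :+ con 2) refl

  -- `X2` split by its largest negative part. As `T1 0` vanishes, `T1` may be shifted by one:
  -- `T1 (suc j)` and `T2 j` both carry the power of q that stands in front of `Y2 (suc j)`.
  T1 T2 : ℕ → Ser
  T1 j = sh (ex M (suc j)) (br j (suc j + M) 1ℤ)
  T2 j = sh (ex M (suc j) + suc (suc j + M)) (br j (suc (suc j + M)) (ℤ.+ 2))

  term : ∀ j → T1 (suc j) ⊕ T2 j ≼ Y2 (suc j)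
  term j n = begin
    T1 A n + T2 j n
      ≡⟨ cong₂ _+_ (≡.trans (sh-exp (ex-suc M A) w n) (sym (sh-sh (ex M A + suc A) _ w n)))
           (≡.trans (sh-exp (expo (ex M A) A M) v n) (sym (sh-sh (ex M A + suc A) M v n))) ⟩
    sh (ex M A + suc A) (sh (suc (suc A + M)) w) n + sh (ex M A + suc A) (sh M v) n
      ≡⟨ sh-⊕ (ex M A + suc A) (sh (suc (suc A + M)) w) (sh M v) n ⟨
    sh (ex M A + suc A) (sh (suc (suc A + M)) w ⊕ sh M v) n
      ≤⟨ sh-mono (ex M A + suc A) (bound j) n ⟩
    Y2 A n ∎
    where
    open ≤-Reasoning
    A = suc j
    w = br A (suc A + M) 1ℤ
    v = br j (suc A + M) (ℤ.+ 2)
    expo : ∀ e A M → e + suc (A + M) ≡ e + suc A + M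
    expo = solve 3 (λ e A M → e :+ (con 1 :+ (A :+ M)) := (e :+ (con 1 :+ A)) :+ M) refl

  X≼Y : ∑ X2 ≼ Qm ⊕ ∑ Y2
  X≼Y n = begin
    ∑ X2 n
      ≡⟨ ∑-cong (λ j → sh-split (ex M (suc j)) (suc (suc j + M)) (br-mi j (suc j + M) 1ℤ)) n ⟩
    ∑ (λ j → T1 j ⊕ T2 j) n
      ≡⟨ ∑-⊕ T1 T2 n ⟩
    ∑ T1 n + ∑ T2 n
      ≡⟨ cong (_+ ∑ T2 n) (≡.trans (∑-head T1 (ex-van M (ex M ∘ suc) (λ j → br j (suc j + M) 1ℤ) (ex-mono M)) n)
           (cong (_+ ∑ (T1 ∘ suc) n) (≡.trans (sh-cong (ex M 1) (mi-pos 0 (suc M) 0) n) (sh-0 (ex M 1) n)))) ⟩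
    ∑ (T1 ∘ suc) n + ∑ T2 n
      ≡⟨ ∑-⊕ (T1 ∘ suc) T2 n ⟨
    ∑ (λ j → T1 (suc j) ⊕ T2 j) n
      ≤⟨ ∑-mono term n ⟩
    ∑ (Y2 ∘ suc) n
      ≤⟨ m≤n+m _ (Y2 0 n) ⟩
    Y2 0 n + ∑ (Y2 ∘ suc) n
      ≡⟨ ∑-head Y2 (van⁺ (λ j → br (suc j) (j + M) -1ℤ)) n ⟨
    ∑ Y2 n
      ≤⟨ m≤n+m _ (Qm n) ⟩
    Qm n + ∑ Y2 n ∎
    where open ≤-Reasoning

-- The comparison of X and Y for M = 0

-- What remains to be shown for M = 0 at the Durfee square of side j + 1.

Key : ℕ → Set
Key j = sh 1 (br j n 1ℤ) ⊕ sh (2 + n) (br j (suc n) (ℤ.+ 2)) ≼ br j n (ℤ.+ 2) ⊕ sh (2 + n) (br n n 1ℤ)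
  where n = suc j

pl-strip : ∀ i k c → let L = (i , pl) ∷ rng mi 0 k in B L (ℤ.+ suc c) ≗ sh (suc i) (B L (ℤ.+ c))
pl-strip i k c n = ≡.trans (B-unfold i pl (rng mi 0 k) (ℤ.+ suc c) n) (cong (_+ sh (suc i) (B ((i , pl) ∷ rng mi 0 k) (ℤ.+ c)) n) (mi-pos 0 k c n))

key0 : Key 0
key0 n = ≤-trans (≤-reflexive (cong₂ _+_ (≡.trans (sh-cong 1 (mi-pos 0 1 0) n) (sh-0 1 n)) (≡.trans (sh-cong 3 (mi-pos 0 2 1) n) (sh-0 3 n)))) z≤n

-- With the positive part 1 alone, raising the charge by 1 costs a factor q, so the first summands
-- agree. For the others, a negative 3 in `br 1 3 2` forces a further positive 1, so this series
-- solves x = q^2 `br 1 2 0` + q^4 x, and `br 2 2 1` satisfies x ≥ q^2 `br 1 2 0` + q^4 x.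
key1 : Key 1
key1 n = +-mono-≤ (≤-reflexive (sym (pl-strip 0 2 1 n))) (sh-mono 4 kw n)
  where
  k-rec : br 1 3 (ℤ.+ 2) ≗ sh 2 (br 1 2 0ℤ) ⊕ sh 4 (br 1 3 (ℤ.+ 2))
  k-rec m = ≡.trans (br-mi 1 2 (ℤ.+ 2) m) (cong₂ _+_
    (≡.trans (pl-strip 0 2 1 m) (≡.trans (sh-cong 1 (pl-strip 0 2 0) m) (sh-sh 1 1 _ m)))
    (≡.trans (sh-cong 3 (pl-strip 0 3 2) m) (sh-sh 3 1 _ m)))
  w-rec : sh 2 (br 1 2 0ℤ) ⊕ sh 4 (br 2 2 1ℤ) ≼ br 2 2 1ℤ
  w-rec m = begin
    sh 2 (br 1 2 0ℤ) m + sh 4 (br 2 2 1ℤ) m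
      ≡⟨ cong (_+ sh 4 (br 2 2 1ℤ) m) (sh-cong 2 (br-flip 1 2 0ℤ) m) ⟩
    sh 2 (br 2 1 0ℤ) m + sh 4 (br 2 2 1ℤ) m
      ≡⟨ sh-split 2 2 (br-mi 2 1 0ℤ) m ⟨
    sh 2 (br 2 2 0ℤ) m
      ≤⟨ m≤n+m _ (br 1 2 1ℤ m) ⟩
    br 1 2 1ℤ m + sh 2 (br 2 2 0ℤ) m
      ≡⟨ br-pl 1 2 1ℤ m ⟨
    br 2 2 1ℤ m ∎
    where open ≤-Reasoning
  kw : br 1 3 (ℤ.+ 2) ≼ br 2 2 1ℤ
  kw = fix-≼ {I = ⊤} 3 {X = λ _ → br 1 3 (ℤ.+ 2)} {A = λ _ → sh 2 (br 1 2 0ℤ)}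
    {Y = λ _ → br 2 2 1ℤ} {B = λ _ → sh 2 (br 1 2 0ℤ)} id
    (λ _ m → ≤-reflexive (k-rec m)) (λ _ → w-rec) (λ _ m → ≤-refl) tt

module Large (i : ℕ) where
  j n N : ℕ
  j = 2 + i
  n = 3 + i
  N = 2 + n

  u w k : ℤ → Ser
  u = br j n
  w = br n n
  k = br j (suc n)

  -- ⟨ j , n ⟩ with positive sizes left out: `β` lacks 1, `E` lacks 2, `H` lacks both.
  H β E : List Part
  H = rng pl 2 i ++ rng mi 0 n
  β = (1 , pl) ∷ H
  E = (0 , pl) ∷ H

  u-split : ⟨ j , n ⟩ ↭ (0 , pl) ∷ β
  u-split = trans (++⁺ʳ (rng mi 0 n) (rng-bottom pl 0 (suc i))) (prep _ (++⁺ʳ (rng mi 0 n) (rng-bottom pl 1 i)))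

  open +-*-Solver using (solve; _:+_; _:=_)
  open ≤-Reasoning

  -- The analogue of `reach`: trading the negative n + 1 for the positive n frees one cell each
  -- time. `lower` brings the charge e + 3 to e + 2, and `uni` reflects e + 2 about 1 to -e.
  k≼w : ∀ e → sh (suc e) (k (ℤ.+ (3 + e))) ≼ w (0 ℤ.⊖ e)
  k≼w = fix-≼ {I = ℕ} j {X = λ e → sh (suc e) (k (ℤ.+ (3 + e)))} {A = λ e → sh (suc e) (u (ℤ.+ (3 + e)))}
    {Y = λ e → w (0 ℤ.⊖ e)} {B = λ e → u (0 ℤ.⊖ e)} suc
    (λ e m → ≤-reflexive (≡.trans (sh-split (suc e) (suc n) (br-mi j n (ℤ.+ (3 + e))) m)
      (cong (sh (suc e) (u (ℤ.+ (3 + e))) m +_) (≡.trans (sh-exp (expo e n) _ m) (sym (sh-sh n (2 + e) _ m))))))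
    (λ e m → ≤-reflexive (sym (≡.trans (br-pl j n (0 ℤ.⊖ e) m) (cong (λ z → u (0 ℤ.⊖ e) m + sh n (w z) m) (pred-⊖ e)))))
    (λ e → ≼-trans (lower (∈-pl n (s≤s z≤n)) (∈-mi j (s≤s z≤n)) (∈-mi j (s≤s (s≤s z≤n))) (ℤ.+ (2 + e)) e)
      (λ m → ≤-trans (≤-reflexive (cong (λ z → u (ℤ.+ z) m) (+-comm 1 (suc e))))
        (≤-trans (subst (Uni j) (+-comm j 1) (uni j 1) (suc e) 1 m) (≤-reflexive (cong (λ z → u z m) (ℤₚ.[1+m]⊖[1+n]≡m⊖n 0 e))))))
    where
    expo : ∀ e n → suc e + suc n ≡ n + (2 + e)
    expo = solve 2 (λ e n → (con 1 :+ e) :+ (con 1 :+ n) := n :+ (con 2 :+ e)) refl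
      where open +-*-Solver
    pred-⊖ : ∀ e → ℤ.pred (0 ℤ.⊖ e) ≡ 0 ℤ.⊖ suc e
    pred-⊖ zero    = refl
    pred-⊖ (suc e) = refl

  k⊕u : k (ℤ.+ 2) ⊕ u 1ℤ ≼ u (ℤ.+ 2) ⊕ w 1ℤ
  k⊕u m = begin
    k (ℤ.+ 2) m + u 1ℤ m
      ≡⟨ cong (_+ u 1ℤ m) (br-mi j n (ℤ.+ 2) m) ⟩
    u (ℤ.+ 2) m + sh (suc n) (k (ℤ.+ 3)) m + u 1ℤ m
      ≡⟨ solve 3 (λ a b c → (a :+ b) :+ c := a :+ (c :+ b)) refl (u (ℤ.+ 2) m) (sh (suc n) (k (ℤ.+ 3)) m) (u 1ℤ m) ⟩
    u (ℤ.+ 2) m + (u 1ℤ m + sh (suc n) (k (ℤ.+ 3)) m)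
      ≡⟨ cong (λ z → u (ℤ.+ 2) m + (u 1ℤ m + z)) (≡.trans (sh-exp (+-comm 1 n) _ m) (sym (sh-sh n 1 _ m))) ⟩
    u (ℤ.+ 2) m + (u 1ℤ m + sh n (sh 1 (k (ℤ.+ 3))) m)
      ≤⟨ +-monoʳ-≤ (u (ℤ.+ 2) m) (+-monoʳ-≤ (u 1ℤ m) (sh-mono n (k≼w 0) m)) ⟩
    u (ℤ.+ 2) m + (u 1ℤ m + sh n (w 0ℤ) m)
      ≡⟨ cong (u (ℤ.+ 2) m +_) (br-pl j n 1ℤ m) ⟨
    u (ℤ.+ 2) m + w 1ℤ m ∎

  -- After `sh N (u 1ℤ)` is added on both sides, `k⊕u` removes `k` and `w`, and q u(1) + q^N u(2) ≤
  -- u(2) + q^N u(1) remains. Extracting the positive 1 from u(2), and from the u(1) that this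
  -- leaves on the left, and the positive 2 from u(1) on the right reduces this to the hypothesis.
  from-β : sh N (B β (ℤ.+ 2)) ⊕ sh (suc N) (B β 1ℤ) ≼ B β (ℤ.+ 2) ⊕ sh N (B E 1ℤ) → Key j
  from-β h m = +-cancelʳ-≤ (sh N (u 1ℤ) m) _ _ (begin
    sh 1 (u 1ℤ) m + sh N (k (ℤ.+ 2)) m + sh N (u 1ℤ) m
      ≡⟨ ≡.trans (+-assoc (sh 1 (u 1ℤ) m) _ _) (cong (sh 1 (u 1ℤ) m +_) (sym (sh-⊕ N (k (ℤ.+ 2)) (u 1ℤ) m))) ⟩
    sh 1 (u 1ℤ) m + sh N (k (ℤ.+ 2) ⊕ u 1ℤ) m
      ≤⟨ +-monoʳ-≤ (sh 1 (u 1ℤ) m) (sh-mono N k⊕u m) ⟩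
    sh 1 (u 1ℤ) m + sh N (u (ℤ.+ 2) ⊕ w 1ℤ) m
      ≡⟨ cong (sh 1 (u 1ℤ) m +_) (sh-⊕ N (u (ℤ.+ 2)) (w 1ℤ) m) ⟩
    sh 1 (u 1ℤ) m + (sh N (u (ℤ.+ 2)) m + sh N (w 1ℤ) m)
      ≡⟨ cong (λ z → sh 1 (u 1ℤ) m + (z + sh N (w 1ℤ) m)) (≡.trans (sh-split N 1 (B-out u-split (ℤ.+ 2)) m)
           (cong (sh N (B β (ℤ.+ 2)) m +_) (≡.trans (sh-exp (+-comm N 1) (u 1ℤ) m) (≡.trans (sh-split (suc N) 1 (B-out u-split 1ℤ) m)
             (cong (sh (suc N) (B β 1ℤ) m +_) (sh-exp (+-comm (suc N) 1) (u 0ℤ) m)))))) ⟩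
    sh 1 (u 1ℤ) m + (sh N (B β (ℤ.+ 2)) m + (sh (suc N) (B β 1ℤ) m + sh (2 + N) (u 0ℤ) m) + sh N (w 1ℤ) m)
      ≡⟨ solve 5 (λ a b c d e → a :+ ((b :+ (c :+ d)) :+ e) := (b :+ c) :+ ((a :+ d) :+ e)) refl (sh 1 (u 1ℤ) m) (sh N (B β (ℤ.+ 2)) m) (sh (suc N) (B β 1ℤ) m) (sh (2 + N) (u 0ℤ) m) (sh N (w 1ℤ) m) ⟩
    (sh N (B β (ℤ.+ 2)) m + sh (suc N) (B β 1ℤ) m) + (sh 1 (u 1ℤ) m + sh (2 + N) (u 0ℤ) m + sh N (w 1ℤ) m)
      ≤⟨ +-monoˡ-≤ _ (h m) ⟩
    (B β (ℤ.+ 2) m + sh N (B E 1ℤ) m) + (sh 1 (u 1ℤ) m + sh (2 + N) (u 0ℤ) m + sh N (w 1ℤ) m)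
      ≡⟨ solve 5 (λ a b c d e → (a :+ b) :+ ((c :+ d) :+ e) := ((a :+ c) :+ e) :+ (b :+ d)) refl (B β (ℤ.+ 2) m) (sh N (B E 1ℤ) m) (sh 1 (u 1ℤ) m) (sh (2 + N) (u 0ℤ) m) (sh N (w 1ℤ) m) ⟩
    B β (ℤ.+ 2) m + sh 1 (u 1ℤ) m + sh N (w 1ℤ) m + (sh N (B E 1ℤ) m + sh (2 + N) (u 0ℤ) m)
      ≡⟨ cong₂ (λ a b → a + sh N (w 1ℤ) m + b) (B-out u-split (ℤ.+ 2) m)
           (≡.trans (sh-split N 2 (B-out (trans u-split (swap _ _ refl)) 1ℤ) m) (cong (sh N (B E 1ℤ) m +_) (sh-exp (+-comm N 2) (u 0ℤ) m))) ⟨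
    u (ℤ.+ 2) m + sh N (w 1ℤ) m + sh N (u 1ℤ) m ∎)

key2 : Key 2
key2 = Large.from-β 0 h
  where
  β E L c γ : List Part
  β = (1 , pl) ∷ rng mi 0 3
  E = (0 , pl) ∷ rng mi 0 3
  L = (0 , pl) ∷ rng mi 1 3
  c = (0 , pl) ∷ rng mi 1 2
  γ = (1 , pl) ∷ rng mi 0 2

  c₃ : ∀ d → sh 3 (B c d) ≼ B c d
  c₃ = insert₂ {0} {1} {c} (here refl) (there (there (here refl)))

  c₄ : ∀ d → sh 4 (B c d) ≼ B c d
  c₄ = insert₂ {0} {2} {c} (here refl) (there (here refl))

  -- The neutral blocks have sizes 3 and 4. Their sums miss 5 and contain everything from 6 on,
  -- which is the origin of the 6.
  c-neutral : ∀ d e → sh (6 + e) (B c d) ≼ B c d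
  c-neutral d zero                = sh-twice 3 3 (c₃ d) (c₃ d)
  c-neutral d (suc zero)          = sh-twice 3 4 (c₃ d) (c₄ d)
  c-neutral d (suc (suc zero))    = sh-twice 4 4 (c₄ d) (c₄ d)
  c-neutral d (suc (suc (suc e))) = sh-twice 3 (6 + e) (c₃ d) (c-neutral d e)

  -- Both lists are `c` with one more negative part, of size 4 in `L` and 1 in `E`. Each exchange
  -- frees 3 cells, which accumulate in `e` and are filled neutrally.
  L≼E : ∀ e d → sh (6 + e) (B L d) ≼ B E d
  L≼E e d = fix-≼ {I = ℕ × ℤ} 0 {X = λ (e , d) → sh (6 + e) (B L d)} {A = λ (e , d) → sh (6 + e) (B c d)}
    {Y = λ (e , d) → B E d} {B = λ (e , d) → B c d} (λ (e , d) → 3 + e , ℤ.suc d)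
    (λ (e , d) m → ≤-reflexive (≡.trans (sh-split (6 + e) 4 (B-out {3} {mi} {L} {c} (swap _ _ refl) d) m)
      (cong (sh (6 + e) (B c d) m +_) (≡.trans (sh-exp (+-comm (6 + e) 4) (B L (ℤ.suc d)) m) (sym (sh-sh 1 (9 + e) (B L (ℤ.suc d)) m))))))
    (λ (e , d) m → ≤-reflexive (sym (B-out {0} {mi} {E} {c} (shift (0 , mi) c []) d m)))
    (λ (e , d) → c-neutral d e) (e , d)

  β-rec : ∀ d → B β (ℤ.+ suc d) ≗ B γ (ℤ.+ suc d) ⊕ sh 5 (B β (ℤ.+ suc d))
  β-rec d m = ≡.trans (B-out {2} {mi} {β} {γ} (swap _ _ refl) (ℤ.+ suc d) m) (cong (B γ (ℤ.+ suc d) m +_)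
    (≡.trans (sh-cong 3 (pl-strip 1 3 (suc d)) m) (sh-sh 3 2 _ m)))

  -- Stripping a positive 2 leads to charge 0, where `B-shift⁺` costs nothing and turns `β` into
  -- `L`; a positive 1 then restores the charge.
  β≼E : sh 6 (B β 1ℤ) ≼ B E 1ℤ
  β≼E m = begin
    sh 6 (B β 1ℤ) m             ≡⟨ ≡.trans (sh-cong 6 (pl-strip 1 3 0) m) (sh-sh 6 2 (B β 0ℤ) m) ⟩
    sh 8 (B β 0ℤ) m             ≡⟨ sh-cong 8 (B-shift⁺ (shp (Sh-mi 0 3)) 0) m ⟨
    sh 8 (B L 0ℤ) m             ≡⟨ sh-sh 1 7 (B L 0ℤ) m ⟨
    sh 1 (sh 7 (B L 0ℤ)) m      ≤⟨ sh-mono 1 (L≼E 1 0ℤ) m ⟩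
    sh 1 (B E 0ℤ) m             ≡⟨ pl-strip 0 3 0 m ⟨
    B E 1ℤ m                    ∎
    where open ≤-Reasoning

  h : sh 5 (B β (ℤ.+ 2)) ⊕ sh 6 (B β 1ℤ) ≼ B β (ℤ.+ 2) ⊕ sh 5 (B E 1ℤ)
  h m = begin
    sh 5 (B β (ℤ.+ 2)) m + sh 6 (B β 1ℤ) m
      ≡⟨ cong (sh 5 (B β (ℤ.+ 2)) m +_) (≡.trans (sh-split 6 5 (β-rec 0) m) (cong₂ _+_ (sym (sh-sh 2 4 (B γ 1ℤ) m)) (sym (sh-sh 5 6 (B β 1ℤ) m)))) ⟩
    sh 5 (B β (ℤ.+ 2)) m + (sh 2 (sh 4 (B γ 1ℤ)) m + sh 5 (sh 6 (B β 1ℤ)) m)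
      ≤⟨ +-monoʳ-≤ (sh 5 (B β (ℤ.+ 2)) m) (+-mono-≤ (sh-mono 2 (insert₂ {1} {1} {γ} (here refl) (there (here refl)) 1ℤ) m) (sh-mono 5 β≼E m)) ⟩
    sh 5 (B β (ℤ.+ 2)) m + (sh 2 (B γ 1ℤ) m + sh 5 (B E 1ℤ) m)
      ≡⟨ solve 3 (λ a b c → a :+ (b :+ c) := (b :+ a) :+ c) refl (sh 5 (B β (ℤ.+ 2)) m) (sh 2 (B γ 1ℤ) m) (sh 5 (B E 1ℤ) m) ⟩
    sh 2 (B γ 1ℤ) m + sh 5 (B β (ℤ.+ 2)) m + sh 5 (B E 1ℤ) m
      ≡⟨ cong (_+ sh 5 (B E 1ℤ) m) (≡.trans (β-rec 1 m) (cong (_+ sh 5 (B β (ℤ.+ 2)) m) (pl-strip 1 2 1 m))) ⟨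
    B β (ℤ.+ 2) m + sh 5 (B E 1ℤ) m ∎
    where
    open ≤-Reasoning
    open +-*-Solver using (solve; _:+_; _:=_)

key≥3 : ∀ i → Key (3 + i)
key≥3 i = from-β h
  where
  open Large (suc i)
  K κ γ : List Part
  K = rng pl 3 i ++ rng mi 0 n
  κ = (1 , pl) ∷ K
  γ = (1 , pl) ∷ rng pl 2 (suc i) ++ (3 + i , mi) ∷ (2 + i , mi) ∷ (1 + i , mi) ∷ rng mi 0 i

  H↭ : H ↭ (2 , pl) ∷ K
  H↭ = ++⁺ʳ (rng mi 0 n) (rng-bottom pl 2 i)

  β↭κ : β ↭ (2 , pl) ∷ κ
  β↭κ = trans (prep _ H↭) (swap _ _ refl)

  β↭γ : β ↭ (i , mi) ∷ γ
  β↭γ = trans (++⁺ˡ ((1 , pl) ∷ rng pl 2 (suc i)) (shift (i , mi) ((3 + i , mi) ∷ (2 + i , mi) ∷ (1 + i , mi) ∷ []) (rng mi 0 i)))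
    (shift (i , mi) ((1 , pl) ∷ rng pl 2 (suc i)) _)

  -- Two positive 3s and one negative i + 1 are extracted, with charges 2, 1, 0, 1. Their sizes add
  -- up to i + 7 = N + 1, so the last term is the second summand on the left of `h` and cancels
  -- there.
  split : B β (ℤ.+ 2) ≗ B κ (ℤ.+ 2) ⊕ (sh 3 (B κ 1ℤ) ⊕ (sh 6 (B γ 0ℤ) ⊕ sh (suc N) (B β 1ℤ)))
  split m = ≡.trans (B-out β↭κ (ℤ.+ 2) m) (cong (B κ (ℤ.+ 2) m +_)
    (≡.trans (sh-split 3 3 (B-out β↭κ 1ℤ) m) (cong (sh 3 (B κ 1ℤ) m +_) (sh-split 6 (suc i) (B-out β↭γ 0ℤ) m))))

  mi∈H : ∀ {l} → l < n → (l , mi) ∈ H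
  mi∈H l = ∈-++⁺ʳ (rng pl 2 (suc i)) (∈-rng mi 0 l)

  -- The positive 3 with the negative 1, 2, 3, 4 gives neutral blocks of sizes 4 to 7; further
  -- blocks of size 4 reach every larger size.
  H-neutral : ∀ d e → sh (4 + e) (B H d) ≼ B H d
  H-neutral d = go
    where
    2∈ : (2 , pl) ∈ H
    2∈ = ∈-resp-↭ (↭-sym H↭) (here refl)
    go : ∀ e → sh (4 + e) (B H d) ≼ B H d
    go zero                      = insert₂ {2} {0} 2∈ (mi∈H (s≤s z≤n)) d
    go (suc zero)                = insert₂ {2} {1} 2∈ (mi∈H (s≤s (s≤s z≤n))) d
    go (suc (suc zero))          = insert₂ {2} {2} 2∈ (mi∈H (s≤s (s≤s (s≤s z≤n)))) d
    go (suc (suc (suc zero)))    = insert₂ {2} {3} 2∈ (mi∈H (s≤s (s≤s (s≤s (s≤s z≤n))))) d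
    go (suc (suc (suc (suc e)))) = sh-twice 4 (4 + e) (go zero) (go e)

  -- Each positive 2 of `β` is traded for a positive 1 of `E`, and the freed cells collect in `e`.
  β≼E : ∀ e d → sh (4 + e) (B β d) ≼ B E d
  β≼E e d = fix-≼ {I = ℕ × ℤ} 0 {X = λ (e , d) → sh (4 + e) (B β d)} {A = λ (e , d) → sh (4 + e) (B H d)}
    {Y = λ (e , d) → B E d} {B = λ (e , d) → B H d} (λ (e , d) → suc e , ℤ.pred d)
    (λ (e , d) m → ≤-reflexive (≡.trans (sh-split (4 + e) 2 (B-unfold 1 pl H d) m)
      (cong (sh (4 + e) (B H d) m +_) (≡.trans (sh-exp (+-comm (4 + e) 2) (B β (ℤ.pred d)) m) (sym (sh-sh 1 (5 + e) (B β (ℤ.pred d)) m))))))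
    (λ (e , d) m → ≤-reflexive (sym (B-unfold 0 pl H d m)))
    (λ (e , d) → H-neutral d e) (e , d)

  -- N = 2 + (4 + i) is the size of the neutral pair formed by the positive 2 and the negative 4 +
  -- i.
  neutralN : ∀ {L} → (1 , pl) ∈ L → (3 + i , mi) ∈ L → ∀ a d → sh N (sh a (B L d)) ≼ sh a (B L d)
  neutralN {L} p q a d m = ≤-trans (≤-reflexive (sh-comm N a (B L d) m)) (sh-mono a (insert₂ {1} {3 + i} p q d) m)

  h : sh N (B β (ℤ.+ 2)) ⊕ sh (suc N) (B β 1ℤ) ≼ B β (ℤ.+ 2) ⊕ sh N (B E 1ℤ)
  h m = begin
    sh N (B β (ℤ.+ 2)) m + b
      ≡⟨ cong (_+ b) (≡.trans (sh-cong N split m) (≡.trans (sh-⊕ N (B κ (ℤ.+ 2)) (sh 3 (B κ 1ℤ) ⊕ (sh 6 (B γ 0ℤ) ⊕ sh (suc N) (B β 1ℤ))) m)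
           (cong (sh N (B κ (ℤ.+ 2)) m +_) (≡.trans (sh-⊕ N (sh 3 (B κ 1ℤ)) (sh 6 (B γ 0ℤ) ⊕ sh (suc N) (B β 1ℤ)) m)
             (cong (sh N (sh 3 (B κ 1ℤ)) m +_) (sh-⊕ N (sh 6 (B γ 0ℤ)) (sh (suc N) (B β 1ℤ)) m)))))) ⟩
    sh N (B κ (ℤ.+ 2)) m + (sh N (sh 3 (B κ 1ℤ)) m + (sh N (sh 6 (B γ 0ℤ)) m + sh N (sh (suc N) (B β 1ℤ)) m)) + b
      ≤⟨ +-monoˡ-≤ b (+-mono-≤ (neutralN (here refl) n∈κ 0 (ℤ.+ 2) m) (+-mono-≤ (neutralN (here refl) n∈κ 3 1ℤ m)
           (+-mono-≤ (neutralN (here refl) n∈γ 6 0ℤ m) (sh-mono N (β≼E (3 + i) 1ℤ) m)))) ⟩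
    B κ (ℤ.+ 2) m + (sh 3 (B κ 1ℤ) m + (sh 6 (B γ 0ℤ) m + sh N (B E 1ℤ) m)) + b
      ≡⟨ solve 5 (λ x y z e b → (x :+ (y :+ (z :+ e))) :+ b := (x :+ (y :+ (z :+ b))) :+ e) refl (B κ (ℤ.+ 2) m) (sh 3 (B κ 1ℤ) m) (sh 6 (B γ 0ℤ) m) (sh N (B E 1ℤ) m) b ⟩
    B κ (ℤ.+ 2) m + (sh 3 (B κ 1ℤ) m + (sh 6 (B γ 0ℤ) m + b)) + sh N (B E 1ℤ) m
      ≡⟨ cong (_+ sh N (B E 1ℤ) m) (split m) ⟨
    B β (ℤ.+ 2) m + sh N (B E 1ℤ) m ∎
    where
    open ≤-Reasoning
    open +-*-Solver using (solve; _:+_; _:=_)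
    b = sh (suc N) (B β 1ℤ) m
    n∈κ : (3 + i , mi) ∈ κ
    n∈κ = there (∈-++⁺ʳ (rng pl 3 i) (here refl))
    n∈γ : (3 + i , mi) ∈ γ
    n∈γ = there (∈-++⁺ʳ (rng pl 2 (suc i)) (here refl))

key : ∀ j → Key j
key zero                = key0
key (suc zero)          = key1
key (suc (suc zero))    = key2
key (suc (suc (suc i))) = key≥3 i

module Square where
  open Frame 0
  open +-*-Solver using (solve; _:+_; _:=_; _:*_; con)

  P Q U V : ℕ → Ser
  P j = sh (ex 0 j + suc j) (br j j 1ℤ)
  Q j = sh (ex 0 j + suc j + suc j) (br j (suc j) (ℤ.+ 2))
  U j = sh (ex 0 (suc j)) (br j (suc j) 1ℤ)
  V j = sh (ex 0 (suc j) + suc (suc j)) (br j (suc (suc j)) (ℤ.+ 2))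

  X2-split : ∀ j → X2 j ≗ U j ⊕ V j
  X2-split j n = ≡.trans (cong (λ z → sh (ex 0 (suc j)) (br j (suc (suc z)) 1ℤ) n) (+-identityʳ j))
    (sh-split (ex 0 (suc j)) (suc (suc j)) (br-mi j (suc j) 1ℤ) n)

  Y2-split : ∀ j → Y2 j ≗ P j ⊕ Q j
  Y2-split j n = ≡.trans (cong (λ z → sh (ex 0 j + suc j) (br (suc j) z -1ℤ) n) (+-identityʳ j))
    (≡.trans (sh-cong (ex 0 j + suc j) (br-flip (suc j) j 1ℤ) n) (sh-split (ex 0 j + suc j) (suc j) (br-mi j j 1ℤ) n))

  -- The left side is all of `X2 j`, the right side takes one half each of `Y2 (suc j)` and `Y2 j`.
  -- Dividing by the common power q^(J^2 + 2J) leaves `Key j`.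
  term : ∀ j → U j ⊕ V j ≼ P (suc j) ⊕ Q j
  term j n = begin
    U j n + V j n
      ≡⟨ cong₂ _+_ (≡.trans (sh-exp (e₁ j) u₁ n) (sym (sh-sh e 1 u₁ n))) (≡.trans (sh-exp (e₂ j) k n) (sym (sh-sh e (3 + j) k n))) ⟩
    sh e (sh 1 u₁) n + sh e (sh (3 + j) k) n
      ≡⟨ sh-⊕ e (sh 1 u₁) (sh (3 + j) k) n ⟨
    sh e (sh 1 u₁ ⊕ sh (3 + j) k) n
      ≤⟨ sh-mono e (key j) n ⟩
    sh e (u₂ ⊕ sh (3 + j) w) n
      ≡⟨ sh-⊕ e u₂ (sh (3 + j) w) n ⟩
    Q j n + sh e (sh (3 + j) w) n
      ≡⟨ +-comm (Q j n) _ ⟩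
    sh e (sh (3 + j) w) n + Q j n
      ≡⟨ cong (_+ Q j n) (≡.trans (sh-sh e (3 + j) w n) (sh-exp (sym (e₂ j)) w n)) ⟩
    P (suc j) n + Q j n ∎
    where
    open ≤-Reasoning
    e = ex 0 j + suc j + suc j
    u₁ = br j (suc j) 1ℤ
    u₂ = br j (suc j) (ℤ.+ 2)
    k = br j (suc (suc j)) (ℤ.+ 2)
    w = br (suc j) (suc j) 1ℤ
    e₁ : ∀ j → ex 0 (suc j) ≡ ex 0 j + suc j + suc j + 1
    e₁ = solve 1 (λ j → (con 2 :+ j) :* ((con 2 :+ j) :+ con 0) :=
      (((con 1 :+ j) :* ((con 1 :+ j) :+ con 0) :+ (con 1 :+ j)) :+ (con 1 :+ j)) :+ con 1) refl
    e₂ : ∀ j → ex 0 (suc j) + suc (suc j) ≡ ex 0 j + suc j + suc j + (3 + j)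
    e₂ = solve 1 (λ j → (con 2 :+ j) :* ((con 2 :+ j) :+ con 0) :+ (con 2 :+ j) :=
      (((con 1 :+ j) :* ((con 1 :+ j) :+ con 0) :+ (con 1 :+ j)) :+ (con 1 :+ j)) :+ (con 3 :+ j)) refl

  X≼Y : ∑ X2 ≼ Qm ⊕ ∑ Y2
  X≼Y n = begin
    ∑ X2 n                             ≡⟨ ∑-cong X2-split n ⟩
    ∑ (λ j → U j ⊕ V j) n              ≤⟨ ∑-mono term n ⟩
    ∑ (λ j → P (suc j) ⊕ Q j) n        ≡⟨ ∑-⊕ (P ∘ suc) Q n ⟩
    ∑ (P ∘ suc) n + ∑ Q n              ≤⟨ +-monoˡ-≤ (∑ Q n) (m≤n+m _ (P 0 n)) ⟩
    P 0 n + ∑ (P ∘ suc) n + ∑ Q n      ≡⟨ cong (_+ ∑ Q n) (∑-head P (van⁺ (λ j → br j j 1ℤ)) n) ⟨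
    ∑ P n + ∑ Q n                      ≡⟨ ∑-⊕ P Q n ⟨
    ∑ (λ j → P j ⊕ Q j) n              ≡⟨ ∑-cong Y2-split n ⟨
    ∑ Y2 n                             ≤⟨ m≤n+m _ (Qm n) ⟩
    Qm n + ∑ Y2 n                      ∎
    where open ≤-Reasoning

R≼C : ∀ M → Frame.Rser M ≼ Frame.Cser M
R≼C M n = +-cancelʳ-≤ (∑ X2 n) _ _ (begin
  Rser n + ∑ X2 n              ≤⟨ +-monoʳ-≤ (Rser n) (X≼Y M n) ⟩
  Rser n + (Qm n + ∑ Y2 n)     ≡⟨ crank-rank n ⟨
  Cser n + ∑ X2 n              ∎)
  where
  open Frame M
  open ≤-Reasoning
  X≼Y : ∀ M → ∑ (Frame.X2 M) ≼ Frame.Qm M ⊕ ∑ (Frame.Y2 M)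
  X≼Y zero    = Square.X≼Y
  X≼Y (suc μ) = Positive.X≼Y μ

-- The generating function of the rank

module Rank (ψ : ℤ → ℕ) where

  -- The partitions of largest part c + 1, weighted by ψ (rank).
  top : ℕ → Ser
  top c = sh (suc c) (F (rng mi 0 (suc c)) (λ d → ψ (ℤ.+ c ℤ.+ d)))

  -- The Durfee rectangles J × (J + c), J = j + 1: below the rectangle lie parts ≤ J + c, to its right parts of the conjugate ≤ J.
  rectangle : ℕ → ℕ → Ser
  rectangle c j = sh (ex c j) (F ⟨ suc j , suc j + c ⟩ (λ d → ψ (ℤ.+ c ℤ.+ d)))

  -- A rectangle J × (J + c) with a full column to its right widens by that column, which gives `b`.
  -- Without one it is, for J ≥ 2, a rectangle (J - 1) × (J + c) with a full row below it, and for J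
  -- = 1 a partition of largest part c + 1.
  rectangle-step : ∀ c → ∑ (rectangle c) ≗ top c ⊕ ∑ (rectangle (suc c))
  rectangle-step c n = begin
    ∑ (rectangle c) n
      ≡⟨ ∑-cong (λ j → sh-split (ex c j) (suc j) (F-unfold j pl ⟨ j , suc j + c ⟩ (χ c))) n ⟩
    ∑ (λ j → a j ⊕ b j) n
      ≡⟨ ∑-⊕ a b n ⟩
    ∑ a n + ∑ b n
      ≡⟨ cong (_+ ∑ b n) (∑-head a (ex-van c (ex c) (λ j → F ⟨ j , suc j + c ⟩ (χ c)) (λ _ → ≤-refl)) n) ⟩
    a 0 n + ∑ (a ∘ suc) n + ∑ b n
      ≡⟨ ≡.trans (+-assoc (a 0 n) _ _) (cong₂ _+_ (sh-exp (*-identityˡ (suc c)) (F (rng mi 0 (suc c)) (χ c)) n) (+-comm (∑ (a ∘ suc) n) _)) ⟩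
    top c n + (∑ b n + ∑ (a ∘ suc) n)
      ≡⟨ cong (top c n +_) (≡.trans (∑-cong next n) (∑-⊕ b (a ∘ suc) n)) ⟨
    top c n + ∑ (rectangle (suc c)) n ∎
    where
    open ≡.≡-Reasoning
    χ : ℕ → ℤ → ℕ
    χ c d = ψ (ℤ.+ c ℤ.+ d)
    a b : ℕ → Ser
    a j = sh (ex c j) (F ⟨ j , suc j + c ⟩ (χ c))
    b j = sh (ex c j + suc j) (F ⟨ suc j , suc j + c ⟩ (χ c ∘ ℤ.suc))
    next : ∀ j → rectangle (suc c) j ≗ b j ⊕ a (suc j)
    next j n = begin
      sh (ex (suc c) j) (F ⟨ suc j , suc j + suc c ⟩ (χ (suc c))) n
        ≡⟨ cong (λ z → sh (ex (suc c) j) (F ⟨ suc j , z ⟩ (χ (suc c))) n) (+-suc (suc j) c) ⟩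
      sh (ex (suc c) j) (F ⟨ suc j , suc (suc j + c) ⟩ (χ (suc c))) n
        ≡⟨ sh-split (ex (suc c) j) (suc (suc j + c)) (F-out (top-mi (suc j) (suc j + c)) (χ (suc c))) n ⟩
      sh (ex (suc c) j) (F ⟨ suc j , suc j + c ⟩ (χ (suc c))) n + sh (ex (suc c) j + suc (suc j + c)) (F ⟨ suc j , suc (suc j + c) ⟩ (χ (suc c) ∘ ℤ.pred)) n
        ≡⟨ cong₂ _+_ (≡.trans (sh-exp (ex-up c j) _ n) (sh-cong (ex c j + suc j) (F-cong ⟨ suc j , suc j + c ⟩ (λ d → cong ψ (≡.trans (ℤₚ.+-assoc 1ℤ (ℤ.+ c) d) (sym (+-sucℤ (ℤ.+ c) d))))) n))
             (≡.trans (sh-exp (ex-diagonal c j) _ n) (sh-cong (ex c (suc j)) (F-cong ⟨ suc j , suc (suc j + c) ⟩ (λ d → cong ψ (sucpred c d))) n)) ⟩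
      b j n + a (suc j) n ∎

  rectangle-small : ∀ c {n} → n ≤ c → ∑ (rectangle c) n ≡ 0
  rectangle-small c {n} n≤c = sumTo-zero n (λ j → sh-vanish (ex c j) _ (≤-trans (s≤s (≤-trans n≤c (m≤n+m c j))) (m≤m+n (suc j + c) _)))

  rectangle-top : ∑ (rectangle 0) ≗ ∑ top
  rectangle-top n = ≡.trans (go n 0 (+-identityʳ n)) (sumTo-cong n (λ l → cong (λ z → top z n) (+-identityʳ l)))
    where
    go : ∀ k c → k + c ≡ n → ∑ (rectangle c) n ≡ sumTo k (λ l → top (l + c) n)
    go zero    c refl = ≡.trans (rectangle-small c ≤-refl) (sym (sh-vanish (suc c) _ ≤-refl))
    go (suc k) c e = ≡.trans (rectangle-step c n) (cong (top c n +_)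
      (≡.trans (go k (suc c) (≡.trans (+-suc k c) e)) (sumTo-cong k (λ l → cong (λ z → top z n) (+-suc l c)))))

-- For c = 0 the rectangles are Durfee squares, and exchanging what lies right of and below the
-- square is conjugation.
rank-flip : ∀ ψ → ∑ (Rank.top (ψ ∘ ℤ.-_)) ≗ ∑ (Rank.top ψ)
rank-flip ψ n = ≡.trans (sym (Rank.rectangle-top (ψ ∘ ℤ.-_) n)) (≡.trans (∑-cong (λ j → sh-cong (ex 0 j) (term j)) n) (Rank.rectangle-top ψ n))
  where
  term : ∀ j → F ⟨ suc j , suc j + 0 ⟩ (λ d → ψ (ℤ.- (0ℤ ℤ.+ d))) ≗ F ⟨ suc j , suc j + 0 ⟩ (λ d → ψ (0ℤ ℤ.+ d))
  term j rewrite +-identityʳ j = λ m → begin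
    F L (λ d → ψ (ℤ.- (0ℤ ℤ.+ d))) m ≡⟨ F-cong L (λ d → cong (ψ ∘ ℤ.-_) (ℤₚ.+-identityˡ d)) m ⟩
    F L (λ d → ψ (ℤ.- d)) m          ≡⟨ ⟨⟩-flip (suc j) (suc j) ψ m ⟩
    F L ψ m                          ≡⟨ F-cong L (λ d → cong ψ (ℤₚ.+-identityˡ d)) m ⟨
    F L (λ d → ψ (0ℤ ℤ.+ d)) m       ∎
    where
    open ≡.≡-Reasoning
    L = ⟨ suc j , suc j ⟩

ge-+ : ∀ c e d → ge (c + e) (ℤ.+ c ℤ.+ d) ≡ ge e d
ge-+ zero    e d = cong (ge e) (ℤₚ.+-identityˡ d)
ge-+ (suc c) e d = ≡.trans (cong (ge (c + e)) (≡.trans (cong ℤ.pred (ℤₚ.suc-+ c d)) (ℤₚ.pred-suc (ℤ.+ c ℤ.+ d)))) (ge-+ c e d)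

-- Passing from c = 0 to c drops the partitions with largest part at most c. Their rank is below c,
-- so `ge (c + e)` gives them weight 0.
rank-ge : ∀ c e → ∑ (Rank.top (ge (c + e))) ≗ ∑ (λ j → sh (ex c j) (F ⟨ suc j , suc j + c ⟩ (ge e)))
rank-ge c e n = ≡.trans (sym (rectangle-top n)) (≡.trans (sym (go c ≤-refl))
  (∑-cong (λ j → sh-cong (ex c j) (F-cong ⟨ suc j , suc j + c ⟩ (ge-+ c e))) n))
  where
  open Rank (ge (c + e))
  go : ∀ k → k ≤ c → ∑ (rectangle k) n ≡ ∑ (rectangle 0) n
  go zero    _   = refl
  go (suc k) k<c = ≡.trans (sym (≡.trans (rectangle-step k n) (cong (_+ ∑ (rectangle (suc k)) n)
    (≡.trans (sh-cong (suc k) (mi-support 0 (suc k) _ (λ d d≤0 → ge-small (c + e) (≤-trans k<c (m≤m+n c e)) _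
      (ℤₚ.≤-trans (ℤₚ.+-monoʳ-≤ (ℤ.+ k) d≤0) (ℤₚ.≤-reflexive (ℤₚ.+-identityʳ (ℤ.+ k)))))) n) (sh-0 (suc k) n))))) (go k (<⇒≤ k<c))

-- The generating function of the crank

one : ℤ → ℕ
one _ = 1

forget : Part → Part
forget (i , _) = i , ze

F-forget : ∀ L → F L one ≗ F (map forget L) one
F-forget []            n = refl
F-forget ((i , s) ∷ L) n = fix-≗ {I = ℕ} i {X = λ _ → F ((i , s) ∷ L) one} {A = λ _ → F L one}
  {Y = λ _ → F (map forget ((i , s) ∷ L)) one} {B = λ _ → F (map forget L) one} id
  (λ _ → F-unfold i s L one) (λ _ → F-unfold i ze (map forget L) one) (λ _ → F-forget L) 0 n

forget-rng : ∀ s a k → map forget (rng s a k) ≡ rng ze a k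
forget-rng s a zero    = refl
forget-rng s a (suc k) = cong ((a + k , ze) ∷_) (forget-rng s a k)

F-forget₂ : ∀ s a k t b l → F (rng s a k ++ rng t b l) one ≗ F (rng ze a k ++ rng ze b l) one
F-forget₂ s a k t b l n = ≡.trans (F-forget (rng s a k ++ rng t b l) n)
  (cong (λ L → F L one n) (≡.trans (map-++ forget (rng s a k) (rng t b l)) (cong₂ _++_ (forget-rng s a k) (forget-rng t b l))))

module Crank (M : ℕ) where
  -- `fill` and `q^suc` make up `Cser (suc M)` and are contained in `Cser M`. The surplus `tail j`
  -- is identified by `tail-cell` as the cell of crank M + 1 with j ones.
  full fill tail : ℕ → Ser
  full j = sh (ex M j) (F ⟨ j , suc j + M ⟩ one)
  fill j = sh (ex M (suc j)) (F ⟨ j , suc (suc j + M) ⟩ one)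
  tail j = sh (ex M j + j) (F (rng pl 0 j ++ rng mi 1 (j + M)) one)

  q^j q^suc : ℕ → Ser
  q^j j = sh (ex M j + j) (F ⟨ j , suc j + M ⟩ one)
  q^suc j = sh (ex M j + suc j) (F ⟨ j , suc j + M ⟩ one)

  open ≡.≡-Reasoning
  open +-*-Solver using (solve; _:+_; _:=_)

  van-full : ∀ (a : ℕ → ℕ) → (∀ j → ex M j ≤ a j) → Van (λ j → sh (a j) (F ⟨ j , suc j + M ⟩ one))
  van-full a = ex-van M a (λ j → F ⟨ j , suc j + M ⟩ one)

  upper : ∑ full ≗ ∑ fill ⊕ ∑ q^j
  upper n = begin
    ∑ full n
      ≡⟨ ∑-head full (van-full (ex M) (λ _ → ≤-refl)) n ⟩
    full 0 n + ∑ (full ∘ suc) n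
      ≡⟨ cong (full 0 n +_) (≡.trans (∑-cong (λ j → sh-split (ex M (suc j)) (suc j) (F-unfold j pl ⟨ j , suc (suc j + M) ⟩ one)) n) (∑-⊕ fill (q^j ∘ suc) n)) ⟩
    full 0 n + (∑ fill n + ∑ (q^j ∘ suc) n)
      ≡⟨ solve 3 (λ a b c → a :+ (b :+ c) := b :+ (a :+ c)) refl (full 0 n) (∑ fill n) (∑ (q^j ∘ suc) n) ⟩
    ∑ fill n + (full 0 n + ∑ (q^j ∘ suc) n)
      ≡⟨ cong (λ z → ∑ fill n + (z + ∑ (q^j ∘ suc) n)) (sh-exp (sym (+-identityʳ (ex M 0))) (F ⟨ 0 , suc M ⟩ one) n) ⟩
    ∑ fill n + (q^j 0 n + ∑ (q^j ∘ suc) n)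
      ≡⟨ cong (∑ fill n +_) (∑-head q^j (van-full (λ j → ex M j + j) (λ j → m≤m+n (ex M j) j)) n) ⟨
    ∑ fill n + ∑ q^j n ∎

  q-step : ∑ q^j ≗ ∑ tail ⊕ ∑ q^suc
  q-step n = ≡.trans (∑-cong term n) (∑-⊕ tail q^suc n)
    where
    term : ∀ j → q^j j ≗ tail j ⊕ q^suc j
    term j m = ≡.trans (sh-split (ex M j + j) 1 (F-out (trans (++⁺ˡ (rng pl 0 j) (rng-bottom mi 0 (j + M))) (shift _ (rng pl 0 j) _)) one) m)
      (cong (tail j m +_) (sh-exp (≡.trans (+-comm (ex M j + j) 1) (sym (+-suc (ex M j) j))) _ m))

  lower-step : ∑ (λ j → sh (ex (suc M) j) (F ⟨ j , suc j + suc M ⟩ one)) ≗ ∑ fill ⊕ ∑ q^suc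
  lower-step n = ≡.trans (∑-cong term n) (≡.trans (∑-⊕ q^suc fill n) (+-comm (∑ q^suc n) (∑ fill n)))
    where
    term : ∀ j → sh (ex (suc M) j) (F ⟨ j , suc j + suc M ⟩ one) ≗ q^suc j ⊕ fill j
    term j m = ≡.trans (cong (λ z → sh (ex (suc M) j) (F ⟨ j , z ⟩ one) m) (+-suc (suc j) M))
      (≡.trans (sh-split (ex (suc M) j) (suc (suc j + M)) (F-out (top-mi j (suc j + M)) one) m)
        (cong₂ _+_ (sh-exp (ex-up M j) (F ⟨ j , suc j + M ⟩ one) m) (sh-exp (ex-diagonal M j) (F ⟨ j , suc (suc j + M) ⟩ one) m)))

  C-step : Frame.Cser M ≗ ∑ tail ⊕ Frame.Cser (suc M)
  C-step n = begin
    ∑ full n                                ≡⟨ upper n ⟩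
    ∑ fill n + ∑ q^j n                      ≡⟨ cong (∑ fill n +_) (q-step n) ⟩
    ∑ fill n + (∑ tail n + ∑ q^suc n)       ≡⟨ solve 3 (λ a b c → a :+ (b :+ c) := b :+ (a :+ c)) refl (∑ fill n) (∑ tail n) (∑ q^suc n) ⟩
    ∑ tail n + (∑ fill n + ∑ q^suc n)       ≡⟨ cong (∑ tail n +_) (lower-step n) ⟨
    ∑ tail n + Frame.Cser (suc M) n         ∎

C-sum : ∀ M n → Frame.Cser M n ≡ sumTo n (λ k → ∑ (Crank.tail (M + k)) n)
C-sum M n = ≡.trans (go n M (m≤m+n n M)) (sumTo-cong n (λ k → cong (λ z → ∑ (Crank.tail z) n) (+-comm k M)))
  where
  small : ∀ M → n ≤ M → ∀ j → sh (ex M j) (F ⟨ j , suc j + M ⟩ one) n ≡ 0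
  small M n≤M j = sh-vanish (ex M j) _ (≤-trans (s≤s (≤-trans n≤M (m≤n+m M j))) (m≤m+n (suc j + M) _))
  go : ∀ k c → n ≤ k + c → Frame.Cser c n ≡ sumTo k (λ l → ∑ (Crank.tail (l + c)) n)
  go zero    c le = ≡.trans (Crank.C-step c n) (≡.trans (cong (∑ (Crank.tail c) n +_) (sumTo-zero n (small (suc c) (≤-trans le (n≤1+n c))))) (+-identityʳ _))
  go (suc k) c le = ≡.trans (Crank.C-step c n) (cong (∑ (Crank.tail c) n +_)
    (≡.trans (go k (suc c) (≤-trans le (≤-reflexive (sym (+-suc k c))))) (sumTo-cong k (λ l → cong (λ z → ∑ (Crank.tail z) n) (+-suc l c)))))

-- cell ω j counts the partitions with ω ones and crank j - ω; the sizes are {1,…,ω} ∪ {2,…,j}, in a form symmetric in ω and j.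

shared : ℕ → ℕ → List Part
shared (suc _) (suc _) = (0 , ze) ∷ []
shared _       _       = []

sizes : ℕ → ℕ → List Part
sizes ω j = shared ω j ++ rng ze 1 (ω ∸ 1) ++ rng ze 1 (j ∸ 1)

cell : ℕ → ℕ → Ser
cell ω j = sh (ω + j * suc ω) (F (sizes ω j) one)

shared-sym : ∀ ω j → shared ω j ≡ shared j ω
shared-sym zero    zero    = refl
shared-sym zero    (suc j) = refl
shared-sym (suc ω) zero    = refl
shared-sym (suc ω) (suc j) = refl

cell-sym : ∀ ω j → cell ω j ≗ cell j ω
cell-sym ω j n = ≡.trans (sh-exp (expo ω j) _ n) (sh-cong (j + ω * suc j) (F-↭ (trans
  (↭-reflexive (cong (_++ rng ze 1 (ω ∸ 1) ++ rng ze 1 (j ∸ 1)) (shared-sym ω j)))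
  (++⁺ˡ (shared j ω) (++-comm (rng ze 1 (ω ∸ 1)) (rng ze 1 (j ∸ 1))))) one) n)
  where
  open +-*-Solver
  expo : ∀ ω j → ω + j * suc ω ≡ j + ω * suc j
  expo = solve 2 (λ ω j → ω :+ j :* (con 1 :+ ω) := j :+ ω :* (con 1 :+ j)) refl

cell-small : ∀ ω j {n} → n < j → cell ω j n ≡ 0
cell-small ω j l = sh-vanish (ω + j * suc ω) _ (≤-trans l (≤-trans (≤-trans (m≤m+n j (j * ω)) (≤-reflexive (sym (*-suc j ω)))) (m≤n+m _ ω)))

tail-cell : ∀ M ω → Crank.tail M ω ≗ cell ω (ω + suc M)
tail-cell M ω n = ≡.trans (sh-exp (expo ω M) _ n) (sh-cong (ω + (ω + suc M) * suc ω) (body ω) n)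
  where
  open +-*-Solver
  expo : ∀ ω M → ex M ω + ω ≡ ω + (ω + suc M) * suc ω
  expo = solve 2 (λ ω M → (con 1 :+ ω) :* ((con 1 :+ ω) :+ M) :+ ω := ω :+ (ω :+ (con 1 :+ M)) :* (con 1 :+ ω)) refl
  body : ∀ ω → F (rng pl 0 ω ++ rng mi 1 (ω + M)) one ≗ F (sizes ω (ω + suc M)) one
  body zero    m = F-forget₂ pl 0 0 mi 1 M m
  body (suc ω) m = ≡.trans (F-forget₂ pl 0 (suc ω) mi 1 (suc ω + M) m) (F-↭ (trans (++⁺ʳ (rng ze 1 (suc ω + M)) (rng-bottom ze 0 ω))
    (↭-reflexive (cong (λ z → (0 , ze) ∷ rng ze 1 ω ++ rng ze 1 z) (sym (+-suc ω M))))) one m)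

crankSum : (ℤ → ℕ) → Ser
crankSum ψ n = sumTo n (λ ω → sumTo n (λ j → ψ (j ℤ.⊖ ω) * cell ω j n))

crank-flip : ∀ ψ → crankSum (ψ ∘ ℤ.-_) ≗ crankSum ψ
crank-flip ψ n = ≡.trans (sumTo-cong n (λ ω → sumTo-cong n (λ j → cong₂ _*_ (cong ψ (sym (ℤₚ.⊖-swap ω j))) (cell-sym ω j n))))
  (sumTo-swap n n (λ ω j → ψ (ω ℤ.⊖ j) * cell j ω n))

ge-neg : ∀ p k → ge p -[1+ k ] ≡ 0
ge-neg zero    k = refl
ge-neg (suc p) k = ge-neg p (suc k)

-- The substitution j = p + k. The indices beyond n that it brings in contribute nothing.
sumTo-ge : ∀ p n (x : ℕ → ℕ) → (∀ j → n < j → x j ≡ 0) → sumTo n (λ j → ge p (ℤ.+ j) * x j) ≡ sumTo n (λ k → x (p + k))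
sumTo-ge zero    n       x h = sumTo-cong n (λ j → +-identityʳ (x j))
sumTo-ge (suc p) zero    x h = ≡.trans (cong (_* x 0) (ge-neg p 0)) (sym (h _ (s≤s z≤n)))
sumTo-ge (suc p) (suc n) x h = begin
  ge p -1ℤ * x 0 + sumTo n (λ j → ge p (ℤ.+ j) * x (suc j))   ≡⟨ cong₂ _+_ (cong (_* x 0) (ge-neg p 0)) (sumTo-ge p n (x ∘ suc) (λ j l → h (suc j) (s≤s l))) ⟩
  sumTo n (λ k → x (suc p + k))                                 ≡⟨ +-identityʳ _ ⟨
  sumTo n (λ k → x (suc p + k)) + 0                             ≡⟨ cong (sumTo n (λ k → x (suc p + k)) +_) (h (suc p + suc n) (s≤s (m≤n+m (suc n) p))) ⟨
  sumTo n (λ k → x (suc p + k)) + x (suc p + suc n)             ≡⟨ sumTo-last n (λ k → x (suc p + k)) ⟨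
  sumTo (suc n) (λ k → x (suc p + k))                           ∎
  where open ≡.≡-Reasoning

crank-ge : ∀ M → crankSum (ge (suc M)) ≗ Frame.Cser M
crank-ge M n = begin
  sumTo n (λ ω → sumTo n (λ j → ge (suc M) (j ℤ.⊖ ω) * cell ω j n))
    ≡⟨ sumTo-cong n (λ ω → sumTo-cong n (λ j → cong (_* cell ω j n) (threshold ω j))) ⟩
  sumTo n (λ ω → sumTo n (λ j → ge (ω + suc M) (ℤ.+ j) * cell ω j n))
    ≡⟨ sumTo-cong n (λ ω → sumTo-ge (ω + suc M) n (λ j → cell ω j n) (λ j → cell-small ω j)) ⟩
  sumTo n (λ ω → sumTo n (λ k → cell ω (ω + suc M + k) n))
    ≡⟨ sumTo-swap n n (λ ω k → cell ω (ω + suc M + k) n) ⟩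
  sumTo n (λ k → sumTo n (λ ω → cell ω (ω + suc M + k) n))
    ≡⟨ sumTo-cong n (λ k → sumTo-cong n (λ ω → ≡.trans (cong (λ z → cell ω z n) (+-assoc ω (suc M) k)) (sym (tail-cell (M + k) ω n)))) ⟩
  sumTo n (λ k → ∑ (Crank.tail (M + k)) n)
    ≡⟨ C-sum M n ⟨
  Frame.Cser M n ∎
  where
  open ≡.≡-Reasoning
  threshold : ∀ ω j → ge (suc M) (j ℤ.⊖ ω) ≡ ge (ω + suc M) (ℤ.+ j)
  threshold ω j = ≡.trans (sym (ge-+ ω (suc M) (j ℤ.⊖ ω))) (cong (ge (ω + suc M))
    (≡.trans (cong (λ z → ℤ.+ ω ℤ.+ z) (sym (ℤₚ.m-n≡m⊖n j ω))) (≡.trans (ℤₚ.+-comm (ℤ.+ ω) (ℤ.+ j ℤ.- ℤ.+ ω))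
      (≡.trans (ℤₚ.+-assoc (ℤ.+ j) (ℤ.- (ℤ.+ ω)) (ℤ.+ ω)) (≡.trans (cong (λ z → ℤ.+ j ℤ.+ z) (ℤₚ.+-inverseˡ (ℤ.+ ω))) (ℤₚ.+-identityʳ (ℤ.+ j)))))))

-- Partitions with a given number of large parts

-- Multisets of j parts of size > a: subtract a + 1 from each part and conjugate.

module Elementary (a : ℕ) (L₀ : List Part) (L₀-ze : Sh L₀ L₀) where

  private
    e : ℕ → ℕ → Ser
    e k j = B (rng pl a k ++ L₀) (ℤ.+ j)
    T : ℕ → Ser
    T j = sh (j * suc a) (F (rng ze 0 j ++ L₀) one)

  -- `Sh L L` forces all parts to be neutral, since a charged part would change its size.
  ze-B : ∀ {L} → Sh L L → ∀ d → B L d ≗ F L (λ _ → δ d 0ℤ)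
  ze-B [] d zero    = refl
  ze-B [] d (suc n) = refl
  ze-B (shz {i} {L} r) d n = fix-≗ {I = ℕ} i {X = λ _ → B ((i , ze) ∷ L) d} {A = λ _ → B L d}
    {Y = λ _ → F ((i , ze) ∷ L) (λ _ → δ d 0ℤ)} {B = λ _ → F L (λ _ → δ d 0ℤ)} id
    (λ _ → F-unfold i ze L (δ d)) (λ _ → F-unfold i ze L (λ _ → δ d 0ℤ)) (λ _ → ze-B r d) 0 n

  F-const0 : ∀ L → F L (λ _ → 0) ≗ λ _ → 0
  F-const0 L n = F-support L n (λ _ _ → refl)

  pl-neg : ∀ k d → B (rng pl a k ++ L₀) -[1+ d ] ≗ λ _ → 0
  pl-neg zero    d n = ≡.trans (ze-B L₀-ze -[1+ d ] n) (F-const0 L₀ n)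
  pl-neg (suc k) d = fix-≗ (a + k) {A = λ d → B (rng pl a k ++ L₀) -[1+ d ]} {B = λ _ _ → 0} suc
    (λ d → B-unfold (a + k) pl (rng pl a k ++ L₀) -[1+ d ]) (λ _ n → sym (sh-0 (suc (a + k)) n)) (pl-neg k) d

  base : ∀ k → e k 0 ≗ F L₀ one
  base zero    n = ze-B L₀-ze 0ℤ n
  base (suc k) n = ≡.trans (B-unfold (a + k) pl (rng pl a k ++ L₀) 0ℤ n)
    (≡.trans (cong₂ _+_ (base k n) (≡.trans (sh-cong (suc (a + k)) (pl-neg (suc k) 0) n) (sh-0 (suc (a + k)) n))) (+-identityʳ _))

  -- Split by the smallest size a + 1. Without it, `B-shift⁺` lowers every charged part by 1 and
  -- contributes q^j; with it, one part fewer remains. `T` obeys the same recursion by its largest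
  -- part. For n ≤ a + k the cut-off at size a + k has no effect.
  elementary : ∀ k j {n} → n ≤ a + k → e k j n ≡ T j n
  elementary k       zero    {n} l = base k n
  elementary zero    (suc j) {n} l = ≡.trans (≡.trans (ze-B L₀-ze (ℤ.+ suc j) n) (F-const0 L₀ n))
    (sym (sh-vanish (suc j * suc a) _ (≤-trans (s≤s (subst (n ≤_) (+-identityʳ a) l)) (m≤m+n (suc a) (j * suc a)))))
  elementary (suc k) (suc j) {n} l = begin
    e (suc k) (suc j) n
      ≡⟨ B-out (++⁺ʳ L₀ (rng-bottom pl a k)) (ℤ.+ suc j) n ⟩
    B (rng pl (suc a) k ++ L₀) (ℤ.+ suc j) n + sh (suc a) (e (suc k) j) n
      ≡⟨ cong (_+ sh (suc a) (e (suc k) j) n) (B-shift⁺ (Sh-++ (Sh-pl a k) L₀-ze) (suc j) n) ⟨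
    sh (suc j) (e k (suc j)) n + sh (suc a) (e (suc k) j) n
      ≡⟨ cong₂ _+_ (sh-local _≡_ refl j (λ m m<n → elementary k (suc j) (≤-pred (≤-trans m<n (≤-trans l (≤-reflexive (+-suc a k)))))))
           (sh-local _≡_ refl a (λ m m<n → elementary (suc k) j (≤-trans (<⇒≤ m<n) l))) ⟩
    sh (suc j) (T (suc j)) n + sh (suc a) (T j) n
      ≡⟨ cong₂ _+_ (sh-comm (suc j) (suc j * suc a) _ n) (sh-sh (suc a) (j * suc a) _ n) ⟩
    sh (suc j * suc a) (sh (suc j) (F (rng ze 0 (suc j) ++ L₀) one)) n + sh (suc j * suc a) (F (rng ze 0 j ++ L₀) one) n
      ≡⟨ +-comm (sh (suc j * suc a) (sh (suc j) (F (rng ze 0 (suc j) ++ L₀) one)) n) _ ⟩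
    sh (suc j * suc a) (F (rng ze 0 j ++ L₀) one) n + sh (suc j * suc a) (sh (suc j) (F (rng ze 0 (suc j) ++ L₀) one)) n
      ≡⟨ sh-⊕ (suc j * suc a) (F (rng ze 0 j ++ L₀) one) (sh (suc j) (F (rng ze 0 (suc j) ++ L₀) one)) n ⟨
    sh (suc j * suc a) (F (rng ze 0 j ++ L₀) one ⊕ sh (suc j) (F (rng ze 0 (suc j) ++ L₀) one)) n
      ≡⟨ sh-cong (suc j * suc a) (F-unfold j ze (rng ze 0 j ++ L₀) one) n ⟨
    T (suc j) n ∎
    where open ≡.≡-Reasoning

-- Enumeration of partitions as lists

shL : {X : Set} → ℕ → (ℕ → List X) → ℕ → List X
shL zero    f n       = f n
shL (suc k) f zero    = []
shL (suc k) f (suc n) = shL k f n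

shL-local : ∀ {X : Set} k {f g : ℕ → List X} {n} → (∀ m → m < n → f m ≡ g m) → shL (suc k) f n ≡ shL (suc k) g n
shL-local k       {n = zero}  h = refl
shL-local zero    {n = suc n} h = h n ≤-refl
shL-local (suc k) {n = suc n} h = shL-local k (λ m l → h m (m<n⇒m<1+n l))

sum-shL : ∀ {X : Set} k (f : X → ℕ) g n → sum (map f (shL k g n)) ≡ sh k (λ m → sum (map f (g m))) n
sum-shL zero    f g n       = refl
sum-shL (suc k) f g zero    = refl
sum-shL (suc k) f g (suc n) = sum-shL k f g n

∈-shL⁻ : ∀ {X : Set} k {g n} {x : X} → x ∈ shL k g n → ∃[ m ] (k + m ≡ n × x ∈ g m)
∈-shL⁻ zero    {n = n}     x∈ = n , refl , x∈
∈-shL⁻ (suc k) {n = suc n} x∈ with m , e , y ← ∈-shL⁻ k x∈ = m , cong suc e , y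

∈-shL⁺ : ∀ {X : Set} k {g m} {x : X} → x ∈ g m → x ∈ shL k g (k + m)
∈-shL⁺ zero    x∈ = x∈
∈-shL⁺ (suc k) x∈ = ∈-shL⁺ k x∈

shL-unique : ∀ {X : Set} k {g : ℕ → List X} {n} → (∀ m → k + m ≡ n → Unique (g m)) → Unique (shL k g n)
shL-unique zero    {n = n}     h = h n refl
shL-unique (suc k) {n = zero}  h = []
shL-unique (suc k) {n = suc n} h = shL-unique k (λ m e → h m (cong suc e))

-- Weakly decreasing lists of positive integers ≤ A with sum n; the second argument is fuel.

enum′ : ℕ → ℕ → ℕ → List (List ℕ)
enum′ zero    k       zero    = [] ∷ []
enum′ zero    k       (suc n) = []
enum′ (suc A) zero    n       = enum′ A n n
enum′ (suc A) (suc k) n       = enum′ A n n ++ shL (suc A) (λ m → map (suc A ∷_) (enum′ (suc A) k m)) n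

enum : ℕ → ℕ → List (List ℕ)
enum A n = enum′ A n n

enum′-fuel : ∀ A k l {n} → n ≤ k → n ≤ l → enum′ (suc A) k n ≡ enum′ (suc A) l n
enum′-fuel A zero    zero    p    q    = refl
enum′-fuel A zero    (suc l) z≤n  q    = sym (++-identityʳ _)
enum′-fuel A (suc k) zero    p    z≤n  = ++-identityʳ _
enum′-fuel A (suc k) (suc l) {n} p q = cong (enum′ A n n ++_) (shL-local A {n = n}
  (λ m m<n → cong (map (suc A ∷_)) (enum′-fuel A k l (≤-pred (≤-trans m<n p)) (≤-pred (≤-trans m<n q)))))

next : ℕ → ℕ → List (List ℕ)
next A m = map (suc A ∷_) (enum (suc A) m)

enum-unfold : ∀ A n → enum (suc A) n ≡ enum A n ++ shL (suc A) (next A) n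
enum-unfold A zero    = sym (++-identityʳ _)
enum-unfold A (suc n) = cong (enum A (suc n) ++_) (shL-local A {n = suc n}
  (λ m m<n → cong (map (suc A ∷_)) (enum′-fuel A n m (≤-pred m<n) ≤-refl)))

Bounded : ℕ → ℕ → List ℕ → Set
Bounded A n μ = Linked _≥_ (A ∷ μ) × All (_> 0) μ × sum μ ≡ n

enum-sound : ∀ A n {μ} → μ ∈ enum A n → Bounded A n μ
enum-sound zero    zero (here refl) = [-] , [] , refl
enum-sound (suc A) n {μ} μ∈ = <-rec (λ n → ∀ {μ} → μ ∈ enum (suc A) n → Bounded (suc A) n μ) step n μ∈
  where
  raise : ∀ {μ} → Linked _≥_ (A ∷ μ) → Linked _≥_ (suc A ∷ μ)
  raise [-]     = [-]
  raise (p ∷ l) = m≤n⇒m≤1+n p ∷ l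
  step : ∀ n → (∀ {m} → m < n → ∀ {μ} → μ ∈ enum (suc A) m → Bounded (suc A) m μ) →
         ∀ {μ} → μ ∈ enum (suc A) n → Bounded (suc A) n μ
  step n rec μ∈ with ∈-++⁻ (enum A n) (subst (_ ∈_) (enum-unfold A n) μ∈)
  ... | inj₁ l with d , p , s ← enum-sound A n l = raise d , p , s
  ... | inj₂ r with m , refl , r′ ← ∈-shL⁻ (suc A) {next A} {n} r with ν , ν∈ , refl ← ∈-map⁻ (suc A ∷_) r′
               with d , p , s ← rec (s≤s (m≤n+m m A)) ν∈ = ≤-refl ∷ d , s≤s z≤n ∷ p , cong (suc A +_) s

enum-complete : ∀ A μ → Linked _≥_ (A ∷ μ) → All (_> 0) μ → μ ∈ enum A (sum μ)
enum-complete zero    []      d p = here refl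
enum-complete (suc A) []      d p = subst ([] ∈_) (sym (enum-unfold A 0)) (∈-++⁺ˡ (enum-complete A [] [-] p))
enum-complete A       (x ∷ μ) (x≤A ∷ d) (x>0 ∷ p) = go A x≤A
  where
  μ∈ : μ ∈ enum x (sum μ)
  μ∈ = enum-complete x μ d p
  go : ∀ A → x ≤ A → x ∷ μ ∈ enum A (x + sum μ)
  go zero    x≤0 = contradiction (≤-trans x>0 x≤0) λ ()
  go (suc A) x≤A with m≤n⇒m<n∨m≡n x≤A
  ... | inj₁ (s≤s x≤) = subst (x ∷ μ ∈_) (sym (enum-unfold A _)) (∈-++⁺ˡ (go A x≤))
  ... | inj₂ refl = subst (x ∷ μ ∈_) (sym (enum-unfold A _)) (∈-++⁺ʳ (enum A (x + sum μ)) (∈-shL⁺ (suc A) {next A} (∈-map⁺ (suc A ∷_) μ∈)))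

enum-unique : ∀ A n → Unique (enum A n)
enum-unique zero    zero    = [] ∷ []
enum-unique zero    (suc n) = []
enum-unique (suc A) n = <-rec (λ n → Unique (enum (suc A) n)) step n
  where
  step : ∀ n → (∀ {m} → m < n → Unique (enum (suc A) m)) → Unique (enum (suc A) n)
  step n rec = subst Unique (sym (enum-unfold A n)) (Unq.++⁺ (enum-unique A n)
    (shL-unique (suc A) {next A} (λ m e → Unq.map⁺ ∷-injectiveʳ (rec (subst (m <_) e (s≤s (m≤n+m m A))))))
    disjoint)
    where
    disjoint : ∀ {μ} → μ ∈ enum A n × μ ∈ shL (suc A) (next A) n → _
    disjoint (l , r) with m , refl , r′ ← ∈-shL⁻ (suc A) {next A} {n} r with ν , ν∈ , refl ← ∈-map⁻ (suc A ∷_) r′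
      with (A<A ∷ _) , _ ← enum-sound A n l = 1+n≰n A<A

W : ℕ → (List ℕ → ℕ) → Ser
W A f n = sum (map f (enum A n))

W-unfold : ∀ A f → W (suc A) f ≗ W A f ⊕ sh (suc A) (W (suc A) (f ∘ (suc A ∷_)))
W-unfold A f n = begin
  sum (map f (enum (suc A) n))
    ≡⟨ cong (sum ∘ map f) (enum-unfold A n) ⟩
  sum (map f (enum A n ++ R))
    ≡⟨ cong sum (map-++ f (enum A n) R) ⟩
  sum (map f (enum A n) ++ map f R)
    ≡⟨ sum-++ (map f (enum A n)) (map f R) ⟩
  W A f n + sum (map f R)
    ≡⟨ cong (W A f n +_) (≡.trans (sum-shL (suc A) f _ n) (sh-cong (suc A) (λ m → cong sum (sym (map-∘ (enum (suc A) m)))) n)) ⟩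
  W A f n + sh (suc A) (W (suc A) (f ∘ (suc A ∷_))) n ∎
  where
  open ≡.≡-Reasoning
  R = shL (suc A) (next A) n

sum-map-∈ : ∀ {X : Set} {f g : X → ℕ} xs → (∀ {x} → x ∈ xs → f x ≡ g x) → sum (map f xs) ≡ sum (map g xs)
sum-map-∈ []       h = refl
sum-map-∈ (x ∷ xs) h = cong₂ _+_ (h (here refl)) (sum-map-∈ xs (h ∘ there))

W-local : ∀ A n {f g} → (∀ {μ} → Bounded A n μ → f μ ≡ g μ) → W A f n ≡ W A g n
W-local A n h = sum-map-∈ (enum A n) (λ μ∈ → h (enum-sound A n μ∈))

W-cong : ∀ A {f g} → f ≗ g → W A f ≗ W A g
W-cong A e n = W-local A n (λ {μ} _ → e μ)

-- Counting the enumerated partitions by rank and by crank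

rankOf : List ℕ → ℤ
rankOf μ = ℤ.+ max 0 μ ℤ.- ℤ.+ length μ

ones : List ℕ → ℕ
ones μ = length (filter (_≟ 1) μ)

larger : ℕ → List ℕ → ℕ
larger k μ = length (filter (_>? k) μ)

crankTop : ℕ → List ℕ → ℕ
crankTop zero      μ = max 0 μ
crankTop k@(suc _) μ = larger k μ

crankOf : List ℕ → ℤ
crankOf μ = crankTop (ones μ) μ ℤ.⊖ ones μ

head-max : ∀ {A x μ} → Linked _≥_ (A ∷ x ∷ μ) → max 0 (x ∷ μ) ≡ x
head-max (_ ∷ d) = max≈v⁺ (here refl) (Linked⇒All (λ p q → ≤-trans q p) ≤-refl d) z≤n

W-heads : ∀ A f n → W (suc A) f (suc n) ≡ sumTo A (λ l → sh (suc l) (W (suc l) (f ∘ (suc l ∷_))) (suc n))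
W-heads zero    f n = W-unfold 0 f (suc n)
W-heads (suc A) f n = ≡.trans (W-unfold (suc A) f (suc n))
  (≡.trans (cong (_+ sh (2 + A) (W (2 + A) (f ∘ (2 + A ∷_))) (suc n)) (W-heads A f n))
    (sym (sumTo-last A (λ l → sh (suc l) (W (suc l) (f ∘ (suc l ∷_))) (suc n)))))

W-length : ∀ A χ → W A (λ μ → χ (ℤ.- (ℤ.+ length μ))) ≗ F (rng mi 0 A) χ
W-length zero    χ zero    = +-identityʳ (χ 0ℤ)
W-length zero    χ (suc n) = refl
W-length (suc A) = fix-≗ {I = ℤ → ℕ} A {X = λ χ → W (suc A) (λ μ → χ (ℤ.- (ℤ.+ length μ)))} {A = λ χ → W A (λ μ → χ (ℤ.- (ℤ.+ length μ)))}
  {Y = λ χ → F (rng mi 0 (suc A)) χ} {B = λ χ → F (rng mi 0 A) χ} (_∘ ℤ.pred)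
  (λ χ n → ≡.trans (W-unfold A _ n) (cong (W A (λ μ → χ (ℤ.- (ℤ.+ length μ))) n +_)
    (sh-cong (suc A) (W-cong (suc A) (λ μ → cong χ (neg-suc (length μ)))) n)))
  (F-unfold A mi (rng mi 0 A)) (W-length A)
  where
  neg-suc : ∀ k → -[1+ k ] ≡ ℤ.pred (ℤ.- (ℤ.+ k))
  neg-suc zero    = refl
  neg-suc (suc k) = refl

rank-count : ∀ ψ n → W (suc n) (ψ ∘ rankOf) (suc n) ≡ ∑ (Rank.top ψ) (suc n)
rank-count ψ n = begin
  W (suc n) (ψ ∘ rankOf) (suc n)
    ≡⟨ W-local (suc n) (suc n) (λ {μ} → same μ) ⟩
  W (suc n) f (suc n)
    ≡⟨ W-heads n f n ⟩
  sumTo n (λ l → sh (suc l) (W (suc l) (f ∘ (suc l ∷_))) (suc n))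
    ≡⟨ sumTo-cong n (λ l → sh-cong (suc l) (term l) (suc n)) ⟩
  sumTo n (λ l → Rank.top ψ l (suc n))
    ≡⟨ +-identityʳ _ ⟨
  sumTo n (λ l → Rank.top ψ l (suc n)) + 0
    ≡⟨ cong (sumTo n (λ l → Rank.top ψ l (suc n)) +_) (sh-vanish (2 + n) _ {suc n} ≤-refl) ⟨
  sumTo n (λ l → Rank.top ψ l (suc n)) + Rank.top ψ (suc n) (suc n)
    ≡⟨ sumTo-last n (λ l → Rank.top ψ l (suc n)) ⟨
  ∑ (Rank.top ψ) (suc n) ∎
  where
  open ≡.≡-Reasoning
  f : List ℕ → ℕ
  f []      = ψ 0ℤ
  f (x ∷ μ) = ψ (ℤ.+ x ℤ.- ℤ.+ suc (length μ))
  same : ∀ μ → Bounded (suc n) (suc n) μ → ψ (rankOf μ) ≡ f μ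
  same []      _       = refl
  same (x ∷ μ) (d , _) = cong (λ z → ψ (ℤ.+ z ℤ.- ℤ.+ suc (length μ))) (head-max d)
  term : ∀ l → W (suc l) (f ∘ (suc l ∷_)) ≗ F (rng mi 0 (suc l)) (λ d → ψ (ℤ.+ l ℤ.+ d))
  term l m = ≡.trans (W-cong (suc l) (λ μ → cong ψ (drop (length μ))) m) (W-length (suc l) (λ d → ψ (ℤ.+ l ℤ.+ d)) m)
    where
    drop : ∀ k → ℤ.+ suc l ℤ.- ℤ.+ suc k ≡ ℤ.+ l ℤ.+ ℤ.- (ℤ.+ k)
    drop k = ≡.trans (ℤₚ.[1+m]⊖[1+n]≡m⊖n l k) (sym (ℤₚ.m-n≡m⊖n l k))

W-scale : ∀ A c f → W A (λ μ → c * f μ) ≗ λ n → c * W A f n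
W-scale A c f n = go (enum A n)
  where
  go : ∀ xs → sum (map (λ μ → c * f μ) xs) ≡ c * sum (map f xs)
  go []       = sym (*-zeroʳ c)
  go (x ∷ xs) = ≡.trans (cong (c * f x +_) (go xs)) (sym (*-distribˡ-+ c (f x) _))

W-sumTo : ∀ A k (f : ℕ → List ℕ → ℕ) n → W A (λ μ → sumTo k (λ i → f i μ)) n ≡ sumTo k (λ i → W A (f i) n)
W-sumTo A k f n = go (enum A n)
  where
  go : ∀ xs → sum (map (λ μ → sumTo k (λ i → f i μ)) xs) ≡ sumTo k (λ i → sum (map (f i) xs))
  go []       = sym (sumTo-zero k (λ _ → refl))
  go (x ∷ xs) = ≡.trans (cong (sumTo k (λ i → f i x) +_) (go xs)) (sym (sumTo-+ k (λ i → f i x) (λ i → sum (map (f i) xs))))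

W-zero : ∀ A → W A (λ _ → 0) ≗ λ _ → 0
W-zero A n = go (enum A n)
  where
  go : ∀ xs → sum (map (λ (_ : List ℕ) → 0) xs) ≡ 0
  go []       = refl
  go (x ∷ xs) = go xs

sh-scale : ∀ k c f → sh k (λ m → c * f m) ≗ λ n → c * sh k f n
sh-scale zero    c f n       = refl
sh-scale (suc k) c f zero    = sym (*-zeroʳ c)
sh-scale (suc k) c f (suc n) = sh-scale k c f n

sumTo-cong≤ : ∀ k {f g} → (∀ j → j ≤ k → f j ≡ g j) → sumTo k f ≡ sumTo k g
sumTo-cong≤ zero    h = h 0 z≤n
sumTo-cong≤ (suc k) h = cong₂ _+_ (h 0 z≤n) (sumTo-cong≤ k (λ j l → h (suc j) (s≤s l)))

eq : ℕ → ℕ → ℕ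
eq a x = δ (ℤ.+ a) (ℤ.+ x)

sumTo-eq : ∀ k (g : ℕ → ℕ) {x} → x ≤ k → sumTo k (λ j → g j * eq j x) ≡ g x
sumTo-eq zero    g {zero}  _       = *-identityʳ (g 0)
sumTo-eq (suc k) g {zero}  _       = ≡.trans (cong₂ _+_ (*-identityʳ (g 0)) (sumTo-zero k (λ j → *-zeroʳ (g (suc j))))) (+-identityʳ (g 0))
sumTo-eq (suc k) g {suc x} (s≤s l) = ≡.trans (cong (_+ sumTo k (λ j → g (suc j) * eq j x)) (*-zeroʳ (g 0))) (sumTo-eq k (g ∘ suc) l)

module Ones (ω′ : ℕ) where
  ω = suc ω′

  -- The required number `o` of ones is kept apart from the threshold `ω`: `only-ones` inducts on
  -- it, and o = 0 also serves the partitions without ones.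
  h : ℕ → (ℤ → ℕ) → List ℕ → ℕ
  h o χ μ = eq o (ones μ) * χ (ℤ.+ larger ω μ)

  reject : ∀ x μ → x ≤ ω → larger ω (x ∷ μ) ≡ larger ω μ
  reject x μ l = cong length (filter-reject (_>? ω) (≤⇒≯ l))

  only-ones : ∀ o χ → W 1 (h o χ) ≗ sh o (F [] χ)
  only-ones zero χ n = ≡.trans (W-unfold 0 (h 0 χ) n) (≡.trans (cong₂ _+_ (nil n) (≡.trans (sh-cong 1 (W-zero 1) n) (sh-0 1 n))) (+-identityʳ _))
    where
    nil : W 0 (h 0 χ) ≗ F [] χ
    nil zero    = ≡.trans (+-identityʳ _) (+-identityʳ _)
    nil (suc n) = refl
  only-ones (suc o) χ n = ≡.trans (W-unfold 0 (h (suc o) χ) n) (≡.trans (cong₂ _+_ (nil n)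
      (sh-cong 1 (λ m → ≡.trans (W-cong 1 (λ μ → cong (λ z → eq o (ones μ) * χ (ℤ.+ z)) (reject 1 μ (s≤s z≤n))) m) (only-ones o χ m)) n))
    (sh-sh 1 o (F [] χ) n))
    where
    nil : W 0 (h (suc o) χ) ≗ λ _ → 0
    nil zero    = refl
    nil (suc n) = refl

  small : ∀ o χ k → k ≤ ω′ → W (suc k) (h o χ) ≗ sh o (F (rng ze 1 k) χ)
  small o χ zero    _ = only-ones o χ
  small o χ (suc k) l n = fix-≗ {I = ℕ} (suc k) {X = λ _ → W (2 + k) (h o χ)} {A = λ _ → W (suc k) (h o χ)}
    {Y = λ _ → sh o (F (rng ze 1 (suc k)) χ)} {B = λ _ → sh o (F (rng ze 1 k) χ)} id
    (λ _ m → ≡.trans (W-unfold (suc k) (h o χ) m) (cong (W (suc k) (h o χ) m +_) (sh-cong (2 + k)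
      (W-cong (2 + k) (λ μ → cong (λ z → eq o (ones μ) * χ (ℤ.+ z)) (reject (2 + k) μ (s≤s l)))) m)))
    (λ _ m → ≡.trans (sh-cong o (F-unfold (suc k) ze (rng ze 1 k) χ) m) (≡.trans (sh-⊕ o (F (rng ze 1 k) χ) _ m)
      (cong (sh o (F (rng ze 1 k) χ) m +_) (sh-comm o (2 + k) _ m))))
    (λ _ → small o χ k (≤-trans (n≤1+n k) l)) 0 n

  large : ∀ o k χ → W (k + ω) (h o χ) ≗ sh o (F (rng pl ω k ++ rng ze 1 ω′) χ)
  large o zero    χ = small o χ ω′ ≤-refl
  large o (suc k) χ = fix-≗ {I = ℤ → ℕ} (ω + k) {X = λ χ → W (suc k + ω) (h o χ)} {A = λ χ → W (k + ω) (h o χ)}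
    {Y = λ χ → sh o (F (rng pl ω (suc k) ++ rng ze 1 ω′) χ)} {B = λ χ → sh o (F (rng pl ω k ++ rng ze 1 ω′) χ)} (_∘ ℤ.suc)
    (λ χ m → ≡.trans (W-unfold (k + ω) (h o χ) m) (cong (W (k + ω) (h o χ) m +_)
      (≡.trans (sh-exp (cong suc (+-comm k ω)) _ m) (sh-cong (suc (ω + k)) (W-cong (suc k + ω) (accept χ)) m))))
    (λ χ m → ≡.trans (sh-cong o (F-unfold (ω + k) pl (rng pl ω k ++ rng ze 1 ω′) χ) m) (≡.trans (sh-⊕ o (F (rng pl ω k ++ rng ze 1 ω′) χ) _ m)
      (cong (sh o (F (rng pl ω k ++ rng ze 1 ω′) χ) m +_) (sh-comm o (suc (ω + k)) _ m))))
    (λ χ → large o k χ) χ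
    where
    accept : ∀ χ μ → h o χ (suc (k + ω) ∷ μ) ≡ h o (χ ∘ ℤ.suc) μ
    accept χ μ = cong₂ (λ y z → eq o y * χ (ℤ.+ z)) (cong length (filter-reject (_≟ 1) big))
      (cong length (filter-accept (_>? ω) (s≤s (m≤n+m ω k))))
      where
      big : suc (k + ω) ≢ 1
      big e = contradiction (≡.trans (sym (+-suc k ω′)) (suc-injective e)) λ ()

eq-sym : ∀ a b → eq a b ≡ eq b a
eq-sym zero    zero    = refl
eq-sym zero    (suc b) = refl
eq-sym (suc a) zero    = refl
eq-sym (suc a) (suc b) = eq-sym a b

rng-ze : ∀ a k → Sh (rng ze a k) (rng ze a k)
rng-ze a zero    = []
rng-ze a (suc k) = shz (rng-ze a k)

pair-count : ℕ → ℕ → ℕ → Ser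
pair-count A ω j = W A (λ μ → eq ω (ones μ) * eq j (crankTop ω μ))

pair-count-ones : ∀ ω′ j n → suc ω′ ≤ n → pair-count n (suc ω′) j n ≡ cell (suc ω′) j n
pair-count-ones ω′ j n ω≤n = begin
  W n (h ω (δ (ℤ.+ j))) n
    ≡⟨ cong (λ z → W z (h ω (δ (ℤ.+ j))) n) (m∸n+n≡m ω≤n) ⟨
  W (k + ω) (h ω (δ (ℤ.+ j))) n
    ≡⟨ large ω k (δ (ℤ.+ j)) n ⟩
  sh ω (B (rng pl ω k ++ rng ze 1 ω′) (ℤ.+ j)) n
    ≡⟨ sh-local _≡_ refl ω′ (λ m m<n → Elementary.elementary ω (rng ze 1 ω′) (rng-ze 1 ω′) k j
         (≤-trans (<⇒≤ m<n) (≤-reflexive (sym (m+[n∸m]≡n ω≤n))))) ⟩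
  sh ω (sh (j * suc ω) (F (rng ze 0 j ++ rng ze 1 ω′) one)) n
    ≡⟨ sh-sh ω (j * suc ω) _ n ⟩
  sh (ω + j * suc ω) (F (rng ze 0 j ++ rng ze 1 ω′) one) n
    ≡⟨ sh-cong (ω + j * suc ω) (F-↭ (perm j) one) n ⟩
  cell ω j n ∎
  where
  open ≡.≡-Reasoning
  open Ones ω′
  k = n ∸ ω
  perm : ∀ j → rng ze 0 j ++ rng ze 1 ω′ ↭ sizes ω j
  perm zero    = ↭-reflexive (sym (++-identityʳ (rng ze 1 ω′)))
  perm (suc j) = trans (++⁺ʳ (rng ze 1 ω′) (rng-bottom ze 0 j)) (prep _ (++-comm (rng ze 1 j) (rng ze 1 ω′)))

pair-count-none : ∀ j n → j ≤ 2 + n → pair-count (2 + n) 0 j (2 + n) ≡ cell 0 j (2 + n)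
pair-count-none j n j≤ = begin
  W N (λ μ → eq 0 (ones μ) * eq j (max 0 μ)) N
    ≡⟨ W-local N N (λ {μ} → same μ) ⟩
  W N f N
    ≡⟨ W-heads (suc n) f (suc n) ⟩
  sumTo (suc n) (λ l → sh (suc l) (W (suc l) (f ∘ (suc l ∷_))) N)
    ≡⟨ sumTo-cong (suc n) term ⟩
  sumTo (suc n) (λ l → t l * eq j (suc l))
    ≡⟨ select j j≤ ⟩
  cell 0 j N ∎
  where
  open ≡.≡-Reasoning
  N = 2 + n
  f : List ℕ → ℕ
  f []      = eq j 0
  f (x ∷ μ) = eq 0 (ones (x ∷ μ)) * eq j x
  same : ∀ μ → Bounded N N μ → eq 0 (ones μ) * eq j (max 0 μ) ≡ f μ
  same []      _       = +-identityʳ _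
  same (x ∷ μ) (d , _) = cong (λ z → eq 0 (ones (x ∷ μ)) * eq j z) (head-max d)
  t : ℕ → ℕ
  t zero    = 0
  t (suc l) = sh (2 + l) (F (rng ze 1 (suc l)) one) N
  term : ∀ l → sh (suc l) (W (suc l) (f ∘ (suc l ∷_))) N ≡ t l * eq j (suc l)
  term zero    = ≡.trans (sh-cong 1 (W-zero 1) N) (sh-0 1 N)
  term (suc l) = begin
    sh (2 + l) (W (2 + l) (λ μ → eq 0 (ones μ) * eq j (2 + l))) N
      ≡⟨ sh-cong (2 + l) (λ m → ≡.trans (W-cong (2 + l) (λ μ → ≡.trans (*-comm (eq 0 (ones μ)) _) (cong (eq j (2 + l) *_) (sym (*-identityʳ _)))) m)
           (W-scale (2 + l) (eq j (2 + l)) (Ones.h (suc l) 0 one) m)) N ⟩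
    sh (2 + l) (λ m → eq j (2 + l) * W (2 + l) (Ones.h (suc l) 0 one) m) N
      ≡⟨ sh-scale (2 + l) (eq j (2 + l)) (W (2 + l) (Ones.h (suc l) 0 one)) N ⟩
    eq j (2 + l) * sh (2 + l) (W (2 + l) (Ones.h (suc l) 0 one)) N
      ≡⟨ cong (eq j (2 + l) *_) (sh-cong (2 + l) (Ones.small (suc l) 0 one (suc l) ≤-refl) N) ⟩
    eq j (2 + l) * t (suc l)
      ≡⟨ *-comm (eq j (2 + l)) (t (suc l)) ⟩
    t (suc l) * eq j (2 + l) ∎
  select : ∀ j → j ≤ N → sumTo (suc n) (λ l → t l * eq j (suc l)) ≡ cell 0 j N
  select zero    _       = sumTo-zero (suc n) (λ l → *-zeroʳ (t l))
  select (suc j) (s≤s l) = ≡.trans (sumTo-cong (suc n) (λ l → cong (t l *_) (eq-sym j l))) (≡.trans (sumTo-eq (suc n) t l) (value j))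
    where
    value : ∀ j → t j ≡ cell 0 (suc j) N
    -- `cell 0 1` is q and vanishes in degree N ≥ 2. In degree 1 it would count a partition with
    -- largest part 1 and no ones.
    value zero    = refl
    value (suc j) = sh-exp (sym (*-identityʳ (2 + j))) (F (rng ze 1 (suc j)) one) N

cell-count : ∀ n ω j → ω ≤ 2 + n → j ≤ 2 + n → pair-count (2 + n) ω j (2 + n) ≡ cell ω j (2 + n)
cell-count n zero    j _ l = pair-count-none j n l
cell-count n (suc ω) j l _ = pair-count-ones ω j (2 + n) l

length≤sum : ∀ {μ} → All (_> 0) μ → length μ ≤ sum μ
length≤sum []      = z≤n
length≤sum (p ∷ q) = +-mono-≤ p (length≤sum q)

ones≤ : ∀ {A n μ} → Bounded A n μ → ones μ ≤ n
ones≤ {μ = μ} (_ , p , refl) = ≤-trans (length-filter (_≟ 1) μ) (length≤sum p)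

crankTop≤ : ∀ {n μ} ω → Bounded n n μ → crankTop ω μ ≤ n
crankTop≤ {μ = []}    zero    _                 = z≤n
crankTop≤ {μ = x ∷ μ} zero    (d@(x≤n ∷ _) , _) = ≤-trans (≤-reflexive (head-max d)) x≤n
crankTop≤ {μ = μ}     (suc ω) (_ , p , refl)    = ≤-trans (length-filter (_>? suc ω) μ) (length≤sum p)

sumTo-*ʳ : ∀ k f c → sumTo k (λ j → f j * c) ≡ sumTo k f * c
sumTo-*ʳ zero    f c = refl
sumTo-*ʳ (suc k) f c = ≡.trans (cong (f 0 * c +_) (sumTo-*ʳ k (f ∘ suc) c)) (sym (*-distribʳ-+ c (f 0) (sumTo k (f ∘ suc))))

crank-count : ∀ ψ n → W (2 + n) (ψ ∘ crankOf) (2 + n) ≡ crankSum ψ (2 + n)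
crank-count ψ n = begin
  W N (ψ ∘ crankOf) N
    ≡⟨ W-local N N (λ {μ} → expand μ) ⟩
  W N (λ μ → sumTo N (λ ω → sumTo N (λ j → ψ (j ℤ.⊖ ω) * eq j (crankTop ω μ) * eq ω (ones μ)))) N
    ≡⟨ W-sumTo N N (λ ω μ → sumTo N (λ j → ψ (j ℤ.⊖ ω) * eq j (crankTop ω μ) * eq ω (ones μ))) N ⟩
  sumTo N (λ ω → W N (λ μ → sumTo N (λ j → ψ (j ℤ.⊖ ω) * eq j (crankTop ω μ) * eq ω (ones μ))) N)
    ≡⟨ sumTo-cong≤ N (λ ω ω≤ → ≡.trans (W-sumTo N N (λ j μ → ψ (j ℤ.⊖ ω) * eq j (crankTop ω μ) * eq ω (ones μ)) N)
         (sumTo-cong≤ N (λ j j≤ → ≡.trans (W-cong N (λ μ → ≡.trans (*-assoc (ψ (j ℤ.⊖ ω)) (eq j (crankTop ω μ)) (eq ω (ones μ))) (cong (ψ (j ℤ.⊖ ω) *_) (*-comm (eq j (crankTop ω μ)) (eq ω (ones μ))))) N)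
           (≡.trans (W-scale N (ψ (j ℤ.⊖ ω)) (λ μ → eq ω (ones μ) * eq j (crankTop ω μ)) N) (cong (ψ (j ℤ.⊖ ω) *_) (cell-count n ω j ω≤ j≤)))))) ⟩
  crankSum ψ N ∎
  where
  open ≡.≡-Reasoning
  N = 2 + n
  -- Only the term with ω the number of ones and j the `crankTop` survives; both are at most N, so
  -- the finite ranges contain it.
  expand : ∀ μ → Bounded N N μ →
    ψ (crankOf μ) ≡ sumTo N (λ ω → sumTo N (λ j → ψ (j ℤ.⊖ ω) * eq j (crankTop ω μ) * eq ω (ones μ)))
  expand μ b = sym (≡.trans (sumTo-cong N (λ ω → sumTo-*ʳ N (λ j → ψ (j ℤ.⊖ ω) * eq j (crankTop ω μ)) (eq ω (ones μ))))
    (≡.trans (sumTo-eq N (λ ω → sumTo N (λ j → ψ (j ℤ.⊖ ω) * eq j (crankTop ω μ))) (ones≤ b))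
      (sumTo-eq N (λ j → ψ (j ℤ.⊖ ones μ)) (crankTop≤ (ones μ) b))))

-- Cumulative counts of both statistics

leq : ℤ → ℤ → ℕ
leq t c = if does (c ℤ.≤? t) then 1 else 0

leq-yes : ∀ {t c} → c ℤ.≤ t → leq t c ≡ 1
leq-yes {t} {c} p = cong (if_then 1 else 0) (dec-true (c ℤ.≤? t) p)

leq-no : ∀ {t c} → ¬ (c ℤ.≤ t) → leq t c ≡ 0
leq-no {t} {c} p = cong (if_then 1 else 0) (dec-false (c ℤ.≤? t) p)

ge-yes : ∀ m {c} → ℤ.+ m ℤ.≤ c → ge m c ≡ 1
ge-yes zero    (ℤ.+≤+ _) = refl
ge-yes (suc m) p         = ge-yes m (ℤₚ.pred-mono p)

ge-no : ∀ m {c} → ¬ (ℤ.+ m ℤ.≤ c) → ge m c ≡ 0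
ge-no zero    {ℤ.+ n}    p = contradiction (ℤ.+≤+ z≤n) p
ge-no zero    { -[1+ n ]} p = refl
ge-no (suc m) {c}        p = ge-no m (λ q → p (subst (ℤ.+ suc m ℤ.≤_) (ℤₚ.suc-pred c) (ℤₚ.suc-mono q)))

leq-neg : ∀ m c → leq (ℤ.- (ℤ.+ m)) c ≡ ge m (ℤ.- c)
leq-neg m c with c ℤ.≤? ℤ.- (ℤ.+ m)
... | yes p = sym (ge-yes m (subst (ℤ._≤ ℤ.- c) (ℤₚ.neg-involutive (ℤ.+ m)) (ℤₚ.neg-mono-≤ p)))
... | no ¬p = sym (ge-no m (λ q → ¬p (subst (ℤ._≤ ℤ.- (ℤ.+ m)) (ℤₚ.neg-involutive c) (ℤₚ.neg-mono-≤ q))))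

leq-ge : ∀ m c → leq (ℤ.pred (ℤ.+ m)) c + ge m c ≡ 1
leq-ge m c with ℤ.+ m ℤ.≤? c
... | yes p = cong₂ _+_ (leq-no (λ q → ℤₚ.<-irrefl refl (ℤₚ.i≤pred[j]⇒i<j (ℤₚ.≤-trans p q)))) (ge-yes m p)
... | no ¬p = cong₂ _+_ (leq-yes (ℤₚ.i<j⇒i≤pred[j] (ℤₚ.≰⇒> ¬p))) (ge-no m ¬p)

W-+ : ∀ A f g → W A (λ μ → f μ + g μ) ≗ W A f ⊕ W A g
W-+ A f g n = W-sumTo A 1 (λ { zero → f ; (suc _) → g }) n

module Counts (n : ℕ) where
  N = 2 + n

  crank≤ rank≤ : ℤ → ℕ
  crank≤ t = W N (leq t ∘ crankOf) N
  rank≤  t = W N (leq t ∘ rankOf) N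

  R-ge : ∀ M → W N (ge (suc M) ∘ rankOf) N ≡ Frame.Rser M N
  R-ge M = ≡.trans (rank-count (ge (suc M)) (suc n)) (≡.trans (cong (λ z → ∑ (Rank.top (ge z)) N) (+-comm 1 M)) (rank-ge M 1 N))

  R₀-ge : ∀ M → W N (ge M ∘ rankOf) N ≡ Frame.R₀ser M N
  R₀-ge M = ≡.trans (rank-count (ge M) (suc n)) (≡.trans (cong (λ z → ∑ (Rank.top (ge z)) N) (sym (+-identityʳ M))) (rank-ge M 0 N))

  C-ge : ∀ M → W N (ge (suc M) ∘ crankOf) N ≡ Frame.Cser M N
  C-ge M = ≡.trans (crank-count (ge (suc M)) n) (crank-ge M N)

  -- Symmetry about 0 turns counts up to a nonpositive threshold into tail counts; for thresholds of
  -- the form m - 1 with m ≥ 0, `complement` does this instead.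
  rank-neg : ∀ m → rank≤ (ℤ.- (ℤ.+ m)) ≡ W N (ge m ∘ rankOf) N
  rank-neg m = ≡.trans (W-cong N (λ μ → leq-neg m (rankOf μ)) N) (≡.trans (rank-count (ge m ∘ ℤ.-_) (suc n))
    (≡.trans (rank-flip (ge m) N) (sym (rank-count (ge m) (suc n)))))

  crank-neg : ∀ m → crank≤ (ℤ.- (ℤ.+ m)) ≡ W N (ge m ∘ crankOf) N
  crank-neg m = ≡.trans (W-cong N (λ μ → leq-neg m (crankOf μ)) N) (≡.trans (crank-count (ge m ∘ ℤ.-_) n)
    (≡.trans (crank-flip (ge m) N) (sym (crank-count (ge m) n))))

  complement : ∀ (st : List ℕ → ℤ) m → W N (leq (ℤ.pred (ℤ.+ m)) ∘ st) N + W N (ge m ∘ st) N ≡ W N (λ _ → 1) N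
  complement st m = ≡.trans (sym (W-+ N _ _ N)) (W-cong N (λ μ → leq-ge m (st μ)) N)

  swap-≤ : ∀ {a b c d t} → a + b ≡ t → c + d ≡ t → b ≤ d → c ≤ a
  swap-≤ {a} {b} {c} {d} p q b≤d = +-cancelʳ-≤ b c a (≤-trans (+-monoʳ-≤ c b≤d) (≤-reflexive (≡.trans q (sym p))))

  neg₁ : ∀ M → rank≤ -[1+ M ] ≤ crank≤ -[1+ M ]
  neg₁ M = begin
    rank≤ -[1+ M ]     ≡⟨ ≡.trans (rank-neg (suc M)) (R-ge M) ⟩
    Frame.Rser M N     ≤⟨ R≼C M N ⟩
    Frame.Cser M N     ≡⟨ ≡.trans (crank-neg (suc M)) (C-ge M) ⟨
    crank≤ -[1+ M ]    ∎
    where open ≤-Reasoning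

  neg₂ : ∀ M → crank≤ -[1+ M ] ≤ rank≤ (ℤ.- (ℤ.+ M))
  neg₂ M = begin
    crank≤ -[1+ M ]          ≡⟨ ≡.trans (crank-neg (suc M)) (C-ge M) ⟩
    Frame.Cser M N           ≤⟨ C≼R₀ M N ⟩
    Frame.R₀ser M N          ≡⟨ ≡.trans (rank-neg M) (R₀-ge M) ⟨
    rank≤ (ℤ.- (ℤ.+ M))      ∎
    where open ≤-Reasoning

  pos₁ : ∀ M → crank≤ (ℤ.+ M) ≤ rank≤ (ℤ.+ M)
  pos₁ M = swap-≤ (complement rankOf (suc M)) (complement crankOf (suc M)) (begin
    W N (ge (suc M) ∘ rankOf) N     ≡⟨ R-ge M ⟩
    Frame.Rser M N                  ≤⟨ R≼C M N ⟩
    Frame.Cser M N                  ≡⟨ C-ge M ⟨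
    W N (ge (suc M) ∘ crankOf) N    ∎)
    where open ≤-Reasoning

  pos₂ : ∀ M → rank≤ (ℤ.pred (ℤ.+ M)) ≤ crank≤ (ℤ.+ M)
  pos₂ M = swap-≤ (complement crankOf (suc M)) (complement rankOf M) (begin
    W N (ge (suc M) ∘ crankOf) N    ≡⟨ C-ge M ⟩
    Frame.Cser M N                  ≤⟨ C≼R₀ M N ⟩
    Frame.R₀ser M N                 ≡⟨ R₀-ge M ⟨
    W N (ge M ∘ rankOf) N           ∎)
    where open ≤-Reasoning

-- From counts to sorted listings

parts-injective : ∀ {n} {p q : Partition n} → parts p ≡ parts q → p ≡ q
parts-injective {p = mkPartition _ d₁ p₁ s₁} {mkPartition _ d₂ p₂ s₂} refl
  rewrite Linked.irrelevant ≤-irrelevant d₁ d₂ | All.irrelevant ≤-irrelevant p₁ p₂ | ≡-irrelevant s₁ s₂ = refl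

parts-bounded : ∀ {n} (p : Partition n) → Linked _≥_ (n ∷ parts p)
parts-bounded (mkPartition []      d p refl) = [-]
parts-bounded (mkPartition (x ∷ μ) d p refl) = m≤m+n x (sum μ) ∷ d

crank-crankOf : ∀ {n} (p : Partition n) → crank p ≡ crankOf (parts p)
crank-crankOf p with numOnes p
... | zero  = refl
... | suc _ = refl

-- The listing and `enum n n` are free of duplicates and have the same members, hence are
-- permutations of each other; ties thereby become irrelevant.
listing-sum : ∀ {n k} (e : Fin k ↔ Partition n) (f : List ℕ → ℕ) → sum (tabulate (f ∘ parts ∘ Inverse.to e)) ≡ W n f n
listing-sum {n} e f = ≡.trans (cong sum (sym (map-tabulate (parts ∘ to) f))) (sum-↭ (↭.map⁺ f same))
  where
  open Inverse e
  unique : Unique (tabulate (parts ∘ to))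
  unique = Unq.tabulate⁺ (λ {i} {j} q → ≡.trans (sym (strictlyInverseʳ i)) (≡.trans (cong from (parts-injective q)) (strictlyInverseʳ j)))
  fwd : ∀ {μ} → μ ∈ tabulate (parts ∘ to) → μ ∈ enum n n
  fwd μ∈ with i , refl ← ∈-tabulate⁻ μ∈ = subst (λ z → parts (to i) ∈ enum n z) (sum≡n (to i))
    (enum-complete n (parts (to i)) (parts-bounded (to i)) (positive (to i)))
  bwd : ∀ {μ} → μ ∈ enum n n → μ ∈ tabulate (parts ∘ to)
  bwd {μ} μ∈ with d , p , s ← enum-sound n n μ∈ = subst (_∈ tabulate (parts ∘ to)) (cong parts (strictlyInverseˡ q)) (∈-tabulate⁺ (from q))
    where
    q : Partition n
    q = mkPartition μ (Linked.tail d) p s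
  same : tabulate (parts ∘ to) ↭ enum n n
  same = ∼bag⇒↭ (unique∧set⇒bag unique (enum-unique n n) (mk⇔ fwd bwd))

module Segment where
  Increasing : ∀ {k} → (Fin k → ℤ) → Set
  Increasing a = ∀ {i j} → i Fin.≤ j → a i ℤ.≤ a j

  below : ∀ {k} → (Fin k → ℤ) → ℤ → ℕ
  below a t = sum (tabulate (leq t ∘ a))

  <-below : ∀ {k} (a : Fin k → ℤ) → Increasing a → ∀ {t} i → a i ℤ.≤ t → toℕ i < below a t
  <-below a inc {t} Fin.zero    p = ≤-trans (≤-reflexive (sym (leq-yes p))) (m≤m+n _ _)
  <-below a inc {t} (Fin.suc i) p = +-mono-≤ (≤-reflexive (sym (leq-yes (ℤₚ.≤-trans (inc {Fin.zero} {Fin.suc i} z≤n) p))))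
    (<-below (a ∘ Fin.suc) (inc ∘ s≤s) i p)

  below-≤ : ∀ {k} (a : Fin k → ℤ) → Increasing a → ∀ {t} i → ¬ (a i ℤ.≤ t) → below a t ≤ toℕ i
  below-≤ {suc zero}    a inc Fin.zero    p = ≤-reflexive (≡.trans (+-identityʳ _) (leq-no p))
  below-≤ {suc (suc k)} a inc Fin.zero    p = +-mono-≤ (≤-reflexive (leq-no p))
    (below-≤ (a ∘ Fin.suc) (inc ∘ s≤s) Fin.zero (λ q → p (ℤₚ.≤-trans (inc z≤n) q)))
  below-≤ {suc k}       a inc {t} (Fin.suc i) p = +-mono-≤ leq≤1 (below-≤ (a ∘ Fin.suc) (inc ∘ s≤s) i p)
    where
    leq≤1 : leq t (a Fin.zero) ≤ 1
    leq≤1 with a Fin.zero ℤ.≤? t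
    ... | yes _ = ≤-refl
    ... | no  _ = z≤n

  -- In an increasing listing the places of value at most t form an initial segment of length
  -- `below a t`, so an inequality of counts transfers a bound at equal places.
  transfer : ∀ {k l} (a : Fin k → ℤ) (b : Fin l → ℤ) → Increasing a → Increasing b → ∀ {i j s t} →
    toℕ i ≡ toℕ j → below a s ≤ below b t → a i ℤ.≤ s → b j ℤ.≤ t
  transfer a b inc inc′ {i} {j} {s} {t} i≡j le p with b j ℤ.≤? t
  ... | yes q = q
  ... | no ¬q = contradiction (≤-trans (<-below a inc i p) (≤-trans le (≤-trans (below-≤ b inc′ j ¬q) (≤-reflexive (sym i≡j))))) (<-irrefl refl)

squeeze : ∀ {a r} → a ℤ.≤ r → r ℤ.≤ ℤ.suc a → r ≡ a ⊎ r ≡ ℤ.suc a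
squeeze {a} {r} p q with r ℤ.≤? a
... | yes r≤a = inj₁ (ℤₚ.≤-antisym r≤a p)
... | no  r≰a = inj₂ (ℤₚ.≤-antisym q (ℤₚ.i<j⇒suc[i]≤j (ℤₚ.≰⇒> r≰a)))

Conclusion : ℤ → ℤ → Set
Conclusion c r = (c ≡ 0ℤ → c - r ≡ 0ℤ) × (0ℤ ℤ.< c → (c - r ≡ 0ℤ) ⊎ (c - r ≡ 1ℤ)) × (c ℤ.< 0ℤ → (c - r ≡ 0ℤ) ⊎ (c - r ≡ -1ℤ))

suc-minus : ∀ a → ℤ.suc a - a ≡ 1ℤ
suc-minus a = ≡.trans (ℤₚ.+-assoc 1ℤ a (ℤ.- a)) (cong ℤ.suc (ℤₚ.+-inverseʳ a))

minus-suc : ∀ a → a - ℤ.suc a ≡ -1ℤ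
minus-suc a = begin
  a - ℤ.suc a               ≡⟨ cong (λ z → a ℤ.+ z) (ℤₚ.neg-distrib-+ 1ℤ a) ⟩
  a ℤ.+ (-1ℤ - a)           ≡⟨ ℤₚ.+-assoc a -1ℤ (ℤ.- a) ⟨
  a ℤ.+ -1ℤ - a             ≡⟨ cong (_- a) (ℤₚ.+-comm a -1ℤ) ⟩
  ℤ.pred a - a              ≡⟨ ℤₚ.+-assoc -1ℤ a (ℤ.- a) ⟩
  ℤ.pred (a - a)            ≡⟨ cong ℤ.pred (ℤₚ.+-inverseʳ a) ⟩
  -1ℤ                       ∎
  where open ≡.≡-Reasoning

-- For c > 0, `p₁` gives r ≤ c, and `p₂` at c - 1, read contrapositively, gives r ≥ c - 1. For c <
-- 0, `n₁` and `n₂` confine r to c and c + 1 likewise. At c = 0, `p₁` and `n₁` leave only 0.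
conclude : ∀ c r →
  (∀ M → r ℤ.≤ -[1+ M ] → c ℤ.≤ -[1+ M ]) → (∀ M → c ℤ.≤ -[1+ M ] → r ℤ.≤ ℤ.- (ℤ.+ M)) →
  (∀ M → c ℤ.≤ ℤ.+ M → r ℤ.≤ ℤ.+ M) → (∀ M → r ℤ.≤ ℤ.pred (ℤ.+ M) → c ℤ.≤ ℤ.+ M) → Conclusion c r
conclude c r n₁ n₂ p₁ p₂ = zero-case , pos-case c refl , neg-case c refl
  where
  zero-case : c ≡ 0ℤ → c - r ≡ 0ℤ
  zero-case refl = cong (0ℤ -_) (ℤₚ.≤-antisym (p₁ 0 ℤₚ.≤-refl) (ℤₚ.i<j⇒suc[i]≤j (ℤₚ.≰⇒> (λ q → contradiction (n₁ 0 q) λ ()))))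
  pos-case : ∀ d → d ≡ c → 0ℤ ℤ.< c → (c - r ≡ 0ℤ) ⊎ (c - r ≡ 1ℤ)
  pos-case (ℤ.+ zero)  refl (ℤ.+<+ ())
  pos-case (ℤ.+ suc k) refl _ with squeeze {ℤ.+ k} {r} (subst (ℤ._≤ r) (ℤₚ.suc-pred (ℤ.+ k)) (ℤₚ.i<j⇒suc[i]≤j
    (ℤₚ.≰⇒> (λ q → 1+n≰n (ℤₚ.drop‿+≤+ (p₂ k q)))))) (p₁ (suc k) ℤₚ.≤-refl)
  ... | inj₁ refl = inj₂ (suc-minus (ℤ.+ k))
  ... | inj₂ refl = inj₁ (ℤₚ.+-inverseʳ (ℤ.+ suc k))
  neg-case : ∀ d → d ≡ c → c ℤ.< 0ℤ → (c - r ≡ 0ℤ) ⊎ (c - r ≡ -1ℤ)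
  neg-case (ℤ.+ k) refl (ℤ.+<+ ())
  neg-case -[1+ k ] refl _ with squeeze {c} {r} (ℤₚ.i<j⇒suc[i]≤j
    (ℤₚ.≰⇒> (λ q → 1+n≰n (ℤₚ.drop‿-≤- (n₁ (suc k) q))))) (subst (r ℤ.≤_) (next-neg k) (n₂ k ℤₚ.≤-refl))
    where
    next-neg : ∀ k → ℤ.- (ℤ.+ k) ≡ ℤ.suc -[1+ k ]
    next-neg zero    = refl
    next-neg (suc k) = refl
  ... | inj₁ refl = inj₁ (ℤₚ.+-inverseʳ c)
  ... | inj₂ refl = inj₂ (minus-suc c)

parts-one : (p : Partition 1) → parts p ≡ 1 ∷ []
parts-one (mkPartition (suc zero ∷ [])          d p s) = refl
parts-one (mkPartition (suc zero ∷ suc _ ∷ _)   d p ())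
parts-one (mkPartition (suc zero ∷ zero ∷ _)    d (_ ∷ () ∷ _) s)
parts-one (mkPartition (suc (suc _) ∷ _)        d p ())
parts-one (mkPartition (zero ∷ _)               d (() ∷ _) s)

theorem1p5 : (n : ℕ) → n ≥ 1 →
  (C : OrderedListing n crank) (R : OrderedListing n rank) (p : Partition n) →
  let d = crank p - rank (Inverse.to (τ C R) p) in
    (crank p ≡ 0ℤ → d ≡ 0ℤ)
    × (0ℤ ℤ.< crank p → (d ≡ 0ℤ) ⊎ (d ≡ 1ℤ))
    × (crank p ℤ.< 0ℤ → (d ≡ 0ℤ) ⊎ (d ≡ -1ℤ))
-- The only partition of 1 has crank -1 and rank 0.
theorem1p5 (suc zero) _ C R p = subst₂ Conclusion
  (sym (≡.trans (crank-crankOf p) (cong crankOf (parts-one p)))) (cong rankOf (sym (parts-one (Inverse.to (τ C R) p))))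
  ((λ ()) , (λ ()) , (λ _ → inj₂ refl))
theorem1p5 (suc (suc n)) _ C R p = conclude (crank p) (rank q)
  (λ M → back (neg₁ M)) (λ M → forth (neg₂ M)) (λ M → forth (pos₁ M)) (λ M → back (pos₂ M))
  where
  open Counts n
  open Segment
  q = Inverse.to (τ C R) p
  i = Inverse.from (enumerate C) p
  j = Fin.cast (sizes-agree C R) i
  c : Fin (size C) → ℤ
  c = crank ∘ Inverse.to (enumerate C)
  r : Fin (size R) → ℤ
  r = rank ∘ Inverse.to (enumerate R)
  i≡j : toℕ i ≡ toℕ j
  i≡j = sym (toℕ-cast (sizes-agree C R) i)
  ci : c i ≡ crank p
  ci = cong crank (Inverse.strictlyInverseˡ (enumerate C) p)
  below-c : ∀ t → below c t ≡ crank≤ t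
  below-c t = ≡.trans (cong sum (tabulate-cong (λ k → cong (leq t) (crank-crankOf (Inverse.to (enumerate C) k)))))
    (listing-sum (enumerate C) (leq t ∘ crankOf))
  below-r : ∀ t → below r t ≡ rank≤ t
  below-r t = listing-sum (enumerate R) (leq t ∘ rankOf)
  forth : ∀ {s t} → crank≤ s ≤ rank≤ t → crank p ℤ.≤ s → rank q ℤ.≤ t
  forth {s} {t} le h = transfer c r (increasing C) (increasing R) {i} {j} i≡j
    (subst₂ _≤_ (sym (below-c s)) (sym (below-r t)) le) (subst (ℤ._≤ s) (sym ci) h)
  back : ∀ {s t} → rank≤ s ≤ crank≤ t → rank q ℤ.≤ s → crank p ℤ.≤ t
  back {s} {t} le h = subst (ℤ._≤ t) ci (transfer r c (increasing R) (increasing C) {j} {i} (sym i≡j)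
    (subst₂ _≤_ (sym (below-r s)) (sym (below-c t)) le) h)
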